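{- Let $\Sigma=(B,\sigma)$ be a signed graph whose underlying graph $B$ is a block that is neither a single edge nor a circle. Let $e$ be an edge of $B$ and $C$ a circle of $B$ containing $e$. Then $e$ is a battery with circle $C$ (i.e. either $[e,C,-]$ or $[e,C,+]$ holds) if and only if $B$ is $C$-layered, $e$ lies in a handle of $C$, and one of the following holds: (1) the other handle of $C$ (the one not containing $e$) contains a balancing edge of $\Sigma$; in this case $[e,C,-]$ is a negative battery; (2) for every bridge $D$ of $C$ and every path $P$ through $D$, with endpoints $u\neq w$, both circles formed by $P$ together with one of the two $u$–$w$ paths of $C$ are negative; in this case $[e,C,+]$ is a positive battery.
   Context: A signed graph $\Sigma=(G,\sigma)$ is a finite graph $G$ with signature $\sigma:E(G)\to\{+,-\}$. A circle is a connected 2-regular subgraph; its sign is the product of its edge signs. A (sub)graph is balanced if all its circles are positive. Switching by $\zeta:V(G)\to\{+,-\}$ replaces $\sigma(e)$ by $\zeta(u)\sigma(e)\zeta(w)$ for each edge $e$ with endpoints $u,w$. An edge $b$ is a balancing edge of $\Sigma$ if $\Sigma$ can be switched to a signature in which $b$ is the only negative edge. A block is a maximal subgraph without a cutpoint. For a circle $C$, a chord is an edge not in $C$ joining two distinct vertices of $C$; a bridge of $C$ is either a chord of $C$ or a connected component $D$ of $G\setminus V(C)$ together with all edges joining $D$ to $C$; its vertices of attachment are its vertices on $C$; a path through a bridge $D$ is a path in $D$ whose endpoints are two distinct vertices of attachment of $D$. Two chords $c_1,c_2$ of $C$ cross if $C\cup c_1\cup c_2$ is a subdivision of $K_4$.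 The endpoints of chords partition $C$ into paths called segments; a segment is a handle if its two endpoints are joined by a chord. A circle with chords is 2-handled if no two chords cross and there are exactly two handles. If every bridge of $C$ has exactly two vertices of attachment, $C^*$ is obtained from $C$ by adding, for each bridge, one chord joining its two vertices of attachment; segments and handles of $C$ are then those determined by $C^*$. The graph is $C$-layered if every bridge of $C$ has exactly two vertices of attachment and $C^*$ is 2-handled. An edge $e$ is a negative battery with circle $C$, written $[e,C,-]$, if $C$ is a negative circle containing $e$ and is the only negative circle containing $e$; it is a positive battery $[e,C,+]$ if $C$ is a positive circle containing $e$ and is the only positive circle containing $e$. -}

module Defs where

open import Data.Bool.Base using (if_then_else_)
open import Data.Fin.Base as Fin using (Fin)
open import Data.Fin.Properties using (_≟_)
open import Data.Fin.Subset using (Subset; _∈_; _∉_; _∪_; _∩_; ∁; ⊤; ⊥; ⁅_⁆; ∣_∣; Nonempty)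
open import Data.List.Base using (List; []; _∷_; foldr)
import Data.List.Membership.Propositional as List
open import Data.List.Relation.Unary.All using (All)
open import Data.List.Relation.Unary.Unique.Propositional using (Unique)
open import Data.Nat.Base as ℕ using (ℕ)
open import Data.Product.Base using (Σ-syntax; ∃; ∃-syntax; _×_; _,_; proj₁; proj₂)
open import Data.Sign.Base as Sign using (Sign)
import Data.Sign.Properties as Sign
open import Data.Sum.Base using (_⊎_; inj₁; inj₂)
open import Data.Unit.Base as Unit using ()
open import Data.Vec.Base using (lookup; tabulate)
open import Function.Bundles using (_⇔_)
open import Function.Definitions using (Injective)
open import Relation.Binary.PropositionalEquality using (_≡_; _≢_)
open import Relation.Nullary using (¬_; does)
open import Algebra.Properties.CommutativeMonoid.Sum Sign.*-commutativeMonoid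
  using () renaming (sum to product)

-- Multigraphs: loops and parallel edges are allowed.  The order of the two
-- ends of an edge carries no meaning.

record Graph (V E : Set) : Set where
  field ends : E → V × V

  Incident : E → V → Set
  Incident x v = proj₁ (ends x) ≡ v ⊎ proj₂ (ends x) ≡ v

  Joins : E → V → V → Set
  Joins x u v = ends x ≡ (u , v) ⊎ ends x ≡ (v , u)

  data Walk : V → V → Set where
    []   : ∀ {u} → Walk u u
    step : ∀ {u v w} (x : E) → Joins x u v → Walk v w → Walk u w

  vertices : ∀ {u w} → Walk u w → List V
  vertices {u} []           = u ∷ []
  vertices {u} (step _ _ p) = u ∷ vertices p

  edges : ∀ {u w} → Walk u w → List E
  edges []           = []
  edges (step x _ p) = x ∷ edges p

  IsPathIn : (E → Set) → ∀ {u w} → Walk u w → Set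
  IsPathIn F p = Unique (vertices p) × All F (edges p)

  -- The subgraph with edge set F (and no isolated vertices) arises from K₄ by
  -- replacing its edges by independent paths between the branch vertices.
  record IsK₄Subdivision (F : E → Set) : Set where
    field
      branch        : Fin 4 → V
      branch-inj    : Injective _≡_ _≡_ branch
      path          : ∀ i j → i Fin.< j → Walk (branch i) (branch j)
      path-isPathIn : ∀ i j i<j → IsPathIn F (path i j i<j)
      independent   : ∀ i j i<j k l k<l → ¬ (i ≡ k × j ≡ l) →
                      ∀ v → v List.∈ vertices (path i j i<j) →
                      v List.∈ vertices (path k l k<l) →
                      v ≡ branch i ⊎ v ≡ branch j
      covers        : ∀ x → F x → ∃[ i ] ∃[ j ] Σ[ i<j ∈ i Fin.< j ]
                      x List.∈ edges (path i j i<j)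

module FiniteGraph {n m : ℕ} (G : Graph (Fin n) (Fin m)) where
  open Graph G public

  edgeSet : ∀ {u w} → Walk u w → Subset m
  edgeSet p = foldr (λ x F → ⁅ x ⁆ ∪ F) ⊥ (edges p)

  -- Vertex v belongs to the subgraph spanned by the edges F.
  Touches : Subset m → Fin n → Set
  Touches F v = ∃[ x ] x ∈ F × Incident x v

  -- A loop counts twice.
  degree : Subset m → Fin n → ℕ
  degree F v = ∣ F ∩ tabulate (λ x → does (proj₁ (ends x) ≟ v)) ∣
         ℕ.+ ∣ F ∩ tabulate (λ x → does (proj₂ (ends x) ≟ v)) ∣

  -- A 2-regular subgraph has no isolated vertices, so circles are represented
  -- by their edge sets.
  record IsCircle (C : Subset m) : Set where
    field
      nonempty  : Nonempty C
      regular   : ∀ v → Touches C v → degree C v ≡ 2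
      connected : ∀ u v → Touches C u → Touches C v →
                  Σ[ p ∈ Walk u v ] All (_∈ C) (edges p)

  -- v is the only vertex common to two nonempty sets of edges that partition
  -- the edges.  For loopless graphs this is the usual notion; in addition, the
  -- vertex of a loop is a cutpoint if it is incident with any other edge.
  IsCutpoint : Fin n → Set
  IsCutpoint v = ∃[ F ] Touches F v × Touches (∁ F) v ×
    (∀ w → Touches F w → Touches (∁ F) w → w ≡ v)

  record IsBlock : Set where
    field
      connected  : ∀ u v → Walk u v
      noCutpoint : ∀ v → ¬ IsCutpoint v

  module _ (C : Subset m) where

    IsChord : Fin m → Set
    IsChord x = x ∉ C × ∃[ u ] ∃[ w ] u ≢ w × Joins x u w × Touches C u × Touches C w

    -- D is the vertex set of a connected component of G ∖ V(C).
    record IsOuterComponent (D : Subset n) : Set where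
      field
        nonempty  : Nonempty D
        avoids    : ∀ v → v ∈ D → ¬ Touches C v
        connected : ∀ u v → u ∈ D → v ∈ D → Σ[ p ∈ Walk u v ] All (_∈ D) (vertices p)
        maximal   : ∀ x u v → Joins x u v → u ∈ D → ¬ Touches C v → v ∈ D

    -- Elements differing only in their proof component stand for the same
    -- bridge; in C* below they yield parallel chords with the same ends, which
    -- affect neither crossing nor segments nor handles.
    data Bridge : Set where
      chord     : (x : Fin m) → IsChord x → Bridge
      component : (D : Subset n) → IsOuterComponent D → Bridge

    _∈ᵇ_ : Fin m → Bridge → Set
    x ∈ᵇ chord y _     = x ≡ y
    x ∈ᵇ component D _ = ∃[ u ] ∃[ w ] Joins x u w × u ∈ D × (w ∈ D ⊎ Touches C w)

    Attachment : Bridge → Fin n → Set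
    Attachment D v = Touches C v × ∃[ x ] x ∈ᵇ D × Incident x v

    AttachedExactlyAt : Bridge → Fin n × Fin n → Set
    AttachedExactlyAt D (u , w) = u ≢ w × (∀ v → Attachment D v ⇔ (v ≡ u ⊎ v ≡ w))

    -- C together with a family of chords, given by their pairs of ends.
    module WithChords {I : Set} (chordEnds : I → Fin n × Fin n) where

      C⁺ : Graph (Fin n) ((∃[ x ] x ∈ C) ⊎ I)
      C⁺ = record { ends = λ { (inj₁ (x , _)) → ends x ; (inj₂ i) → chordEnds i } }

      C∪_∪_ : I → I → (∃[ x ] x ∈ C) ⊎ I → Set
      (C∪ i ∪ j) (inj₁ _) = Unit.⊤
      (C∪ i ∪ j) (inj₂ k) = k ≡ i ⊎ k ≡ j

      Cross : I → I → Set
      Cross i j = Graph.IsK₄Subdivision C⁺ (C∪ i ∪ j)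

      ChordEnd : Fin n → Set
      ChordEnd v = ∃[ i ] Graph.Incident C⁺ (inj₂ i) v

      -- S is the edge set of a segment with endpoints u and w.
      SegmentBetween : Fin n → Fin n → Subset m → Set
      SegmentBetween u w S = u ≢ w × ChordEnd u × ChordEnd w ×
        (Σ[ p ∈ Walk u w ] IsPathIn (_∈ C) p × edgeSet p ≡ S ×
          (∀ v → v List.∈ vertices p → ChordEnd v → v ≡ u ⊎ v ≡ w))

      IsHandle : Subset m → Set
      IsHandle H = ∃[ u ] ∃[ w ] SegmentBetween u w H × ∃[ i ] Graph.Joins C⁺ (inj₂ i) u w

      record TwoHandled : Set where
        field
          noCrossing : ∀ i j → i ≢ j → ¬ Cross i j
          twoHandles : ∃[ H₁ ] ∃[ H₂ ] H₁ ≢ H₂ × IsHandle H₁ × IsHandle H₂ ×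
                       (∀ H → IsHandle H → H ≡ H₁ ⊎ H ≡ H₂)

    record Layered : Set where
      field
        twoAttachments : ∀ D → ∃[ uw ] AttachedExactlyAt D uw

      -- C⁺ for this family of chords is C*.
      open WithChords (λ D → proj₁ (twoAttachments D)) public

      field
        twoHandled : TwoHandled

record SignedGraph (n m : ℕ) : Set where
  field
    graph     : Graph (Fin n) (Fin m)
    signature : Fin m → Sign

  open FiniteGraph graph public

  sign : Subset m → Sign
  sign F = product (λ x → if lookup F x then signature x else Sign.+)

  switch : (Fin n → Sign) → Fin m → Sign
  switch ζ x = ζ (proj₁ (ends x)) Sign.* signature x Sign.* ζ (proj₂ (ends x))

  IsBalancingEdge : Fin m → Set
  IsBalancingEdge b = ∃[ ζ ] (∀ x → switch ζ x ≡ Sign.- ⇔ x ≡ b)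

  -- [ e , C , s ]
  record Battery (e : Fin m) (C : Subset m) (s : Sign) : Set where
    field
      isCircle : IsCircle C
      hasSign  : sign C ≡ s
      contains : e ∈ C
      unique   : ∀ C′ → IsCircle C′ → sign C′ ≡ s → e ∈ C′ → C′ ≡ C

  OnHandle : (C : Subset m) → Layered C → Fin m → Set
  OnHandle C L e = ∃[ H ] Layered.IsHandle L H × e ∈ H

  OtherHandleBalances : (C : Subset m) → Layered C → Fin m → Set
  OtherHandleBalances C L e =
    ∃[ H ] Layered.IsHandle L H × e ∉ H × ∃[ b ] b ∈ H × IsBalancingEdge b

  -- P runs through the bridge D from u to w, and Q is one of the two u–w paths
  -- of C.
  BridgePathsNegative : Subset m → Set
  BridgePathsNegative C =
    ∀ (D : Bridge C) u w → u ≢ w → Attachment C D u → Attachment C D w →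
    ∀ (P : Walk u w) → IsPathIn (λ x → _∈ᵇ_ C x D) P →
    ∀ (Q : Walk u w) → IsPathIn (_∈ C) Q →
    sign (edgeSet P ∪ edgeSet Q) ≡ Sign.-

{-# OPTIONS --safe #-}

-- The circles through e correspond to the paths joining the ends of e without e;
-- let p₀ be the path of C, and say that a bridge attached to p₀ at x and y spans
-- the interval from x to y.
--
-- If e is a battery, every path other than p₀ has the sign opposite to p₀, so a
-- path through a bridge from x to y has the sign opposite to the interval.  This
-- is contradicted by a bridge with three attachments (through a tripod) and by
-- two bridges whose spans cross or do not overlap (by a path through both).
-- Hence the spans form a chain under inclusion; its least member gives the handle
-- avoiding e, and its greatest the handle containing e.
--
-- Conversely, crossing spans give a subdivision of K₄ and disjoint ones a third
-- handle, so a layered circle with e on a handle has a chain of spans.  A path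
-- that leaves p₀ over a bridge can then never use a second bridge, which
-- leaves only the circles consisting of a path through one bridge and an arc of C.
--
-- That an edge b of the other handle is balancing follows because, after
-- negating b, all circles through e are positive, and in a block this implies
-- balance.
module Submission where

open import Defs
open import Data.Bool.Base using (true; false; _∨_; if_then_else_)
open import Data.Empty using (⊥-elim) renaming (⊥ to Empty)
open import Data.Fin.Base as Fin using (Fin; zero; suc)
open import Data.Fin.Patterns using (0F; 1F; 2F; 3F)
open import Data.Fin.Properties using (any?; all?; _≟_; pigeonhole; <-cmp)
open import Data.Fin.Subset using (Subset; inside; outside; _∈_; _∉_; _⊆_; _⊂_; _⊃_; _∪_; _∩_; ∁; ⊤; ⊥; ⁅_⁆; ∣_∣)
open import Data.Fin.Subset.Induction using (⊃-wellFounded; Acc; acc)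
open import Data.Fin.Subset.Properties using (_∈?_; ∈⊤; ∉⊥; x∈⁅x⁆; x∈⁅y⁆⇒x≡y; x∈p∪q⁻; x∈p∪q⁺; x∈p∩q⁻; x∈p∩q⁺; ⊆-antisym; p⊂q⇒∣p∣<∣q∣; ∣⁅x⁆∣≡1; x∈∁p⇒x∉p; x∉p⇒x∈∁p)
open import Data.List.Base as List using (List; []; _∷_; length)
open import Data.List.Membership.Propositional using () renaming (_∈_ to _∈ₗ_; _∉_ to _∉ₗ_)
open import Data.List.Relation.Unary.All as All using (All; []; _∷_)
open import Data.List.Relation.Unary.AllPairs using ([]; _∷_)
open import Data.List.Relation.Unary.Any as Any using (here; there; index)
open import Data.List.Relation.Unary.Any.Properties using (lookup-index)
open import Data.List.Relation.Unary.Unique.Propositional using (Unique)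
open import Data.Nat.Base as ℕ using (ℕ; zero; suc; _+_; _≤_; _<_; z≤n; s≤s)
import Data.Nat.Properties as ℕ
open import Data.Product.Base using (Σ-syntax; ∃; ∃-syntax; ∃₂; _×_; _,_; proj₁; proj₂)
open import Data.Product.Properties using () renaming (≡-dec to ×-≡-dec)
open import Data.Sign.Base as Sign using (Sign; opposite; _*_)
import Data.Sign.Properties as Sign
open import Algebra.Properties.CommutativeMonoid.Sum Sign.*-commutativeMonoid using (sum-cong-≗; ∑-distrib-+; sum-replicate-zero) renaming (sum to product)
open import Data.Sum.Base using (_⊎_; inj₁; inj₂; [_,_]′; swap)
open import Data.Unit.Base using (tt)
open import Data.Vec.Base using (lookup; tabulate; _∷_; []; here; there)
open import Data.Vec.Properties using ([]=⇒lookup; lookup⇒[]=; lookup-zipWith; lookup∘tabulate)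
open import Data.Vec.Properties.WithK using ([]=-irrelevant)
open import Function.Base using (_∘_; id; case_of_)
open import Function.Bundles using (_⇔_; mk⇔; Equivalence)
open import Relation.Binary.Definitions using (tri<; tri≈; tri>)
open import Relation.Binary.PropositionalEquality using (_≡_; _≢_; refl; sym; trans; cong; cong₂; subst; subst₂; ≢-sym; module ≡-Reasoning)
open import Relation.Nullary using (¬_; Dec; yes; no; does; contradiction)
open import Relation.Nullary.Decidable using (_×-dec_; _⊎-dec_; _→-dec_; ¬?; map′; from-yes)
open import Relation.Unary using (Decidable)

-- The definitions carry no coordinates: circles are 2-regular edge sets, a crossing is an abstract
-- subdivision of K₄, a handle is an arbitrary arc. Opening `C` at `e` supplies them: a vertex of
-- `C` gets its rank along `p₀`, arcs become intervals of ranks or complements of such, and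
-- crossing, disjoint and nested chords become inequalities between natural numbers. Two devices
-- translate back. A parity argument determines an arc of `C` from its ends and from whether it uses
-- `e`. A cut of at most two edges cannot separate the branch vertices of a subdivision of K₄, which
-- shows that nested chords do not cross. Signs are governed by the potential `ψ` along `p₀`: the
-- sign of an interval is the product of the values at its ends, so every sign condition is an
-- identity in a few unknown signs and is decided by trying all cases. In the proof of balance, the
-- linkages that are carried along with the ears do the work of Menger's theorem: they provide two
-- disjoint paths from the ends of `e` to any two vertices reached so far.

infix 4 _∈ₗ?_
_∈ₗ?_ : ∀ {n} (v : Fin n) vs → Dec (v ∈ₗ vs)
v ∈ₗ? vs = Any.any? (v ≟_) vs

-- Walks, their pieces, and ranks along them.

module Walks {n : ℕ} {E : Set} (G : Graph (Fin n) E) where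
  open Graph G public

  private variable
    u v w t : Fin n
    x : E

  Simple : Walk u w → Set
  Simple p = Unique (vertices p)

  infix 4 _∈ᵥ_ _∈ₑ_
  _∈ᵥ_ : Fin n → Walk u w → Set
  v ∈ᵥ p = v ∈ₗ vertices p

  _∈ₑ_ : E → Walk u w → Set
  x ∈ₑ p = x ∈ₗ edges p

  infixr 5 _·_
  _·_ : Walk u v → Walk v w → Walk u w
  []         · q = q
  step x j p · q = step x j (p · q)

  ·-assoc : (p : Walk u v) (q : Walk v w) (r : Walk w t) → (p · q) · r ≡ p · (q · r)
  ·-assoc []           q r = refl
  ·-assoc (step x j p) q r = cong (step x j) (·-assoc p q r)

  len : Walk u w → ℕ
  len p = length (edges p)

  start∈ : (p : Walk u w) → u ∈ᵥ p
  start∈ []           = here refl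
  start∈ (step _ _ _) = here refl

  end∈ : (p : Walk u w) → w ∈ᵥ p
  end∈ []           = here refl
  end∈ (step _ _ p) = there (end∈ p)

  ∈ᵥ-·⁻ : (p : Walk u v) {q : Walk v w} → t ∈ᵥ p · q → t ∈ᵥ p ⊎ t ∈ᵥ q
  ∈ᵥ-·⁻ []           t∈       = inj₂ t∈
  ∈ᵥ-·⁻ (step _ _ p) (here e) = inj₁ (here e)
  ∈ᵥ-·⁻ (step _ _ p) (there i) with ∈ᵥ-·⁻ p i
  ... | inj₁ i′ = inj₁ (there i′)
  ... | inj₂ i′ = inj₂ i′

  ∈ᵥ-·ʳ : (p : Walk u v) {q : Walk v w} → t ∈ᵥ q → t ∈ᵥ p · q
  ∈ᵥ-·ʳ []           i = i
  ∈ᵥ-·ʳ (step _ _ p) i = there (∈ᵥ-·ʳ p i)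

  ∈ᵥ-·ˡ : (p : Walk u v) {q : Walk v w} → t ∈ᵥ p → t ∈ᵥ p · q
  ∈ᵥ-·ˡ []           {q} (here refl) = start∈ q
  ∈ᵥ-·ˡ (step _ _ p) (here e)  = here e
  ∈ᵥ-·ˡ (step _ _ p) (there i) = there (∈ᵥ-·ˡ p i)

  ∈ₑ-·⁻ : (p : Walk u v) {q : Walk v w} → x ∈ₑ p · q → x ∈ₑ p ⊎ x ∈ₑ q
  ∈ₑ-·⁻ []           i        = inj₂ i
  ∈ₑ-·⁻ (step _ _ p) (here e) = inj₁ (here e)
  ∈ₑ-·⁻ (step _ _ p) (there i) with ∈ₑ-·⁻ p i
  ... | inj₁ i′ = inj₁ (there i′)
  ... | inj₂ i′ = inj₂ i′

  ∈ₑ-·ʳ : (p : Walk u v) {q : Walk v w} → x ∈ₑ q → x ∈ₑ p · q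
  ∈ₑ-·ʳ []           i = i
  ∈ₑ-·ʳ (step _ _ p) i = there (∈ₑ-·ʳ p i)

  ∈ₑ-·ˡ : (p : Walk u v) {q : Walk v w} → x ∈ₑ p → x ∈ₑ p · q
  ∈ₑ-·ˡ (step _ _ p) (here e)  = here e
  ∈ₑ-·ˡ (step _ _ p) (there i) = there (∈ₑ-·ˡ p i)

  len-· : (p : Walk u v) (q : Walk v w) → len (p · q) ≡ len p + len q
  len-· []           q = refl
  len-· (step _ _ p) q = cong suc (len-· p q)

  Joins-sym : Joins x u w → Joins x w u
  Joins-sym = swap

  Joins⇒Incidentˡ : Joins x u w → Incident x u
  Joins⇒Incidentˡ (inj₁ e) = inj₁ (cong proj₁ e)
  Joins⇒Incidentˡ (inj₂ e) = inj₂ (cong proj₂ e)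

  Joins⇒Incidentʳ : Joins x u w → Incident x w
  Joins⇒Incidentʳ = Joins⇒Incidentˡ ∘ Joins-sym

  Incident⇒Joins : ∀ x → Incident x u → ∃[ w ] Joins x u w
  Incident⇒Joins x (inj₁ e) = proj₂ (ends x) , inj₁ (cong (_, proj₂ (ends x)) e)
  Incident⇒Joins x (inj₂ e) = proj₁ (ends x) , inj₂ (cong (proj₁ (ends x) ,_) e)

  Incident-Joins : Joins x u w → Incident x v → v ≡ u ⊎ v ≡ w
  Incident-Joins (inj₁ e) (inj₁ i) = inj₁ (trans (sym i) (cong proj₁ e))
  Incident-Joins (inj₁ e) (inj₂ i) = inj₂ (trans (sym i) (cong proj₂ e))
  Incident-Joins (inj₂ e) (inj₁ i) = inj₂ (trans (sym i) (cong proj₁ e))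
  Incident-Joins (inj₂ e) (inj₂ i) = inj₁ (trans (sym i) (cong proj₂ e))

  Joins-unique : Joins x u w → Joins x v t → (u ≡ v × w ≡ t) ⊎ (u ≡ t × w ≡ v)
  Joins-unique (inj₁ e) (inj₁ f) with trans (sym e) f
  ... | refl = inj₁ (refl , refl)
  Joins-unique (inj₁ e) (inj₂ f) with trans (sym e) f
  ... | refl = inj₂ (refl , refl)
  Joins-unique (inj₂ e) (inj₁ f) with trans (sym e) f
  ... | refl = inj₂ (refl , refl)
  Joins-unique (inj₂ e) (inj₂ f) with trans (sym e) f
  ... | refl = inj₁ (refl , refl)

  reverse : Walk u w → Walk w u
  reverse []           = []
  reverse (step x j p) = reverse p · step x (Joins-sym j) []

  ∈ᵥ-reverse⁻ : (p : Walk u w) → t ∈ᵥ reverse p → t ∈ᵥ p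
  ∈ᵥ-reverse⁻ []           i = i
  ∈ᵥ-reverse⁻ (step x j p) i with ∈ᵥ-·⁻ (reverse p) i
  ... | inj₁ i′ = there (∈ᵥ-reverse⁻ p i′)
  ... | inj₂ (here refl) = there (start∈ p)
  ... | inj₂ (there (here refl)) = here refl

  ∈ᵥ-reverse⁺ : (p : Walk u w) → t ∈ᵥ p → t ∈ᵥ reverse p
  ∈ᵥ-reverse⁺ []           i           = i
  ∈ᵥ-reverse⁺ (step x j p) (here refl) = ∈ᵥ-·ʳ (reverse p) (there (here refl))
  ∈ᵥ-reverse⁺ (step x j p) (there i)   = ∈ᵥ-·ˡ (reverse p) (∈ᵥ-reverse⁺ p i)

  ∈ₑ-reverse⁻ : (p : Walk u w) → x ∈ₑ reverse p → x ∈ₑ p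
  ∈ₑ-reverse⁻ (step x j p) i with ∈ₑ-·⁻ (reverse p) i
  ... | inj₁ i′ = there (∈ₑ-reverse⁻ p i′)
  ... | inj₂ (here refl) = here refl

  ∈ₑ-reverse⁺ : (p : Walk u w) → x ∈ₑ p → x ∈ₑ reverse p
  ∈ₑ-reverse⁺ (step x j p) (here refl) = ∈ₑ-·ʳ (reverse p) (here refl)
  ∈ₑ-reverse⁺ (step x j p) (there i)   = ∈ₑ-·ˡ (reverse p) (∈ₑ-reverse⁺ p i)

  Simple-·⁺ : (p : Walk u v) (q : Walk v w) → Simple p → Simple q →
              (∀ {t} → t ∈ᵥ p → t ∈ᵥ q → t ≡ v) → Simple (p · q)
  Simple-·⁺ []           q sp       sq d = sq
  Simple-·⁺ {u} (step x j p) q (a ∷ sp) sq d =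
    All.tabulate fresh ∷ Simple-·⁺ p q sp sq (d ∘ there)
    where
    fresh : ∀ {t} → t ∈ᵥ p · q → u ≢ t
    fresh i refl with ∈ᵥ-·⁻ p i
    ... | inj₁ i′ = All.lookup a i′ refl
    ... | inj₂ i′ = All.lookup a (end∈ p) (d (here refl) i′)

  Simple-·ˡ : (p : Walk u v) {q : Walk v w} → Simple (p · q) → Simple p
  Simple-·ˡ []           s       = [] ∷ []
  Simple-·ˡ (step x j p) (a ∷ s) = All.tabulate (All.lookup a ∘ ∈ᵥ-·ˡ p) ∷ Simple-·ˡ p s

  Simple-·ʳ : (p : Walk u v) {q : Walk v w} → Simple (p · q) → Simple q
  Simple-·ʳ []           s       = s
  Simple-·ʳ (step x j p) (_ ∷ s) = Simple-·ʳ p s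

  Simple-·-meet : (p : Walk u v) {q : Walk v w} → Simple (p · q) → t ∈ᵥ p → t ∈ᵥ q → t ≡ v
  Simple-·-meet []           s       (here e)    i = e
  Simple-·-meet (step x j p) (a ∷ s) (here refl) i = contradiction refl (All.lookup a (∈ᵥ-·ʳ p i))
  Simple-·-meet (step x j p) (a ∷ s) (there k)   i = Simple-·-meet p s k i

  Simple-fresh : (j : Joins x u v) (p : Walk v w) → Simple (step x j p) → t ∈ᵥ p → u ≢ t
  Simple-fresh j p (a ∷ _) = All.lookup a

  Simple-step : (j : Joins x u v) → u ≢ v → Simple (step x j [])
  Simple-step j u≢v = (u≢v ∷ []) ∷ ([] ∷ [])

  Simple-reverse : (p : Walk u w) → Simple p → Simple (reverse p)
  Simple-reverse []           s       = s
  Simple-reverse (step x j p) (a ∷ s) =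
    Simple-·⁺ (reverse p) (step x (Joins-sym j) []) (Simple-reverse p s)
      (Simple-step (Joins-sym j) (≢-sym (All.lookup a (start∈ p))))
      λ { i (here e) → e
        ; i (there (here refl)) → contradiction refl (All.lookup a (∈ᵥ-reverse⁻ p i)) }

  Simple-loop : (p : Walk u u) → Simple p → p ≡ []
  Simple-loop []           s       = refl
  Simple-loop (step x j p) (a ∷ s) = contradiction refl (All.lookup a (end∈ p))

  Incident⇒∈ᵥ : (p : Walk u w) → x ∈ₑ p → Incident x v → v ∈ᵥ p
  Incident⇒∈ᵥ (step x j p) (here refl) i with Incident-Joins j i
  ... | inj₁ refl = here refl
  ... | inj₂ refl = there (start∈ p)
  Incident⇒∈ᵥ (step x j p) (there x∈) i = there (Incident⇒∈ᵥ p x∈ i)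

  ∈ᵥ-step⇒Incident : (j : Joins x u v) (p : Walk v w) → t ∈ᵥ step x j p →
                     ∃[ y ] y ∈ₑ step x j p × Incident y t
  ∈ᵥ-step⇒Incident {x = x} j p  (here refl) = x , here refl , Joins⇒Incidentˡ j
  ∈ᵥ-step⇒Incident {x = x} j [] (there (here refl)) = x , here refl , Joins⇒Incidentʳ j
  ∈ᵥ-step⇒Incident j (step y k p) (there i) =
    let f , f∈ , inc = ∈ᵥ-step⇒Incident k p i in f , there f∈ , inc

  ∈ᵥ⇒Incident : (p : Walk u w) → u ≢ w → v ∈ᵥ p → ∃[ x ] x ∈ₑ p × Incident x v
  ∈ᵥ⇒Incident []           u≢w _ = contradiction refl u≢w
  ∈ᵥ⇒Incident (step x j p) u≢w i = ∈ᵥ-step⇒Incident j p i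

  Simple⇒Unique-edges : (p : Walk u w) → Simple p → Unique (edges p)
  Simple⇒Unique-edges []           s       = []
  Simple⇒Unique-edges (step x j p) (a ∷ s) =
    All.tabulate (λ { i refl → All.lookup a (Incident⇒∈ᵥ p i (Joins⇒Incidentˡ j)) refl })
    ∷ Simple⇒Unique-edges p s

  Joins-walk : (p : Walk u w) → x ∈ₑ p → ∃₂ λ s t →
               Σ[ q ∈ Walk u s ] Σ[ j ∈ Joins x s t ] Σ[ r ∈ Walk t w ] p ≡ q · step x j r
  Joins-walk (step x j p) (here refl) = _ , _ , [] , j , p , refl
  Joins-walk (step y k p) (there i)   =
    let s , t , q , j , r , eq = Joins-walk p i
    in s , t , step y k q , j , r , cong (step y k) eq

  splitAt : (p : Walk u w) → v ∈ᵥ p → Σ[ q ∈ Walk u v ] Σ[ r ∈ Walk v w ] p ≡ q · r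
  splitAt []           (here refl) = [] , [] , refl
  splitAt p@(step _ _ _) (here refl) = [] , p , refl
  splitAt (step x j p) (there i)   =
    let q , r , eq = splitAt p i in step x j q , r , cong (step x j) eq

  firstHit : {P : Fin n → Set} → Decidable P → (p : Walk u w) → P t → t ∈ᵥ p →
             ∃[ v ] Σ[ q ∈ Walk u v ] Σ[ r ∈ Walk v w ] p ≡ q · r × P v × (∀ {s} → s ∈ᵥ q → P s → s ≡ v)
  firstHit {u} P? p Pt t∈ with P? u
  ... | yes Pu = u , [] , p , refl , Pu , λ { (here e) _ → e }
  firstHit P? []           Pt (here refl) | no ¬Pu = contradiction Pt ¬Pu
  firstHit P? (step x j p) Pt (here refl) | no ¬Pu = contradiction Pt ¬Pu
  firstHit P? (step x j p) Pt (there i)   | no ¬Pu =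
    let v , q , r , eq , Pv , first = firstHit P? p Pt i
    in v , step x j q , r , cong (step x j) eq , Pv ,
       λ { (here refl) Ps → contradiction Ps ¬Pu ; (there k) Ps → first k Ps }

  simplify : (p : Walk u w) → Σ[ q ∈ Walk u w ] Simple q ×
             (∀ {t} → t ∈ᵥ q → t ∈ᵥ p) × (∀ {x} → x ∈ₑ q → x ∈ₑ p)
  simplify []           = [] , ([] ∷ []) , id , id
  simplify {u} (step x j p) with simplify p
  ... | q , s , v⊆ , e⊆ with u ∈ₗ? vertices q
  ... | no u∉ = step x j q , All.tabulate (λ i e → u∉ (subst (_∈ᵥ q) (sym e) i)) ∷ s ,
                (λ { (here e) → here e ; (there i) → there (v⊆ i) }) ,
                (λ { (here e) → here e ; (there i) → there (e⊆ i) })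
  ... | yes u∈ with splitAt q u∈
  ...   | q₁ , q₂ , refl = q₂ , Simple-·ʳ q₁ s ,
                           (λ i → there (v⊆ (∈ᵥ-·ʳ q₁ i))) , (λ i → there (e⊆ (∈ₑ-·ʳ q₁ i)))

  -- Position of the first occurrence. A vertex off the walk gets the length of the walk, the same
  -- value as the last vertex of a simple one, so ranks separate only vertices known to lie on the
  -- walk.
  rank : Walk u w → Fin n → ℕ
  rank []               v = 0
  rank {u} (step _ _ p) v = if does (u ≟ v) then 0 else suc (rank p v)

  rank-start : (p : Walk u w) → rank p u ≡ 0
  rank-start []           = refl
  rank-start {u} (step x j p) with u ≟ u
  ... | yes _ = refl
  ... | no ¬e = contradiction refl ¬e

  rank-later : (j : Joins x u v) (p : Walk v w) → u ≢ t → rank (step x j p) t ≡ suc (rank p t)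
  rank-later {u = u} {t = t} j p u≢t with u ≟ t
  ... | yes e = contradiction e u≢t
  ... | no  _ = refl

  rank-·ˡ : (p : Walk u v) {q : Walk v w} → t ∈ᵥ p → rank (p · q) t ≡ rank p t
  rank-·ˡ []           {q} (here refl) = rank-start q
  rank-·ˡ {u} {t = t} (step x j p) i with u ≟ t
  ... | yes _ = refl
  rank-·ˡ (step x j p) (here e)  | no ¬e = contradiction (sym e) ¬e
  rank-·ˡ (step x j p) (there i) | no ¬e = cong suc (rank-·ˡ p i)

  rank-·ʳ : (p : Walk u v) {q : Walk v w} → Simple (p · q) → t ∈ᵥ q →
            rank (p · q) t ≡ len p + rank q t
  rank-·ʳ []           s       i = refl
  rank-·ʳ (step x j p) (a ∷ s) i =
    trans (rank-later j (p · _) (All.lookup a (∈ᵥ-·ʳ p i))) (cong suc (rank-·ʳ p s i))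

  rank≤len : (p : Walk u w) → t ∈ᵥ p → rank p t ≤ len p
  rank≤len []           i = z≤n
  rank≤len {u} {t = t} (step x j p) i with u ≟ t
  ... | yes _ = z≤n
  rank≤len (step x j p) (here e)  | no ¬e = contradiction (sym e) ¬e
  rank≤len (step x j p) (there i) | no ¬e = s≤s (rank≤len p i)

  rank-end : (p : Walk u w) → Simple p → rank p w ≡ len p
  rank-end []           s       = refl
  rank-end (step x j p) (a ∷ s) = trans (rank-later j p (All.lookup a (end∈ p))) (cong suc (rank-end p s))

  rank-injective : (p : Walk u w) → v ∈ᵥ p → t ∈ᵥ p → rank p v ≡ rank p t → v ≡ t
  rank-injective []           (here refl) (here refl) _ = refl
  rank-injective {u} {v = v} {t = t} (step x j p) i k e with u ≟ v | u ≟ t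
  ... | yes refl | yes refl = refl
  rank-injective (step x j p) (here e′)  k _ | no ¬e | no _  = contradiction (sym e′) ¬e
  rank-injective (step x j p) (there _) (here e′) _ | no _ | no ¬e = contradiction (sym e′) ¬e
  rank-injective (step x j p) (there i) (there k) e | no _ | no _ = rank-injective p i k (ℕ.suc-injective e)

  rank-prefix : (p : Walk u v) {q : Walk v w} → Simple (p · q) → t ∈ᵥ p → rank (p · q) t ≤ rank (p · q) v
  rank-prefix p s i = subst₂ _≤_ (sym (rank-·ˡ p i))
    (sym (trans (rank-·ˡ p (end∈ p)) (rank-end p (Simple-·ˡ p s)))) (rank≤len p i)

  rank-suffix : (p : Walk u v) {q : Walk v w} → Simple (p · q) → t ∈ᵥ q → rank (p · q) v ≤ rank (p · q) t
  rank-suffix p {q} s i = subst₂ _≤_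
    (sym (trans (rank-·ʳ p s (start∈ q)) (trans (cong (len p +_) (rank-start q)) (ℕ.+-identityʳ _))))
    (sym (rank-·ʳ p s i)) (ℕ.m≤m+n (len p) _)

  rank-step : (p : Walk u w) → Simple p → (q : Walk u v) (j : Joins x v t) (r : Walk t w) →
              p ≡ q · step x j r → rank p t ≡ suc (rank p v)
  rank-step _ s q j r refl = begin
    rank (q · step _ j r) _        ≡⟨ rank-·ʳ q s (there (start∈ r)) ⟩
    len q + rank (step _ j r) _    ≡⟨ cong (len q +_) (rank-later j r v≢t) ⟩
    len q + suc (rank r _)         ≡⟨ cong (λ k → len q + suc k) (rank-start r) ⟩
    len q + 1                      ≡⟨ ℕ.+-comm (len q) 1 ⟩
    suc (len q)                    ≡⟨ cong suc (rank-end q (Simple-·ˡ q s)) ⟨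
    suc (rank q _)                 ≡⟨ cong suc (rank-·ˡ q (end∈ q)) ⟨
    suc (rank (q · step _ j r) _)  ∎
    where
    open ≡-Reasoning
    v≢t = Simple-fresh j r (Simple-·ʳ q s) (start∈ r)

  record Between (p : Walk u w) (v t : Fin n) : Set where
    field
      before : Walk u v
      walk   : Walk v t
      after  : Walk t w
      split  : p ≡ before · (walk · after)

  between : (p : Walk u w) → Simple p → v ∈ᵥ p → t ∈ᵥ p → rank p v ≤ rank p t → Between p v t
  between {v = v} p s v∈ t∈ v≤t with splitAt p t∈
  ... | q , r , refl with v∈q
    where
    v∈q : v ∈ᵥ q
    v∈q with ∈ᵥ-·⁻ q v∈
    ... | inj₁ i = i
    -- If `v` comes after `t`, the two rank inequalities force `v` to be the splitting vertex `t`
    -- itself.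
    ... | inj₂ i = subst (_∈ᵥ q) (rank-injective (q · r) (∈ᵥ-·ˡ q (end∈ q)) v∈
                     (ℕ.≤-antisym (rank-suffix q s i) v≤t)) (end∈ q)
  ... | i with splitAt q i
  ... | q₁ , q₂ , refl = record { before = q₁ ; walk = q₂ ; after = r ; split = ·-assoc q₁ q₂ r }


-- Finite sets of edges: cardinalities and products of signs.

module _ {n : ℕ} where

  ∈-tabulate⁺ : ∀ {P : Fin n → Set} (P? : Decidable P) {x} → P x → x ∈ tabulate (does ∘ P?)
  ∈-tabulate⁺ P? {x} Px = lookup⇒[]= x _ (trans (lookup∘tabulate (does ∘ P?) x) lemma)
    where
    lemma : does (P? x) ≡ true
    lemma with P? x
    ... | yes _  = refl
    ... | no ¬Px = contradiction Px ¬Px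

  ∈-tabulate⁻ : ∀ {P : Fin n → Set} (P? : Decidable P) {x} → x ∈ tabulate (does ∘ P?) → P x
  ∈-tabulate⁻ P? {x} i with P? x | trans (sym (lookup∘tabulate (does ∘ P?) x)) ([]=⇒lookup i)
  ... | yes Px | _ = Px

∣p∪q∣-disjoint : ∀ {n} (p q : Subset n) → (∀ {x} → x ∈ p → x ∉ q) → ∣ p ∪ q ∣ ≡ ∣ p ∣ + ∣ q ∣
∣p∪q∣-disjoint [] [] d = refl
∣p∪q∣-disjoint (inside ∷ p) (inside ∷ q) d = contradiction here (d here)
∣p∪q∣-disjoint (inside ∷ p) (outside ∷ q) d = cong suc (∣p∪q∣-disjoint p q (λ i k → d (there i) (there k)))
∣p∪q∣-disjoint (outside ∷ p) (inside ∷ q) d =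
  trans (cong suc (∣p∪q∣-disjoint p q (λ i k → d (there i) (there k)))) (sym (ℕ.+-suc ∣ p ∣ ∣ q ∣))
∣p∪q∣-disjoint (outside ∷ p) (outside ∷ q) d = ∣p∪q∣-disjoint p q (λ i k → d (there i) (there k))

module _ {m : ℕ} where
  private variable
    f g h : Fin m
    X Y : Subset m

  ∣pair∣≡2 : f ≢ g → ∣ ⁅ f ⁆ ∪ ⁅ g ⁆ ∣ ≡ 2
  ∣pair∣≡2 {f} {g} f≢g = trans
    (∣p∪q∣-disjoint ⁅ f ⁆ ⁅ g ⁆ λ i k → f≢g (trans (sym (x∈⁅y⁆⇒x≡y f i)) (x∈⁅y⁆⇒x≡y g k)))
    (cong₂ _+_ (∣⁅x⁆∣≡1 f) (∣⁅x⁆∣≡1 g))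

  ∈-pair⁻ : h ∈ ⁅ f ⁆ ∪ ⁅ g ⁆ → h ≡ f ⊎ h ≡ g
  ∈-pair⁻ {f = f} {g = g} i with x∈p∪q⁻ ⁅ f ⁆ ⁅ g ⁆ i
  ... | inj₁ k = inj₁ (x∈⁅y⁆⇒x≡y f k)
  ... | inj₂ k = inj₂ (x∈⁅y⁆⇒x≡y g k)

  pair⊆ : f ∈ X → g ∈ X → ⁅ f ⁆ ∪ ⁅ g ⁆ ⊆ X
  pair⊆ f∈ g∈ i with ∈-pair⁻ i
  ... | inj₁ refl = f∈
  ... | inj₂ refl = g∈

  ∣X∣≡2-exact : f ≢ g → f ∈ X → g ∈ X → (∀ {h} → h ∈ X → h ≡ f ⊎ h ≡ g) → ∣ X ∣ ≡ 2
  ∣X∣≡2-exact {f} {g} f≢g f∈ g∈ only = trans (cong ∣_∣ (⊆-antisym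
    (λ i → case only i of λ { (inj₁ refl) → x∈p∪q⁺ (inj₁ (x∈⁅x⁆ f)) ; (inj₂ refl) → x∈p∪q⁺ (inj₂ (x∈⁅x⁆ g)) })
    (pair⊆ f∈ g∈))) (∣pair∣≡2 f≢g)

  ∣X∣≡2-other : ∣ X ∣ ≡ 2 → f ∈ X → ∃[ g ] g ∈ X × g ≢ f
  ∣X∣≡2-other {X} {f} two f∈ with any? (λ g → (g ∈? X) ×-dec ¬? (g ≟ f))
  ... | yes found = found
  ... | no none = contradiction (trans (sym two) (trans (cong ∣_∣ X≡⁅f⁆) (∣⁅x⁆∣≡1 f))) λ ()
    where
    X⊆ : X ⊆ ⁅ f ⁆
    X⊆ {g} i with g ≟ f
    ... | yes refl = x∈⁅x⁆ f
    ... | no g≢f = contradiction (g , i , g≢f) none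
    X≡⁅f⁆ = ⊆-antisym X⊆ λ i → subst (_∈ X) (sym (x∈⁅y⁆⇒x≡y f i)) f∈

  ∣X∣≡2-three : ∣ X ∣ ≡ 2 → f ∈ X → g ∈ X → h ∈ X → f ≢ g → f ≢ h → g ≢ h → Empty
  ∣X∣≡2-three {h = h} two f∈ g∈ h∈ f≢g f≢h g≢h = ℕ.<-irrefl (trans (∣pair∣≡2 f≢g) (sym two))
    (p⊂q⇒∣p∣<∣q∣ (pair⊆ f∈ g∈ , h , h∈ , λ i → case ∈-pair⁻ i of λ
      { (inj₁ e) → f≢h (sym e) ; (inj₂ e) → g≢h (sym e) }))

  ∣∣≡⇒⊇ : X ⊆ Y → ∣ X ∣ ≡ ∣ Y ∣ → Y ⊆ X
  ∣∣≡⇒⊇ {X} X⊆Y eq {x} x∈Y with x ∈? X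
  ... | yes x∈X = x∈X
  ... | no x∉X = contradiction (p⊂q⇒∣p∣<∣q∣ (X⊆Y , x , x∈Y , x∉X)) (ℕ.<-irrefl eq)

  restrict : (Fin m → Sign) → Subset m → Fin m → Sign
  restrict σ F x = if lookup F x then σ x else Sign.+

  product-⊥ : (σ : Fin m → Sign) → product (restrict σ ⊥) ≡ Sign.+
  product-⊥ σ = trans (sum-cong-≗ lemma) (sum-replicate-zero m)
    where
    lemma : ∀ x → restrict σ ⊥ x ≡ Sign.+
    lemma x with lookup ⊥ x in eq
    ... | false = refl
    ... | true  = contradiction (lookup⇒[]= x ⊥ eq) ∉⊥

  product-∪ : (σ : Fin m → Sign) (X Y : Subset m) → (∀ {x} → x ∈ X → x ∉ Y) →
              product (restrict σ (X ∪ Y)) ≡ product (restrict σ X) * product (restrict σ Y)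
  product-∪ σ X Y d = trans (sum-cong-≗ lemma) (∑-distrib-+ (restrict σ X) (restrict σ Y))
    where
    lemma : ∀ x → restrict σ (X ∪ Y) x ≡ restrict σ X x * restrict σ Y x
    lemma x rewrite lookup-zipWith _∨_ x X Y with lookup X x in eq | lookup Y x in eq′
    ... | true  | true  = contradiction (lookup⇒[]= x Y eq′) (d (lookup⇒[]= x X eq))
    ... | true  | false = sym (Sign.*-identityʳ _)
    ... | false | _     = refl

product-⁅⁆ : ∀ {m} (σ : Fin m → Sign) x → product (restrict σ ⁅ x ⁆) ≡ σ x
product-⁅⁆ {suc m} σ zero = trans (cong (σ zero *_) (product-⊥ (σ ∘ suc))) (Sign.*-identityʳ _)
product-⁅⁆ {suc m} σ (suc x) = product-⁅⁆ (σ ∘ suc) x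

-- Circles through an edge as paths between its ends.

module Circles {n m : ℕ} (G : Graph (Fin n) (Fin m)) where
  open Walks G public
  open FiniteGraph G public
    using (edgeSet; Touches; degree; IsCircle; IsBlock; IsCutpoint)
  private variable
    u v w t a z : Fin n
    x e : Fin m

  ∈-edgeSet⁺ : (p : Walk u w) → x ∈ₑ p → x ∈ edgeSet p
  ∈-edgeSet⁺ (step y j p) (here refl) = x∈p∪q⁺ (inj₁ (x∈⁅x⁆ y))
  ∈-edgeSet⁺ (step y j p) (there i)   = x∈p∪q⁺ (inj₂ (∈-edgeSet⁺ p i))

  ∈-edgeSet⁻ : (p : Walk u w) → x ∈ edgeSet p → x ∈ₑ p
  ∈-edgeSet⁻ []           i = contradiction i ∉⊥
  ∈-edgeSet⁻ (step y j p) i with x∈p∪q⁻ ⁅ y ⁆ (edgeSet p) i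
  ... | inj₁ k = here (x∈⁅y⁆⇒x≡y y k)
  ... | inj₂ k = there (∈-edgeSet⁻ p k)

  abstract
    -- Circles through `e` are handled in this form only; `circle⇒path` shows that none is missed.
    circuit : Fin m → Walk u w → Subset m
    circuit e p = ⁅ e ⁆ ∪ edgeSet p

    ∈-circuit⁻ : (p : Walk u w) → x ∈ circuit e p → x ≡ e ⊎ x ∈ₑ p
    ∈-circuit⁻ {e = e} p i with x∈p∪q⁻ ⁅ e ⁆ (edgeSet p) i
    ... | inj₁ k = inj₁ (x∈⁅y⁆⇒x≡y e k)
    ... | inj₂ k = inj₂ (∈-edgeSet⁻ p k)

    e∈circuit : (p : Walk u w) → e ∈ circuit e p
    e∈circuit {e = e} p = x∈p∪q⁺ (inj₁ (x∈⁅x⁆ e))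

    ∈-circuit⁺ : (p : Walk u w) → x ∈ₑ p → x ∈ circuit e p
    ∈-circuit⁺ p i = x∈p∪q⁺ (inj₂ (∈-edgeSet⁺ p i))

  module _ (σ : Fin m → Sign) where

    walkSign : Walk u w → Sign
    walkSign []           = Sign.+
    walkSign (step x j p) = σ x * walkSign p

    walkSign-· : (p : Walk u v) (q : Walk v w) → walkSign (p · q) ≡ walkSign p * walkSign q
    walkSign-· []           q = refl
    walkSign-· (step x j p) q = trans (cong (σ x *_) (walkSign-· p q)) (sym (Sign.*-assoc (σ x) _ _))

    walkSign-reverse : (p : Walk u w) → walkSign (reverse p) ≡ walkSign p
    walkSign-reverse []           = refl
    walkSign-reverse (step x j p) = trans (walkSign-· (reverse p) _)
      (trans (cong₂ _*_ (walkSign-reverse p) (Sign.*-identityʳ (σ x))) (Sign.*-comm (walkSign p) (σ x)))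

    -- `edgeSet` forgets multiplicities and `walkSign` does not, so repeated edges have to be
    -- excluded; simplicity does this.
    product-edgeSet : (p : Walk u w) → Simple p → product (restrict σ (edgeSet p)) ≡ walkSign p
    product-edgeSet p s = unique p (Simple⇒Unique-edges p s)
      where
      unique : ∀ {u w} (p : Walk u w) → Unique (edges p) → product (restrict σ (edgeSet p)) ≡ walkSign p
      unique []           _       = product-⊥ σ
      unique (step x j p) (a ∷ s) = trans
        (product-∪ σ ⁅ x ⁆ (edgeSet p) λ i k → All.lookup a (subst (_∈ₑ p) (x∈⁅y⁆⇒x≡y x i) (∈-edgeSet⁻ p k)) refl)
        (cong₂ _*_ (product-⁅⁆ σ x) (unique p s))

    abstract
      product-circuit : (p : Walk u w) → Simple p → ¬ e ∈ₑ p →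
                        product (restrict σ (circuit e p)) ≡ σ e * walkSign p
      product-circuit {e = e} p s e∉ = trans
        (product-∪ σ ⁅ e ⁆ (edgeSet p) λ i k → e∉ (subst (_∈ₑ p) (x∈⁅y⁆⇒x≡y e i) (∈-edgeSet⁻ p k)))
        (cong₂ _*_ (product-⁅⁆ σ e) (product-edgeSet p s))

  Loopless : Set
  Loopless = ∀ {x u} → ¬ Joins x u u

  module CirclesLoopless (loopless : Loopless) where

    private
      fstEnds sndEnds : Fin n → Subset m
      fstEnds v = tabulate (λ x → does (proj₁ (ends x) ≟ v))
      sndEnds v = tabulate (λ x → does (proj₂ (ends x) ≟ v))

    abstract
      star : Subset m → Fin n → Subset m
      star F v = (F ∩ fstEnds v) ∪ (F ∩ sndEnds v)

      ∈-star⁺ : ∀ {F} → x ∈ F → Incident x v → x ∈ star F v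
      ∈-star⁺ {v = v} x∈ (inj₁ i) = x∈p∪q⁺ (inj₁ (x∈p∩q⁺ (x∈ , ∈-tabulate⁺ (λ y → proj₁ (ends y) ≟ v) i)))
      ∈-star⁺ {v = v} x∈ (inj₂ i) = x∈p∪q⁺ (inj₂ (x∈p∩q⁺ (x∈ , ∈-tabulate⁺ (λ y → proj₂ (ends y) ≟ v) i)))

      ∈-star⁻ : ∀ {F} → x ∈ star F v → x ∈ F × Incident x v
      ∈-star⁻ {v = v} {F = F} i with x∈p∪q⁻ _ _ i
      ... | inj₁ k = let x∈ , l = x∈p∩q⁻ F _ k in x∈ , inj₁ (∈-tabulate⁻ (λ y → proj₁ (ends y) ≟ v) l)
      ... | inj₂ k = let x∈ , l = x∈p∩q⁻ F _ k in x∈ , inj₂ (∈-tabulate⁻ (λ y → proj₂ (ends y) ≟ v) l)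

      -- Only a loop lies in both summands of `degree`. A single set of size 2 is easier to reason
      -- about: two known members exhaust it.
      degree≡∣star∣ : ∀ F v → degree F v ≡ ∣ star F v ∣
      degree≡∣star∣ F v = sym (∣p∪q∣-disjoint (F ∩ fstEnds v) (F ∩ sndEnds v) λ {x} i k → loopless {x} {v}
        (inj₁ (cong₂ _,_ (∈-tabulate⁻ (λ y → proj₁ (ends y) ≟ v) (proj₂ (x∈p∩q⁻ F _ i)))
                         (∈-tabulate⁻ (λ y → proj₂ (ends y) ≟ v) (proj₂ (x∈p∩q⁻ F _ k))))))

    -- The two pieces meet only in `v`, so an edge on both would have both ends there and be a loop.
    edge-once : (p : Walk u v) (q : Walk v w) → Simple (p · q) → x ∈ₑ p → ¬ x ∈ₑ q
    edge-once {x = x} p q s i k with Incident⇒Joins x (inj₁ refl)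
    ... | t , j with Simple-·-meet p s (Incident⇒∈ᵥ p i (Joins⇒Incidentˡ j)) (Incident⇒∈ᵥ q k (Joins⇒Incidentˡ j))
                   | Simple-·-meet p s (Incident⇒∈ᵥ p i (Joins⇒Incidentʳ j)) (Incident⇒∈ᵥ q k (Joins⇒Incidentʳ j))
    ... | refl | refl = loopless j

    OnlyAt : Walk u w → Fin n → Set
    OnlyAt p v = ∃[ f ] f ∈ₑ p × Incident f v × (∀ {h} → h ∈ₑ p → Incident h v → h ≡ f)

    firstEdge : (p : Walk u w) → Simple p → u ≢ w → OnlyAt p u
    firstEdge []           s       u≢w = contradiction refl u≢w
    firstEdge (step x j p) (a ∷ s) u≢w = x , here refl , Joins⇒Incidentˡ j ,
      λ { (here e) _ → e ; (there i) inc → contradiction refl (All.lookup a (Incident⇒∈ᵥ p i inc)) }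

    lastEdge : (p : Walk u w) → Simple p → u ≢ w → OnlyAt p w
    lastEdge p s u≢w =
      let f , f∈ , inc , only = firstEdge (reverse p) (Simple-reverse p s) (≢-sym u≢w)
      in f , ∈ₑ-reverse⁻ p f∈ , inc , λ i → only (∈ₑ-reverse⁺ p i)

    module _ {a z : Fin n} {e : Fin m} (eⱼ : Joins e a z) where

      circuit-regular-end : (p : Walk a z) → ¬ e ∈ₑ p → Incident e v → OnlyAt p v → ∣ star (circuit e p) v ∣ ≡ 2
      circuit-regular-end p e∉ einc (f , f∈ , inc , only) =
        ∣X∣≡2-exact {f = e} {f} (λ { refl → e∉ f∈ }) (∈-star⁺ (e∈circuit p) einc) (∈-star⁺ (∈-circuit⁺ p f∈) inc)
          λ h∈ → let h∈C , hinc = ∈-star⁻ h∈ in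
            case ∈-circuit⁻ p h∈C of λ { (inj₁ h≡e) → inj₁ h≡e ; (inj₂ h∈p) → inj₂ (only h∈p hinc) }

      circuit-regular : (p : Walk a z) → Simple p → ¬ e ∈ₑ p → v ∈ᵥ p → ∣ star (circuit e p) v ∣ ≡ 2
      circuit-regular {v} p s e∉ v∈ with v ≟ a | v ≟ z
      ... | yes refl | _ = circuit-regular-end p e∉ (Joins⇒Incidentˡ eⱼ) (firstEdge p s λ { refl → loopless eⱼ })
      ... | no _ | yes refl = circuit-regular-end p e∉ (Joins⇒Incidentʳ eⱼ) (lastEdge p s λ { refl → loopless eⱼ })
      ... | no v≢a | no v≢z with splitAt p v∈
      ...   | q , r , refl =
        let f , f∈ , finc , fonly = lastEdge q (Simple-·ˡ q s) (≢-sym v≢a)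
            g , g∈ , ginc , gonly = firstEdge r (Simple-·ʳ q s) v≢z
        in ∣X∣≡2-exact {f = f} {g} (λ eq → edge-once q r s f∈ (subst (_∈ₑ r) (sym eq) g∈))
             (∈-star⁺ (∈-circuit⁺ p (∈ₑ-·ˡ q f∈)) finc) (∈-star⁺ (∈-circuit⁺ p (∈ₑ-·ʳ q g∈)) ginc)
             λ h∈ → let h∈C , hinc = ∈-star⁻ h∈ in
               case ∈-circuit⁻ p h∈C of λ
                 { (inj₁ refl) → case Incident-Joins eⱼ hinc of λ
                     { (inj₁ v≡a) → contradiction v≡a v≢a ; (inj₂ v≡z) → contradiction v≡z v≢z }
                 ; (inj₂ h∈p) → case ∈ₑ-·⁻ q h∈p of λ
                     { (inj₁ i) → inj₁ (fonly i hinc) ; (inj₂ i) → inj₂ (gonly i hinc) } }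

      Touches-circuit⁻ : (p : Walk a z) → Touches (circuit e p) v → v ∈ᵥ p
      Touches-circuit⁻ p (x , x∈ , inc) with ∈-circuit⁻ p x∈
      ... | inj₂ i = Incident⇒∈ᵥ p i inc
      ... | inj₁ refl with Incident-Joins eⱼ inc
      ...   | inj₁ refl = start∈ p
      ...   | inj₂ refl = end∈ p

      Touches-circuit⁺ : (p : Walk a z) → v ∈ᵥ p → Touches (circuit e p) v
      Touches-circuit⁺ p v∈ =
        let x , x∈ , inc = ∈ᵥ⇒Incident p (λ { refl → loopless eⱼ }) v∈
        in x , ∈-circuit⁺ p x∈ , inc

      circuit-IsCircle : (p : Walk a z) → Simple p → ¬ e ∈ₑ p → IsCircle (circuit e p)
      circuit-IsCircle p s e∉ = record
        { nonempty  = e , e∈circuit p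
        ; regular   = λ v t → trans (degree≡∣star∣ _ v) (circuit-regular p s e∉ (Touches-circuit⁻ p t))
        ; connected = λ u v tu tv →
            let qu , ru , equ = splitAt p (Touches-circuit⁻ p tu)
                qv , rv , eqv = splitAt p (Touches-circuit⁻ p tv)
            in reverse qu · qv , All.tabulate λ i → case ∈ₑ-·⁻ (reverse qu) i of λ
              { (inj₁ k) → ∈-circuit⁺ p (subst (_ ∈ₑ_) (sym equ) (∈ₑ-·ˡ qu (∈ₑ-reverse⁻ qu k)))
              ; (inj₂ k) → ∈-circuit⁺ p (subst (_ ∈ₑ_) (sym eqv) (∈ₑ-·ˡ qv k)) }
        }

    module _ {C : Subset m} (isCircle : IsCircle C) where
      open IsCircle isCircle

      ∣star∣≡2 : x ∈ C → Incident x v → ∣ star C v ∣ ≡ 2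
      ∣star∣≡2 {v = v} x∈ inc = trans (sym (degree≡∣star∣ C v)) (regular v (_ , x∈ , inc))

      -- At a vertex of `K` the two edges of `K` are already all the edges of `C` there. Membership
      -- in `K` therefore spreads along every walk in `C`, and `C` is connected.
      circle-minimal : ∀ {K} → IsCircle K → K ⊆ C → K ≡ C
      circle-minimal {K} Kcircle K⊆C = ⊆-antisym K⊆C C⊆K
        where
        open IsCircle Kcircle using () renaming (nonempty to K-nonempty; regular to K-regular)
        full : Touches K v → x ∈ C → Incident x v → x ∈ K
        full {v = v} tv@(y , y∈ , yinc) x∈ inc = proj₁ (∈-star⁻ (∣∣≡⇒⊇
          (λ i → let k , l = ∈-star⁻ i in ∈-star⁺ (K⊆C k) l)
          (trans (trans (sym (degree≡∣star∣ K v)) (K-regular v tv)) (sym (∣star∣≡2 x∈ inc)))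
          (∈-star⁺ x∈ inc)))
        spread : (p : Walk u w) → All (_∈ C) (edges p) → Touches K u → Touches K w
        spread []           _       tu = tu
        spread (step y j p) (i ∷ a) tu = spread p a (y , full tu i (Joins⇒Incidentˡ j) , Joins⇒Incidentʳ j)
        C⊆K : C ⊆ K
        C⊆K {x} x∈ =
          let y , y∈ = K-nonempty
              p , pC = connected _ _ (y , K⊆C y∈ , inj₁ refl) (x , x∈ , inj₁ refl)
          in full (spread p pC (y , y∈ , inj₁ refl)) x∈ (inj₁ refl)

      module _ {a z : Fin n} {e : Fin m} (eⱼ : Joins e a z) (e∈ : e ∈ C) where

        private
          Arc : Fin n → Set
          Arc v = Σ[ q ∈ Walk a v ] Simple q × All (_∈ C) (edges q) × ¬ e ∈ₑ q

          -- f is the edge through which the circle enters v, for an empty arc e.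
          arrival : v ≢ z → (q : Walk a v) → Simple q → All (_∈ C) (edges q) →
                    ∃[ f ] f ∈ C × Incident f v × (∀ {h} → h ∈ₑ q → Incident h v → h ≡ f) ×
                    (Incident e v → e ≡ f) × (f ∈ₑ q ⊎ f ≡ e)
          arrival {v} v≢z q s qC with a ≟ v
          ... | no a≢v = let f , f∈ , inc , only = lastEdge q s a≢v in
            f , All.lookup qC f∈ , inc , only ,
            (λ i → case Incident-Joins eⱼ i of λ { (inj₁ e) → contradiction (sym e) a≢v ; (inj₂ e) → contradiction e v≢z }) ,
            inj₁ f∈
          arrival v≢z q s qC | yes refl with Simple-loop q s
          ... | refl = e , e∈ , Joins⇒Incidentˡ eⱼ , (λ ()) , (λ _ → refl) , inj₂ refl

          -- The second edge `g` of `C` at `v` continues the arc. Its far end is new: an earlier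
          -- vertex of the arc already has two edges of `C`, where `e` counts as one of them at `a`,
          -- and `g` would be a third.
          extend : v ≢ z → ((q , _) : Arc v) → ∃[ y ] Σ[ (q′ , _) ∈ Arc y ] edgeSet q ⊂ edgeSet q′
          extend {v} v≢z (q , s , qC , e∉) with arrival v≢z q s qC
          ... | f , f∈C , finc , fonly , fe , f∈q⊎
            with ∣X∣≡2-other (∣star∣≡2 f∈C finc) (∈-star⁺ f∈C finc)
          ... | g , g∈ , g≢f with ∈-star⁻ g∈
          ... | g∈C , ginc with Incident⇒Joins g ginc
          ... | y , j = y , (q · step g j [] , s′ , All.tabulate qC′ , e∉′) ,
                        (λ i → ∈-edgeSet⁺ (q · _) (∈ₑ-·ˡ q (∈-edgeSet⁻ q i))) ,
                        g , ∈-edgeSet⁺ (q · _) (∈ₑ-·ʳ q (here refl)) , λ i → g∉q (∈-edgeSet⁻ q i)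
            where
            g∉q : ¬ g ∈ₑ q
            g∉q i = g≢f (fonly i ginc)
            g≢e : g ≢ e
            g≢e refl = g≢f (fe ginc)
            v≢y : v ≢ y
            v≢y refl = loopless j
            y∉q : ¬ y ∈ᵥ q
            y∉q y∈ with splitAt q y∈
            ... | q₁ , q₂ , refl with firstEdge q₂ (Simple-·ʳ q₁ s) (≢-sym v≢y) | arrival′
              where
              arrival′ : ∃[ h ] h ∈ C × Incident h y × (h ∈ₑ q₁ ⊎ h ≡ e)
              arrival′ with a ≟ y
              ... | yes refl = e , e∈ , Joins⇒Incidentˡ eⱼ , inj₂ refl
              ... | no a≢y = let h , h∈ , inc , _ = lastEdge q₁ (Simple-·ˡ q₁ s) a≢y in
                             h , All.lookup qC (∈ₑ-·ˡ q₁ h∈) , inc , inj₁ h∈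
            ... | h₂ , h₂∈ , h₂inc , _ | h₁ , h₁∈C , h₁inc , h₁∈ =
              ∣X∣≡2-three (∣star∣≡2 h₁∈C h₁inc) (∈-star⁺ h₁∈C h₁inc)
                (∈-star⁺ (All.lookup qC (∈ₑ-·ʳ q₁ h₂∈)) h₂inc) (∈-star⁺ g∈C (Joins⇒Incidentʳ j))
                (λ { refl → [ (λ i → edge-once q₁ q₂ s i h₂∈) , (λ { refl → e∉ (∈ₑ-·ʳ q₁ h₂∈) }) ]′ h₁∈ })
                (λ { refl → [ (λ i → g∉q (∈ₑ-·ˡ q₁ i)) , g≢e ]′ h₁∈ })
                (λ { refl → g∉q (∈ₑ-·ʳ q₁ h₂∈) })
            s′ = Simple-·⁺ q (step g j []) s (Simple-step j v≢y)
                   λ { _ (here e) → e ; i (there (here refl)) → contradiction i y∉q }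
            qC′ : ∀ {h} → h ∈ₑ q · step g j [] → h ∈ C
            qC′ i with ∈ₑ-·⁻ q i
            ... | inj₁ k = All.lookup qC k
            ... | inj₂ (here refl) = g∈C
            e∉′ : ¬ e ∈ₑ q · step g j []
            e∉′ i with ∈ₑ-·⁻ q i
            ... | inj₁ k = e∉ k
            ... | inj₂ (here refl) = g≢e refl

          complete : ((q , _) : Arc v) → Acc _⊃_ (edgeSet q) → Arc z
          complete {v} arc (acc rs) with v ≟ z
          ... | yes refl = arc
          ... | no v≢z = let y , arc′ , larger = extend v≢z arc in complete arc′ (rs larger)

        -- The arc grown from `a` need not be shown to exhaust `C`: closed up by `e` it is a circle
        -- inside `C`, and `circle-minimal` applies.
        circle⇒path : Σ[ p ∈ Walk a z ] Simple p × ¬ e ∈ₑ p × circuit e p ≡ C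
        circle⇒path =
          let p , s , pC , e∉ = complete ([] , [] ∷ [] , [] , λ ()) (⊃-wellFounded _)
          in p , s , e∉ , circle-minimal (circuit-IsCircle eⱼ p s e∉)
               (λ i → case ∈-circuit⁻ p i of λ { (inj₁ refl) → e∈ ; (inj₂ k) → All.lookup pC k })

-- Deciding statements about signs by running through all assignments.

∀¹ : ∀ {P : Sign → Set} → Decidable P → Dec (∀ s → P s)
∀¹ P? = map′ (λ { (p , q) Sign.+ → p ; (p , q) Sign.- → q }) (λ f → f Sign.+ , f Sign.-)
             (P? Sign.+ ×-dec P? Sign.-)

∀² : ∀ {P : Sign → Sign → Set} → (∀ a b → Dec (P a b)) → Dec (∀ a b → P a b)
∀² P? = ∀¹ λ a → ∀¹ (P? a)

∀³ : ∀ {P : Sign → Sign → Sign → Set} → (∀ a b c → Dec (P a b c)) → Dec (∀ a b c → P a b c)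
∀³ P? = ∀¹ λ a → ∀² (P? a)

∀⁴ : ∀ {P : Sign → Sign → Sign → Sign → Set} → (∀ a b c d → Dec (P a b c d)) → Dec (∀ a b c d → P a b c d)
∀⁴ P? = ∀¹ λ a → ∀³ (P? a)

∀⁵ : ∀ {P : Sign → Sign → Sign → Sign → Sign → Set} →
     (∀ a b c d e → Dec (P a b c d e)) → Dec (∀ a b c d e → P a b c d e)
∀⁵ P? = ∀¹ λ a → ∀⁴ (P? a)

common-factor : ∀ a b c → (a * b) * (a * c) ≡ b * c
common-factor = from-yes (∀³ λ a b c → (a * b) * (a * c) Sign.≟ b * c)

-- Components, loops and cutpoints.

module Components {n m : ℕ} (G : Graph (Fin n) (Fin m)) where
  open Circles G
  private variable
    u v w : Fin n
    x : Fin m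

  joins? : ∀ x u v → Dec (Joins x u v)
  joins? x u v = ×-≡-dec _≟_ _≟_ (ends x) (u , v) ⊎-dec ×-≡-dec _≟_ _≟_ (ends x) (v , u)

  incident? : ∀ x v → Dec (Incident x v)
  incident? x v = (proj₁ (ends x) ≟ v) ⊎-dec (proj₂ (ends x) ≟ v)

  touches? : ∀ F → Decidable (Touches F)
  touches? F v = any? λ x → (x ∈? F) ×-dec incident? x v

  record Component (A : Fin n → Set) (y : Fin n) : Set where
    field
      carrier   : Subset n
      root      : y ∈ carrier
      within    : v ∈ carrier → A v
      reachable : v ∈ carrier → Σ[ p ∈ Walk y v ] (∀ {t} → t ∈ᵥ p → t ∈ carrier)
      closed    : Joins x u v → u ∈ carrier → A v → v ∈ carrier

  componentOf : ∀ {A} → Decidable A → ∀ y → A y → Component A y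
  componentOf {A} A? y Ay = grow ⁅ y ⁆ (⊃-wellFounded _) (x∈⁅x⁆ y)
    (λ i → subst A (sym (x∈⁅y⁆⇒x≡y y i)) Ay)
    (λ i → case x∈⁅y⁆⇒x≡y y i of λ { refl → [] , λ { (here refl) → x∈⁅x⁆ y } })
    where
    grow : ∀ R → Acc _⊃_ R → y ∈ R → (∀ {v} → v ∈ R → A v) →
           (∀ {v} → v ∈ R → Σ[ p ∈ Walk y v ] (∀ {t} → t ∈ᵥ p → t ∈ R)) → Component A y
    grow R (acc rs) y∈ inA conn
      with any? (λ x → any? λ u → any? λ v → joins? x u v ×-dec (u ∈? R) ×-dec A? v ×-dec ¬? (v ∈? R))
    ... | no none = record { carrier = R ; root = y∈ ; within = inA ; reachable = conn ; closed = closed′ }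
      where
      closed′ : Joins x u v → u ∈ R → A v → v ∈ R
      closed′ {v = v} j u∈ Av with v ∈? R
      ... | yes v∈ = v∈
      ... | no v∉ = contradiction (_ , _ , v , j , u∈ , Av , v∉) none
    ... | yes (x , u , v , j , u∈ , Av , v∉) = grow (R ∪ ⁅ v ⁆) (rs (old , v , new , v∉)) (old y∈) inA′ conn′
      where
      old : R ⊆ R ∪ ⁅ v ⁆
      old = x∈p∪q⁺ ∘ inj₁
      new : v ∈ R ∪ ⁅ v ⁆
      new = x∈p∪q⁺ (inj₂ (x∈⁅x⁆ v))
      inA′ : ∀ {t} → t ∈ R ∪ ⁅ v ⁆ → A t
      inA′ i with x∈p∪q⁻ R ⁅ v ⁆ i
      ... | inj₁ k = inA k
      ... | inj₂ k with x∈⁅y⁆⇒x≡y v k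
      ...   | refl = Av
      conn′ : ∀ {t} → t ∈ R ∪ ⁅ v ⁆ → Σ[ p ∈ Walk y t ] (∀ {s} → s ∈ᵥ p → s ∈ R ∪ ⁅ v ⁆)
      conn′ i with x∈p∪q⁻ R ⁅ v ⁆ i
      ... | inj₁ k = let p , p⊆ = conn k in p , old ∘ p⊆
      ... | inj₂ k with x∈⁅y⁆⇒x≡y v k
      ...   | refl = let p , p⊆ = conn u∈ in p · step x j [] , λ l → case ∈ᵥ-·⁻ p l of λ
        { (inj₁ l′) → old (p⊆ l′)
        ; (inj₂ (here refl)) → old u∈
        ; (inj₂ (there (here refl))) → new }

  -- By the convention in `IsCutpoint`, a loop `x` at `u` makes `u` a cutpoint as soon as another
  -- edge meets `u`. A simple walk from `u` towards any edge other than `x` starts with such an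
  -- edge, or is empty and that edge itself serves.
  IsBlock⇒Loopless : IsBlock → m ≢ 1 → Loopless
  IsBlock⇒Loopless block m≢1 {x} {u} j =
    noCutpoint u (⁅ x ⁆ , (x , x∈⁅x⁆ x , Joins⇒Incidentˡ j) , outside-touches , only)
    where
    open IsBlock block
    another : ∀ {k} → k ≢ 1 → (x : Fin k) → ∃[ y ] y ≢ x
    another {suc zero}    k≢1 x       = contradiction refl k≢1
    another {suc (suc k)} k≢1 zero    = suc zero , λ ()
    another {suc (suc k)} k≢1 (suc x) = zero , λ ()
    outside-touches : Touches (∁ ⁅ x ⁆) u
    outside-touches with another m≢1 x
    ... | y , y≢x with simplify (connected u (proj₁ (ends y)))
    ... | [] , _ = y , x∉p⇒x∈∁p (y≢x ∘ x∈⁅y⁆⇒x≡y x) , inj₁ refl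
    ... | step f k p , a ∷ s , _ = f , x∉p⇒x∈∁p (λ i → f≢x (x∈⁅y⁆⇒x≡y x i)) , Joins⇒Incidentˡ k
      where
      f≢x : f ≢ x
      f≢x refl with Joins-unique j k
      ... | inj₁ (_ , refl) = All.lookup a (start∈ p) refl
      ... | inj₂ (refl , _) = All.lookup a (start∈ p) refl
    only : ∀ w → Touches ⁅ x ⁆ w → Touches (∁ ⁅ x ⁆) w → w ≡ u
    only w (y , y∈ , inc) _ with x∈⁅y⁆⇒x≡y x y∈
    ... | refl with Incident-Joins j inc
    ... | inj₁ e = e
    ... | inj₂ e = e

  -- Otherwise x would separate the edges that meet the component of y outside K
  -- from the edge g.
  module _ (noCutpoint : ∀ v → ¬ IsCutpoint v) {K : Fin n → Set} (K? : Decidable K) where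

    return : ∀ {x x′ y f g} → Joins f x y → Joins g x x′ → K x → K x′ → ¬ K y →
             ∃[ w ] K w × w ≢ x × Σ[ q ∈ Walk y w ] Simple q × (∀ {t} → t ∈ᵥ q → K t → t ≡ w)
    return {x} {x′} {y} {f} {g} fⱼ gⱼ Kx Kx′ ¬Ky
      with componentOf (¬? ∘ K?) y ¬Ky
    ... | R with any? (λ w → any? λ r → any? λ h → K? w ×-dec ¬? (w ≟ x) ×-dec (r ∈? Component.carrier R) ×-dec joins? h r w)
    ... | yes (w , r , h , Kw , w≢x , r∈ , hⱼ) =
      let p , p⊆ = reachable r∈
          q , s , q⊆ , _ = simplify (p · step h hⱼ [])
      in w , Kw , w≢x , q , s , λ i Kt → case ∈ᵥ-·⁻ p (q⊆ i) of λ
           { (inj₁ k) → contradiction Kt (within (p⊆ k))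
           ; (inj₂ (here refl)) → contradiction Kt (within r∈)
           ; (inj₂ (there (here e))) → e }
      where open Component R
    ... | no none = contradiction (F , (f , ∈-tabulate⁺ meets? (y , root , Joins⇒Incidentʳ fⱼ) , Joins⇒Incidentˡ fⱼ) ,
                                   (g , x∉p⇒x∈∁p g∉F , Joins⇒Incidentˡ gⱼ) , only) (noCutpoint x)
      where
      open Component R
      meets? : Decidable λ h → ∃[ r ] r ∈ carrier × Incident h r
      meets? h = any? λ r → (r ∈? carrier) ×-dec incident? h r
      F : Subset m
      F = tabulate (does ∘ meets?)
      g∉F : g ∉ F
      g∉F i with ∈-tabulate⁻ meets? i
      ... | r , r∈ , inc with Incident-Joins gⱼ inc
      ... | inj₁ refl = within r∈ Kx
      ... | inj₂ refl = within r∈ Kx′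
      only : ∀ w → Touches F w → Touches (∁ F) w → w ≡ x
      only w (h , h∈ , hw) (k , k∈ , kw) with ∈-tabulate⁻ meets? h∈
      ... | r , r∈ , hr with w ∈? carrier
      ... | yes w∈ = contradiction (∈-tabulate⁺ meets? (w , w∈ , kw)) (x∈∁p⇒x∉p k∈)
      ... | no w∉ with Incident⇒Joins h hr
      ... | s , hⱼ with Incident-Joins hⱼ hw
      ... | inj₁ refl = contradiction r∈ w∉
      ... | inj₂ refl with K? w
      ...   | no ¬Kw = contradiction (closed hⱼ r∈ ¬Kw) w∉
      ...   | yes Kw with w ≟ x
      ...     | yes e = e
      ...     | no w≢x = contradiction (w , r , h , Kw , w≢x , r∈ , hⱼ) none

-- Potentials, and balance of a block from the circles through one edge.

module Potentials {n m : ℕ} (G : Graph (Fin n) (Fin m)) (σ : Fin m → Sign) where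
  open Circles G
  private variable
    u v w s t : Fin n

  prefixSign : Walk u w → Fin n → Sign
  prefixSign []               v = Sign.+
  prefixSign {u} (step x j p) v = if does (u ≟ v) then Sign.+ else σ x * prefixSign p v

  prefixSign-start : (p : Walk u w) → prefixSign p u ≡ Sign.+
  prefixSign-start []           = refl
  prefixSign-start {u} (step x j p) with u ≟ u
  ... | yes _ = refl
  ... | no ¬e = contradiction refl ¬e

  prefixSign-later : ∀ {f} (j : Joins f u v) (p : Walk v w) → u ≢ t →
                     prefixSign (step f j p) t ≡ σ f * prefixSign p t
  prefixSign-later {u = u} {t = t} j p u≢t with u ≟ t
  ... | yes e = contradiction e u≢t
  ... | no  _ = refl

  prefixSign-end : (p : Walk u w) → Simple p → prefixSign p w ≡ walkSign σ p
  prefixSign-end []           _       = refl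
  prefixSign-end (step f j p) (a ∷ s) =
    trans (prefixSign-later j p (All.lookup a (end∈ p))) (cong (σ f *_) (prefixSign-end p s))

  prefixSign-edge : (p : Walk u w) → Simple p → ∀ {f} → f ∈ₑ p → Joins f s t →
                    σ f ≡ prefixSign p s * prefixSign p t
  prefixSign-edge {s = s} {t} (step f j p) (a ∷ sp) (here refl) k with Joins-unique k j
  ... | inj₁ (refl , refl) = sym (trans (cong₂ _*_ (prefixSign-start (step f j p)) (prefixSign-later j p (All.lookup a (start∈ p))))
        (trans (cong (σ f *_) (prefixSign-start p)) (Sign.*-identityʳ _)))
  ... | inj₂ (refl , refl) = sym (trans (cong₂ _*_ (prefixSign-later j p (All.lookup a (start∈ p))) (prefixSign-start (step f j p)))
        (trans (Sign.*-identityʳ _) (trans (cong (σ f *_) (prefixSign-start p)) (Sign.*-identityʳ _))))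
  prefixSign-edge (step g j p) (a ∷ sp) {f} (there i) k = sym (trans
    (cong₂ _*_ (prefixSign-later j p (All.lookup a (Incident⇒∈ᵥ p i (Joins⇒Incidentˡ k))))
                    (prefixSign-later j p (All.lookup a (Incident⇒∈ᵥ p i (Joins⇒Incidentʳ k)))))
    (trans (common-factor (σ g) _ _) (sym (prefixSign-edge p sp i k))))

  -- Equivalently, switching by `ζ` makes every edge of `K` positive.
  Potential : (Fin n → Sign) → Subset m → Set
  Potential ζ K = ∀ {f u v} → f ∈ K → Joins f u v → σ f ≡ ζ u * ζ v

  walkSign-potential : ∀ {ζ K} → Potential ζ K → (p : Walk u w) → (∀ {f} → f ∈ₑ p → f ∈ K) →
                       walkSign σ p ≡ ζ u * ζ w
  walkSign-potential {u} {ζ = ζ} pos [] _ = sym (Sign.s*s≡+ (ζ u))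
  walkSign-potential {u} {w} {ζ} pos (step {v = v} f j p) p⊆ =
    trans (cong₂ _*_ (pos (p⊆ (here refl)) j) (walkSign-potential {ζ = ζ} pos p (p⊆ ∘ there))) (cancel (ζ u) (ζ v) (ζ w))
    where
    cancel : ∀ a b c → (a * b) * (b * c) ≡ a * c
    cancel = from-yes (∀³ λ a b c → (a * b) * (b * c) Sign.≟ a * c)

-- A subgraph K containing e is grown by ears, keeping a potential on K and, for
-- any two vertices of K, disjoint paths in K from the ends of e to them; these
-- close every ear to a circle through e.
module Balance {n m : ℕ} (G : Graph (Fin n) (Fin m)) (loopless : Circles.Loopless G)
  (connected : ∀ u v → Graph.Walk G u v) (noCutpoint : ∀ v → ¬ Circles.IsCutpoint G v)
  (σ : Fin m → Sign) where
  open Circles G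
  open Components G
  open Potentials G σ
  private variable
    u v w s t x y : Fin n

  record Linkage (K : Subset m) (s t x y : Fin n) : Set where
    field
      first  : Walk s x
      second : Walk t y
      first-simple  : Simple first
      second-simple : Simple second
      first⊆  : ∀ {f} → f ∈ₑ first → f ∈ K
      second⊆ : ∀ {f} → f ∈ₑ second → f ∈ K
      disjoint : ∀ {v} → v ∈ᵥ first → ¬ v ∈ᵥ second

  Linkage-swap : ∀ {K} → Linkage K s t x y → Linkage K t s y x
  Linkage-swap l = record
    { first = second ; second = first ; first-simple = second-simple ; second-simple = first-simple
    ; first⊆ = second⊆ ; second⊆ = first⊆ ; disjoint = λ i k → disjoint k i }
    where open Linkage l

  Linkage-mono : ∀ {K L} → K ⊆ L → Linkage K s t x y → Linkage L s t x y
  Linkage-mono K⊆L l = record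
    { Linkage l ; first⊆ = K⊆L ∘ Linkage.first⊆ l ; second⊆ = K⊆L ∘ Linkage.second⊆ l }

  Linkage-extend : ∀ {K} (l : Linkage K s t x y) (q : Walk x v) → Simple q → (∀ {f} → f ∈ₑ q → f ∈ K) →
                   (∀ {r} → r ∈ᵥ Linkage.first l → r ∈ᵥ q → r ≡ x) → (∀ {r} → r ∈ᵥ q → ¬ r ∈ᵥ Linkage.second l) →
                   Linkage K s t v y
  Linkage-extend l q sq q⊆ meet avoid = record
    { first = first · q ; second = second
    ; first-simple = Simple-·⁺ first q first-simple sq meet ; second-simple = second-simple
    ; first⊆ = λ i → [ first⊆ , q⊆ ]′ (∈ₑ-·⁻ first i) ; second⊆ = second⊆
    ; disjoint = λ i → [ disjoint , avoid ]′ (∈ᵥ-·⁻ first i) }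
    where open Linkage l

  walk-touches : ∀ {K} (p : Walk u w) → (∀ {f} → f ∈ₑ p → f ∈ K) → Touches K u → v ∈ᵥ p → Touches K v
  walk-touches []           _  tu (here refl) = tu
  walk-touches (step f j p) p⊆ tu (here refl) = tu
  walk-touches (step f j p) p⊆ tu (there i)   =
    walk-touches p (p⊆ ∘ there) (f , p⊆ (here refl) , Joins⇒Incidentʳ j) i

  module _ {a z : Fin n} {e : Fin m} (eⱼ : Joins e a z) where

    -- Which end of `e` leads to which vertex is left open, because either pairing closes an ear to
    -- a circle through `e`.
    Linked : Subset m → Fin n → Fin n → Set
    Linked K x y = ∃₂ λ s t → Joins e s t × Linkage K s t x y

    Linked-sym : ∀ {K} → Linked K x y → Linked K y x
    Linked-sym (s , t , j , l) = t , s , Joins-sym j , Linkage-swap l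

    record Ear (K : Subset m) : Set where
      field
        from to   : Fin n
        distinct  : from ≢ to
        from∈     : Touches K from
        to∈       : Touches K to
        path      : Walk from to
        simple    : Simple path
        meets     : ∀ {v} → v ∈ᵥ path → Touches K v → v ≡ from ⊎ v ≡ to
        fresh     : ∀ {f} → f ∈ₑ path → f ∉ K

    reverseEar : ∀ {K} → Ear K → Ear K
    reverseEar ear = record
      { from = to ; to = from ; distinct = ≢-sym distinct ; from∈ = to∈ ; to∈ = from∈
      ; path = reverse path ; simple = Simple-reverse path simple
      ; meets = λ i t → swap (meets (∈ᵥ-reverse⁻ path i) t)
      ; fresh = fresh ∘ ∈ₑ-reverse⁻ path }
      where open Ear ear

    -- A walk from `a` towards the missing edge `f₀` reaches a vertex `x` of `K` with an edge `f`
    -- outside `K`. If the other end of `f` is not in `K`, then `return` supplies the rest of the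
    -- ear; it ends at a vertex other than `x` because `x` is no cutpoint.
    findEar : ∀ K → Touches K a → ∀ f → f ∉ K → Ear K
    findEar K ta f₀ f₀∉ with findEdge (connected a (proj₁ (ends f₀))) ta
      where
      findEdge : Walk u (proj₁ (ends f₀)) → Touches K u → ∃₂ λ f v → f ∉ K × Touches K v × Incident f v
      findEdge [] tu = f₀ , _ , f₀∉ , tu , inj₁ refl
      findEdge (step f j p) tu with f ∈? K
      ... | yes f∈ = findEdge p (f , f∈ , Joins⇒Incidentʳ j)
      ... | no f∉ = f , _ , f∉ , tu , Joins⇒Incidentˡ j
    ... | f , x , f∉ , tx@(g , g∈ , ginc) , finc with Incident⇒Joins f finc | Incident⇒Joins g ginc
    ... | y , fⱼ | x′ , gⱼ with touches? K y
    ... | yes ty = record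
      { from = x ; to = y ; distinct = λ { refl → loopless fⱼ } ; from∈ = tx ; to∈ = ty
      ; path = step f fⱼ [] ; simple = Simple-step fⱼ λ { refl → loopless fⱼ }
      ; meets = λ { (here e) _ → inj₁ e ; (there (here e)) _ → inj₂ e }
      ; fresh = λ { (here refl) → f∉ } }
    ... | no ¬ty with return noCutpoint (touches? K) fⱼ gⱼ tx (g , g∈ , Joins⇒Incidentʳ gⱼ) ¬ty
    ... | w , tw , w≢x , q , s , only = record
      { from = x ; to = w ; distinct = ≢-sym w≢x ; from∈ = tx ; to∈ = tw
      ; path = step f fⱼ q ; simple = All.tabulate (λ { i refl → w≢x (sym (only i tx)) }) ∷ s
      ; meets = λ { (here e) _ → inj₁ e ; (there i) t → inj₂ (only i t) }
      ; fresh = λ { (here refl) → f∉ ; (there i) → fresh′ i } }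
      where
      fresh′ : ∀ {h} → h ∈ₑ q → h ∉ K
      fresh′ {h} i h∈ with Incident⇒Joins h (inj₁ refl)
      ... | t , j with only (Incident⇒∈ᵥ q i (Joins⇒Incidentˡ j)) (h , h∈ , Joins⇒Incidentˡ j)
                     | only (Incident⇒∈ᵥ q i (Joins⇒Incidentʳ j)) (h , h∈ , Joins⇒Incidentʳ j)
      ... | refl | refl = loopless j

    module _ (positive : (q : Walk a z) → Simple q → ¬ e ∈ₑ q → σ e * walkSign σ q ≡ Sign.+) where

      positive′ : Joins e s t → (q : Walk s t) → Simple q → ¬ e ∈ₑ q → σ e * walkSign σ q ≡ Sign.+
      positive′ j q sq e∉ with Joins-unique j eⱼ
      ... | inj₁ (refl , refl) = positive q sq e∉
      ... | inj₂ (refl , refl) = trans (cong (σ e *_) (sym (walkSign-reverse σ q)))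
        (positive (reverse q) (Simple-reverse q sq) (e∉ ∘ ∈ₑ-reverse⁻ q))

      record Grown (K : Subset m) : Set where
        field
          e∈        : e ∈ K
          ζ         : Fin n → Sign
          potential : Potential ζ K
          linked    : Touches K x → Touches K y → x ≢ y → Linked K x y

      start : Grown ⁅ e ⁆
      start = record
        { e∈ = x∈⁅x⁆ e
        ; ζ = ζ
        ; potential = λ f∈ j → case x∈⁅y⁆⇒x≡y e f∈ of λ { refl → pos j }
        ; linked = λ { (f , f∈ , i) (g , g∈ , k) x≢y → link (subst (λ h → Incident h _) (x∈⁅y⁆⇒x≡y e f∈) i)
                                                            (subst (λ h → Incident h _) (x∈⁅y⁆⇒x≡y e g∈) k) x≢y }
        }
        where
        ζ : Fin n → Sign
        ζ v = if does (v ≟ a) then Sign.+ else σ e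
        ζa : ζ a ≡ Sign.+
        ζa with a ≟ a
        ... | yes _ = refl
        ... | no ¬e = contradiction refl ¬e
        ζz : ζ z ≡ σ e
        ζz with z ≟ a
        ... | yes refl = contradiction eⱼ loopless
        ... | no _ = refl
        pos : Joins e u v → σ e ≡ ζ u * ζ v
        pos j with Joins-unique j eⱼ
        ... | inj₁ (refl , refl) = sym (cong₂ _*_ ζa ζz)
        ... | inj₂ (refl , refl) = sym (trans (cong₂ _*_ ζz ζa) (Sign.*-identityʳ _))
        link : Incident e x → Incident e y → x ≢ y → Linked ⁅ e ⁆ x y
        link {x} {y} i k x≢y = x , y , j , record
          { first = [] ; second = [] ; first-simple = [] ∷ [] ; second-simple = [] ∷ []
          ; first⊆ = λ () ; second⊆ = λ () ; disjoint = λ { (here refl) (here e) → x≢y e } }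
          where
          j : Joins e x y
          j with Incident⇒Joins e i
          ... | y′ , j with Incident-Joins j k
          ... | inj₁ e = contradiction (sym e) x≢y
          ... | inj₂ refl = j

      module Step {K : Subset m} (grown : Grown K) where
        open Grown grown

        end-touches : Joins e s t → Touches K s
        end-touches j = e , e∈ , Joins⇒Incidentˡ j

        first-touches : ((s , t , j , l) : Linked K x y) → v ∈ᵥ Linkage.first l → Touches K v
        first-touches (s , t , j , l) = walk-touches (Linkage.first l) (Linkage.first⊆ l) (end-touches j)

        second-touches : ((s , t , j , l) : Linked K x y) → v ∈ᵥ Linkage.second l → Touches K v
        second-touches (s , t , j , l) = walk-touches (Linkage.second l) (Linkage.second⊆ l) (end-touches (Joins-sym j))

        module _ (ear : Ear K) where
          open Ear ear renaming (from to x₀; to to y₀; path to P)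

          -- In the circle made of `e`, the linkage and the ear, the potential evaluates everything
          -- except `P`. Positivity of this circle then leaves one value for the sign of `P`.
          earSign : walkSign σ P ≡ ζ x₀ * ζ y₀
          earSign with linked from∈ to∈ distinct
          ... | L@(s , t , j , l) = cancel (ζ s) (ζ t) (ζ x₀) (ζ y₀) (walkSign σ P) (subst₂ (λ b c → b * c ≡ Sign.+)
                  (potential e∈ j) sign-q (positive′ j q simple-q e∉q))
            where
            open Linkage l
            q : Walk s t
            q = first · (P · reverse second)
            meet-P : v ∈ᵥ P → v ∈ᵥ reverse second → v ≡ y₀
            meet-P i k with meets i (second-touches L (∈ᵥ-reverse⁻ second k))
            ... | inj₂ e = e
            ... | inj₁ refl = contradiction (∈ᵥ-reverse⁻ second k) (disjoint (end∈ first))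
            meet-first : v ∈ᵥ first → v ∈ᵥ P · reverse second → v ≡ x₀
            meet-first i k with ∈ᵥ-·⁻ P k
            ... | inj₂ k′ = contradiction (∈ᵥ-reverse⁻ second k′) (disjoint i)
            ... | inj₁ k′ with meets k′ (first-touches L i)
            ... | inj₁ e = e
            ... | inj₂ refl = contradiction (end∈ second) (disjoint i)
            simple-q : Simple q
            simple-q = Simple-·⁺ first _ first-simple
              (Simple-·⁺ P _ simple (Simple-reverse second second-simple) meet-P) meet-first
            e∉q : ¬ e ∈ₑ q
            e∉q i with ∈ₑ-·⁻ first i
            ... | inj₁ k = disjoint (Incident⇒∈ᵥ first k (Joins⇒Incidentʳ j)) (start∈ second)
            ... | inj₂ k with ∈ₑ-·⁻ P k
            ...   | inj₂ k′ = disjoint (start∈ first) (Incident⇒∈ᵥ second (∈ₑ-reverse⁻ second k′) (Joins⇒Incidentˡ j))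
            ...   | inj₁ k′ = fresh k′ e∈
            sign-q : walkSign σ q ≡ (ζ s * ζ x₀) * (walkSign σ P * (ζ t * ζ y₀))
            sign-q = trans (walkSign-· σ first _) (cong₂ _*_ (walkSign-potential {ζ = ζ} potential first first⊆)
              (trans (walkSign-· σ P _) (cong (walkSign σ P *_)
                (trans (walkSign-reverse σ second) (walkSign-potential {ζ = ζ} potential second second⊆)))))
            cancel : ∀ s t x y p → (s * t) * ((s * x) * (p * (t * y))) ≡ Sign.+ → p ≡ x * y
            cancel = from-yes (∀⁵ λ s t x y p → ((s * t) * ((s * x) * (p * (t * y))) Sign.≟ Sign.+) →-dec (p Sign.≟ x * y))

          K′ : Subset m
          K′ = K ∪ edgeSet P

          K⊂K′ : K ⊂ K′
          K⊂K′ = x∈p∪q⁺ ∘ inj₁ , (let f , f∈ , _ = ∈ᵥ⇒Incident P distinct (start∈ P) in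
                                  f , x∈p∪q⁺ (inj₂ (∈-edgeSet⁺ P f∈)) , fresh f∈)

          P⊆K′ : ∀ {f} → f ∈ₑ P → f ∈ K′
          P⊆K′ = x∈p∪q⁺ ∘ inj₂ ∘ ∈-edgeSet⁺ P

          K′-touches : Touches K′ v → Touches K v ⊎ v ∈ᵥ P
          K′-touches (f , f∈ , i) with x∈p∪q⁻ K _ f∈
          ... | inj₁ k = inj₁ (f , k , i)
          ... | inj₂ k = inj₂ (Incident⇒∈ᵥ P (∈-edgeSet⁻ P k) i)

          -- Along the ear the values continue from `ζ x₀`. At the other end `y₀` they agree with
          -- the old potential by `earSign`, so the two parts of the definition fit together.
          ζ′ : Fin n → Sign
          ζ′ v = if does (v ∈ₗ? vertices P) then ζ x₀ * prefixSign P v else ζ v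

          ζ′-P : v ∈ᵥ P → ζ′ v ≡ ζ x₀ * prefixSign P v
          ζ′-P {v} i with v ∈ₗ? vertices P
          ... | yes _ = refl
          ... | no v∉ = contradiction i v∉

          ζ′-K : Touches K v → ζ′ v ≡ ζ v
          ζ′-K {v} tv with v ∈ₗ? vertices P
          ... | no _ = refl
          ... | yes i with meets i tv
          ...   | inj₁ refl = trans (cong (ζ x₀ *_) (prefixSign-start P)) (Sign.*-identityʳ _)
          ...   | inj₂ refl = trans (cong (ζ x₀ *_) (trans (prefixSign-end P simple) earSign))
                  (trans (sym (Sign.*-assoc (ζ x₀) _ _)) (cong (_* ζ y₀) (Sign.s*s≡+ (ζ x₀))))

          potential′ : Potential ζ′ K′
          potential′ {f} f∈ j with x∈p∪q⁻ K _ f∈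
          ... | inj₁ k = trans (potential k j)
                (sym (cong₂ _*_ (ζ′-K (f , k , Joins⇒Incidentˡ j)) (ζ′-K (f , k , Joins⇒Incidentʳ j))))
          ... | inj₂ k = let k′ = ∈-edgeSet⁻ P k in trans (prefixSign-edge P simple k′ j)
                (sym (trans (cong₂ _*_ (ζ′-P (Incident⇒∈ᵥ P k′ (Joins⇒Incidentˡ j))) (ζ′-P (Incident⇒∈ᵥ P k′ (Joins⇒Incidentʳ j))))
                            (common-factor (ζ x₀) _ _)))

          widen : Linked K x y → Linked K′ x y
          widen (s , t , j , l) = s , t , j , Linkage-mono (x∈p∪q⁺ ∘ inj₁) l

          -- The end `x₀` of the ear is linked with `y` inside `K`, and the path to `x₀` is
          -- prolonged along the ear to `x`. This needs `x₀` and `y` to differ; `step-inner`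
          -- reverses the ear if they coincide.
          inner-linked : x ∈ᵥ P → ¬ Touches K x → Touches K y → x₀ ≢ y → Linked K′ x y
          inner-linked {x} {y} x∈ ¬tx ty x₀≢y with linked from∈ ty x₀≢y | splitAt P x∈
          ... | L@(s , t , j , l) | P₁ , P₂ , eq = s , t , j ,
            Linkage-extend (Linkage-mono (x∈p∪q⁺ ∘ inj₁) l) P₁ (Simple-·ˡ P₁ simple′)
              (λ i → P⊆K′ (subst (_ ∈ₑ_) (sym eq) (∈ₑ-·ˡ P₁ i)))
              (λ i k → only k (first-touches L i))
              (λ { i k → case only i (second-touches L k) of λ { refl → Linkage.disjoint l (end∈ (Linkage.first l)) k } })
            where
            simple′ : Simple (P₁ · P₂)
            simple′ = subst Simple eq simple
            only : ∀ {r} → r ∈ᵥ P₁ → Touches K r → r ≡ x₀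
            only {r} i tr with meets (subst (_ ∈ᵥ_) (sym eq) (∈ᵥ-·ˡ P₁ i)) tr
            ... | inj₁ e = e
            ... | inj₂ refl = contradiction (subst (Touches K) (Simple-·-meet P₁ simple′ i (end∈ P₂)) tr) ¬tx

          -- For two vertices inside the ear, the linkage to its ends is prolonged at both ends,
          -- along the outer pieces `P₁` and `P₃`.
          inner-linked₂ : (P₁ : Walk x₀ x) (P₂ : Walk x y) (P₃ : Walk y y₀) → P ≡ P₁ · (P₂ · P₃) →
                          ¬ Touches K x → ¬ Touches K y → x ≢ y → Linked K′ x y
          inner-linked₂ {x} {y} P₁ P₂ P₃ eq ¬tx ¬ty x≢y with linked from∈ to∈ distinct
          -- `Linkage-extend` prolongs only the first path, so the linkage is swapped for the second
          -- prolongation and swapped back.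
          ... | L@(s , t , j , l) = Linked-sym (t , s , Joins-sym j ,
            Linkage-extend (Linkage-swap l₁) (reverse P₃) (Simple-reverse P₃ s₃)
              (λ i → P⊆K′ (subst (_ ∈ₑ_) (sym eq) (∈ₑ-·ʳ P₁ (∈ₑ-·ʳ P₂ (∈ₑ-reverse⁻ P₃ i)))))
              (λ i k → only₃ (∈ᵥ-reverse⁻ P₃ k) (second-touches L i))
              (λ i k → avoid (∈ᵥ-reverse⁻ P₃ i) (∈ᵥ-·⁻ first k)))
            where
            open Linkage l
            simple′ : Simple (P₁ · (P₂ · P₃))
            simple′ = subst Simple eq simple
            s₃ : Simple P₃
            s₃ = Simple-·ʳ P₂ (Simple-·ʳ P₁ simple′)
            only₁ : ∀ {r} → r ∈ᵥ P₁ → Touches K r → r ≡ x₀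
            only₁ i tr with meets (subst (_ ∈ᵥ_) (sym eq) (∈ᵥ-·ˡ P₁ i)) tr
            ... | inj₁ e = e
            ... | inj₂ refl = contradiction (subst (Touches K) (Simple-·-meet P₁ simple′ i (end∈ (P₂ · P₃))) tr) ¬tx
            only₃ : ∀ {r} → r ∈ᵥ P₃ → Touches K r → r ≡ y₀
            only₃ i tr with meets (subst (_ ∈ᵥ_) (sym eq) (∈ᵥ-·ʳ P₁ (∈ᵥ-·ʳ P₂ i))) tr
            ... | inj₂ e = e
            ... | inj₁ refl = contradiction (subst (Touches K) (Simple-·-meet P₁ simple′ (start∈ P₁) (∈ᵥ-·ʳ P₂ i)) tr) ¬tx
            l₁ : Linkage K′ s t x y₀
            l₁ = Linkage-extend (Linkage-mono (x∈p∪q⁺ ∘ inj₁) l) P₁ (Simple-·ˡ P₁ simple′)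
              (λ i → P⊆K′ (subst (_ ∈ₑ_) (sym eq) (∈ₑ-·ˡ P₁ i)))
              (λ i k → only₁ k (first-touches L i))
              (λ { i k → case only₁ i (second-touches L k) of λ { refl → disjoint (end∈ first) k } })
            avoid : ∀ {r} → r ∈ᵥ P₃ → r ∈ᵥ first ⊎ r ∈ᵥ P₁ → Empty
            avoid i (inj₁ k) with only₃ i (first-touches L k)
            ... | refl = disjoint k (end∈ second)
            avoid i (inj₂ k) with Simple-·-meet P₁ simple′ k (∈ᵥ-·ʳ P₂ i)
            ... | refl = x≢y (Simple-·-meet P₂ (Simple-·ʳ P₁ simple′) (start∈ P₂) i)

        module _ (ear : Ear K) where
          open Ear ear renaming (from to x₀; to to y₀; path to P)

          step-inner : x ∈ᵥ P → ¬ Touches K x → Touches K y → Linked (K′ ear) x y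
          step-inner {x} {y} x∈ ¬tx ty with x₀ ≟ y
          ... | no x₀≢y = inner-linked ear x∈ ¬tx ty x₀≢y
          ... | yes refl = let s , t , j , l = inner-linked (reverseEar ear) (∈ᵥ-reverse⁺ P x∈) ¬tx ty (≢-sym distinct)
                           in s , t , j , Linkage-mono back l
            where
            back : K′ (reverseEar ear) ⊆ K′ ear
            back i with x∈p∪q⁻ K _ i
            ... | inj₁ k = x∈p∪q⁺ (inj₁ k)
            ... | inj₂ k = P⊆K′ ear (∈ₑ-reverse⁻ P (∈-edgeSet⁻ (reverse P) k))

          step-inner₂ : x ∈ᵥ P → y ∈ᵥ P → ¬ Touches K x → ¬ Touches K y → x ≢ y → Linked (K′ ear) x y
          step-inner₂ {x} {y} x∈ y∈ ¬tx ¬ty x≢y with splitAt P x∈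
          ... | P₁ , P₂ , eq with ∈ᵥ-·⁻ P₁ (subst (y ∈ᵥ_) eq y∈)
          ... | inj₂ i = let Q₁ , Q₂ , eq′ = splitAt P₂ i in
            inner-linked₂ ear P₁ Q₁ Q₂ (trans eq (cong (P₁ ·_) eq′)) ¬tx ¬ty x≢y
          ... | inj₁ i = let Q₁ , Q₂ , eq′ = splitAt P₁ i in
            Linked-sym (inner-linked₂ ear Q₁ Q₂ P₂ (trans eq (trans (cong (_· P₂) eq′) (·-assoc Q₁ Q₂ P₂))) ¬ty ¬tx (≢-sym x≢y))

          grown′ : Grown (K′ ear)
          grown′ = record
            { e∈ = x∈p∪q⁺ (inj₁ e∈) ; ζ = ζ′ ear ; potential = potential′ ear ; linked = linked′ }
            where
            on-P : Touches (K′ ear) v → ¬ Touches K v → v ∈ᵥ P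
            on-P t ¬t with K′-touches ear t
            ... | inj₁ t′ = contradiction t′ ¬t
            ... | inj₂ i = i
            linked′ : Touches (K′ ear) x → Touches (K′ ear) y → x ≢ y → Linked (K′ ear) x y
            linked′ {x} {y} tx ty x≢y with touches? K x | touches? K y
            ... | yes p | yes q = widen ear (linked p q x≢y)
            ... | no ¬p | yes q = step-inner (on-P tx ¬p) ¬p q
            ... | yes p | no ¬q = Linked-sym (step-inner (on-P ty ¬q) ¬q p)
            ... | no ¬p | no ¬q = step-inner₂ (on-P tx ¬p) (on-P ty ¬q) ¬p ¬q x≢y

      balanced : ∃[ ζ ] (∀ {f u v} → Joins f u v → σ f ≡ ζ u * ζ v)
      balanced = growAll start (⊃-wellFounded _)
        where
        growAll : ∀ {K} → Grown K → Acc _⊃_ K → ∃[ ζ ] (∀ {f u v} → Joins f u v → σ f ≡ ζ u * ζ v)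
        growAll {K} g (acc rs) with any? (λ f → ¬? (f ∈? K))
        ... | no all = ζ , λ {f} j → potential (member f) j
          where
          open Grown g
          member : ∀ f → f ∈ K
          member f with f ∈? K
          ... | yes i = i
          ... | no f∉ = contradiction (f , f∉) all
        ... | yes (f , f∉) = let ear = findEar K (e , Grown.e∈ g , Joins⇒Incidentˡ eⱼ) f f∉ in
              growAll (Step.grown′ g ear) (rs (Step.K⊂K′ g ear))

-- The circle opened at `e`: ranks, segments and arcs.

record Route {n m : ℕ} (G : Graph (Fin n) (Fin m)) (C : Subset m) (e : Fin m) : Set where
  open Circles G
  field
    {a z}  : Fin n
    eⱼ     : Joins e a z
    p₀     : Walk a z
    simple₀ : Simple p₀
    e∉p₀   : ¬ e ∈ₑ p₀
    C≡     : circuit e p₀ ≡ C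

module CircleThrough {n m : ℕ} {G : Graph (Fin n) (Fin m)} (loopless : Circles.Loopless G)
                     {C : Subset m} {e : Fin m} (route : Route G C e) where
  open Circles G
  open CirclesLoopless loopless
  open Components G
  open Route route
  open FiniteGraph G using (Bridge; chord; component; IsOuterComponent)
  private variable
    s t u v w x y x′ y′ : Fin n
    f g : Fin m
    D D′ : Bridge C

  a≢z : a ≢ z
  a≢z refl = loopless eⱼ

  On : Fin n → Set
  On v = v ∈ᵥ p₀

  rk : Fin n → ℕ
  rk = rank p₀

  on? : Decidable On
  on? v = v ∈ₗ? vertices p₀

  ∈C⁻ : f ∈ C → f ≡ e ⊎ f ∈ₑ p₀
  ∈C⁻ i = ∈-circuit⁻ p₀ (subst (_ ∈_) (sym C≡) i)

  p₀⊆C : f ∈ₑ p₀ → f ∈ C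
  p₀⊆C i = subst (_ ∈_) C≡ (∈-circuit⁺ p₀ i)

  e∈C : e ∈ C
  e∈C = subst (_ ∈_) C≡ (e∈circuit p₀)

  On⇒Touches : On v → Touches C v
  On⇒Touches i = subst (λ F → Touches F _) C≡ (Touches-circuit⁺ eⱼ p₀ i)

  Touches⇒On : Touches C v → On v
  Touches⇒On t = Touches-circuit⁻ eⱼ p₀ (subst (λ F → Touches F _) (sym C≡) t)

  rk-injective : On u → On v → rk u ≡ rk v → u ≡ v
  rk-injective = rank-injective p₀

  rk-a : rk a ≡ 0
  rk-a = rank-start p₀

  rk≤rk-z : On v → rk v ≤ rk z
  rk≤rk-z i = subst (rk _ ≤_) (sym (rank-end p₀ simple₀)) (rank≤len p₀ i)

  rk-a≤ : rk a ≤ rk v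
  rk-a≤ {v} = subst (_≤ rk v) (sym rk-a) z≤n

  rk-edge : f ∈ₑ p₀ → Joins f u v → rk v ≡ suc (rk u) ⊎ rk u ≡ suc (rk v)
  rk-edge f∈ k with Joins-walk p₀ f∈
  ... | s , t , q , j , r , eq with Joins-unique k j
  ... | inj₁ (refl , refl) = inj₁ (rank-step p₀ simple₀ q j r eq)
  ... | inj₂ (refl , refl) = inj₂ (rank-step p₀ simple₀ q j r eq)

  edge-On : f ∈ₑ p₀ → Joins f u v → On u
  edge-On f∈ j = Incident⇒∈ᵥ p₀ f∈ (Joins⇒Incidentˡ j)

  -- Ranks are injective on `p₀`, so such an edge would be a loop. This refutes configurations in
  -- which an edge lies in two segments that have at most a vertex in common.
  edge-not-level : ∀ {k} → f ∈ₑ p₀ → ¬ (∀ {v} → Incident f v → rk v ≡ k)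
  edge-not-level {f} f∈ level with Incident⇒Joins f (inj₁ refl)
  ... | t , j = loopless (subst (Joins f _) (sym (rk-injective (edge-On f∈ j) (edge-On f∈ (Joins-sym j))
                  (trans (level (Joins⇒Incidentˡ j)) (sym (level (Joins⇒Incidentʳ j)))))) j)

  record Segment (x y : Fin n) : Set where
    field
      walk     : Walk x y
      simple   : Simple walk
      edges⊆   : f ∈ₑ walk → f ∈ₑ p₀
      on       : v ∈ᵥ walk → On v
      above    : v ∈ᵥ walk → rk x ≤ rk v
      below    : v ∈ᵥ walk → rk v ≤ rk y
      complete : On v → rk x ≤ rk v → rk v ≤ rk y → v ∈ᵥ walk
      complete-edges : f ∈ₑ p₀ → Joins f u v → rk x ≤ rk u → rk x ≤ rk v → rk u ≤ rk y → rk v ≤ rk y → f ∈ₑ walk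

  segment : On x → On y → rk x ≤ rk y → Segment x y
  segment {x} {y} x∈ y∈ x≤y = record
    { walk = walk ; simple = Simple-·ˡ walk s₂
    ; edges⊆ = λ i → subst (_ ∈ₑ_) (sym split) (∈ₑ-·ʳ before (∈ₑ-·ˡ walk i))
    ; on = λ i → subst (_ ∈ᵥ_) (sym split) (∈ᵥ-·ʳ before (∈ᵥ-·ˡ walk i))
    ; above = λ i → subst (λ p → rank p x ≤ rank p _) (sym split) (rank-suffix before s₁ (∈ᵥ-·ˡ walk i))
    ; below = λ i → subst (λ p → rank p _ ≤ rank p y) (sym split′) (rank-prefix (before · walk) s₁′ (∈ᵥ-·ʳ before i))
    ; complete = complete ; complete-edges = complete-edges }
    where
    open Between (between p₀ simple₀ x∈ y∈ x≤y)
    split′ : p₀ ≡ (before · walk) · after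
    split′ = trans split (sym (·-assoc before walk after))
    s₁ : Simple (before · (walk · after))
    s₁ = subst Simple split simple₀
    s₁′ : Simple ((before · walk) · after)
    s₁′ = subst Simple split′ simple₀
    s₂ : Simple (walk · after)
    s₂ = Simple-·ʳ before s₁
    complete : On v → rk x ≤ rk v → rk v ≤ rk y → v ∈ᵥ walk
    complete {v} i x≤v v≤y with ∈ᵥ-·⁻ before (subst (_ ∈ᵥ_) split i)
    ... | inj₁ k = subst (_∈ᵥ walk) (rk-injective x∈ i (ℕ.≤-antisym x≤v
                     (subst (λ p → rank p v ≤ rank p x) (sym split) (rank-prefix before s₁ k)))) (start∈ walk)
    ... | inj₂ k with ∈ᵥ-·⁻ walk k
    ...   | inj₁ l = l
    ...   | inj₂ l = subst (_∈ᵥ walk) (rk-injective y∈ i (ℕ.≤-antisym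
                     (subst (λ p → rank p y ≤ rank p v) (sym split′) (rank-suffix (before · walk) s₁′ l)) v≤y)) (end∈ walk)

    complete-edges : f ∈ₑ p₀ → Joins f u v → rk x ≤ rk u → rk x ≤ rk v → rk u ≤ rk y → rk v ≤ rk y → f ∈ₑ walk
    complete-edges {f} {u} {v} f∈ j x≤u x≤v u≤y v≤y with ∈ₑ-·⁻ before (subst (_ ∈ₑ_) split f∈)
    -- Vertices of `before` have rank at most `rk x`, so both ends of `f` would have exactly the
    -- rank of `x`.
    ... | inj₁ k = contradiction (λ {w} → level {w}) (edge-not-level f∈)
      where
      level : ∀ {w} → Incident f w → rk w ≡ rk x
      level {w} i with subst (λ p → rank p w ≤ rank p x) (sym split) (rank-prefix before s₁ (Incident⇒∈ᵥ before k i))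
                     | Incident-Joins j i
      ... | l | inj₁ refl = ℕ.≤-antisym l x≤u
      ... | l | inj₂ refl = ℕ.≤-antisym l x≤v
    ... | inj₂ k with ∈ₑ-·⁻ walk k
    ...   | inj₁ l = l
    ...   | inj₂ l = contradiction (λ {w} → level {w}) (edge-not-level f∈)
      where
      level : ∀ {w} → Incident f w → rk w ≡ rk y
      level {w} i with subst (λ p → rank p y ≤ rank p w) (sym split′) (rank-suffix (before · walk) s₁′ (Incident⇒∈ᵥ after l i))
                     | Incident-Joins j i
      ... | r | inj₁ refl = ℕ.≤-antisym u≤y r
      ... | r | inj₂ refl = ℕ.≤-antisym v≤y r

  segment-e∉ : (s : Segment x y) → ¬ e ∈ₑ Segment.walk s
  segment-e∉ s i = e∉p₀ (Segment.edges⊆ s i)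

  module Signs (σ : Fin m → Sign) where
    open Potentials G σ

    ψ : Fin n → Sign
    ψ = prefixSign p₀

    ψ-a : ψ a ≡ Sign.+
    ψ-a = prefixSign-start p₀

    ψ-z : ψ z ≡ walkSign σ p₀
    ψ-z = prefixSign-end p₀ simple₀

    -- `ψ` is a potential on the edges of `p₀`, so only the ends matter, even if the walk turns
    -- back.
    walkSign-along : (q : Walk u w) → (∀ {f} → f ∈ₑ q → f ∈ₑ p₀) → walkSign σ q ≡ ψ u * ψ w
    walkSign-along q q⊆ = walkSign-potential {ζ = ψ} {K = edgeSet p₀}
      (λ f∈ → prefixSign-edge p₀ simple₀ (∈-edgeSet⁻ p₀ f∈)) q (∈-edgeSet⁺ p₀ ∘ q⊆)

  module Outer (x∈ : On x) (y∈ : On y) (x<y : rk x < rk y) where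
    private
      module A = Segment (segment (start∈ p₀) x∈ rk-a≤)
      module Z = Segment (segment y∈ (end∈ p₀) (rk≤rk-z y∈))

    outer : Walk x y
    outer = reverse A.walk · step e eⱼ (reverse Z.walk)

    outer-simple : Simple outer
    outer-simple = Simple-·⁺ (reverse A.walk) _ (Simple-reverse A.walk A.simple)
      (All.tabulate (λ { i refl → apart (start∈ A.walk) (∈ᵥ-reverse⁻ Z.walk i) }) ∷ Simple-reverse Z.walk Z.simple)
      λ { i (here e) → e ; i (there k) → contradiction (∈ᵥ-reverse⁻ Z.walk k) (apart (∈ᵥ-reverse⁻ A.walk i)) }
      where
      apart : v ∈ᵥ A.walk → ¬ v ∈ᵥ Z.walk
      apart i k = ℕ.<⇒≱ x<y (ℕ.≤-trans (Z.above k) (A.below i))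

    e∈outer : e ∈ₑ outer
    e∈outer = ∈ₑ-·ʳ (reverse A.walk) (here refl)

    outer⊆C : f ∈ₑ outer → f ∈ C
    outer⊆C i with ∈ₑ-·⁻ (reverse A.walk) i
    ... | inj₁ k = p₀⊆C (A.edges⊆ (∈ₑ-reverse⁻ A.walk k))
    ... | inj₂ (here refl) = e∈C
    ... | inj₂ (there k) = p₀⊆C (Z.edges⊆ (∈ₑ-reverse⁻ Z.walk k))

    outer-vertices⁻ : v ∈ᵥ outer → On v × (rk v ≤ rk x ⊎ rk y ≤ rk v)
    outer-vertices⁻ i with ∈ᵥ-·⁻ (reverse A.walk) i
    ... | inj₁ k = let l = ∈ᵥ-reverse⁻ A.walk k in A.on l , inj₁ (A.below l)
    ... | inj₂ (here refl) = start∈ p₀ , inj₁ rk-a≤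
    ... | inj₂ (there k) = let l = ∈ᵥ-reverse⁻ Z.walk k in Z.on l , inj₂ (Z.above l)

    outer-vertices⁺ : On v → rk v ≤ rk x ⊎ rk y ≤ rk v → v ∈ᵥ outer
    outer-vertices⁺ i (inj₁ l) = ∈ᵥ-·ˡ (reverse A.walk) (∈ᵥ-reverse⁺ A.walk (A.complete i rk-a≤ l))
    outer-vertices⁺ i (inj₂ l) = ∈ᵥ-·ʳ (reverse A.walk) (there (∈ᵥ-reverse⁺ Z.walk (Z.complete i l (rk≤rk-z i))))

    outer-edges⁺ : f ∈ₑ p₀ → Joins f u v → (rk u ≤ rk x × rk v ≤ rk x) ⊎ (rk y ≤ rk u × rk y ≤ rk v) → f ∈ₑ outer
    outer-edges⁺ f∈ j (inj₁ (u≤ , v≤)) =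
      ∈ₑ-·ˡ (reverse A.walk) (∈ₑ-reverse⁺ A.walk (A.complete-edges f∈ j rk-a≤ rk-a≤ u≤ v≤))
    outer-edges⁺ f∈ j (inj₂ (≤u , ≤v)) =
      ∈ₑ-·ʳ (reverse A.walk) (there (∈ₑ-reverse⁺ Z.walk (Z.complete-edges f∈ j ≤u ≤v
        (rk≤rk-z (edge-On f∈ j)) (rk≤rk-z (edge-On f∈ (Joins-sym j))))))

    module _ (σ : Fin m → Sign) where
      open Potentials G σ
      open Signs σ

      -- Up to the order of the factors, this is `ψ x * ψ y` times the sign of `C`: the two arcs of
      -- `C` from `x` to `y` differ by the sign of `C`.
      walkSign-outer : walkSign σ outer ≡ prefixSign p₀ x * (σ e * (walkSign σ p₀ * prefixSign p₀ y))
      walkSign-outer = trans (walkSign-· σ (reverse A.walk) _) (cong₂ _*_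
        (trans (walkSign-reverse σ A.walk) (trans (walkSign-along A.walk A.edges⊆) (cong (_* prefixSign p₀ x) (prefixSign-start p₀))))
        (cong (σ e *_) (trans (walkSign-reverse σ Z.walk) (trans (walkSign-along Z.walk Z.edges⊆)
          (trans (Sign.*-comm (prefixSign p₀ y) _) (cong (_* prefixSign p₀ y) (prefixSign-end p₀ simple₀)))))))

  -- A walk in C crosses the cut {f , e} of C an odd number of times exactly if
  -- its ends lie on different sides.
  private
    indicator : ∀ {A : Set} → Dec A → Sign
    indicator (yes _) = Sign.-
    indicator (no _)  = Sign.+

    occurs : Fin m → List (Fin m) → Sign
    occurs f []       = Sign.+
    occurs f (g ∷ gs) = indicator (f ≟ g) * occurs f gs

    occurs⇒∈ : ∀ gs → occurs f gs ≡ Sign.- → f ∈ₗ gs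
    occurs⇒∈ {f} (g ∷ gs) eq with f ≟ g
    ... | yes refl = here refl
    ... | no _ = there (occurs⇒∈ gs eq)

    ∈⇒occurs : ∀ gs → Unique gs → f ∈ₗ gs → occurs f gs ≡ Sign.-
    ∈⇒occurs {f} (g ∷ gs) (a ∷ s) i with f ≟ g
    ... | yes refl with occurs f gs in eq
    ...   | Sign.+ = refl
    ...   | Sign.- = contradiction refl (All.lookup a (occurs⇒∈ gs eq))
    ∈⇒occurs (g ∷ gs) (a ∷ s) (here e)  | no ¬e = contradiction e ¬e
    ∈⇒occurs (g ∷ gs) (a ∷ s) (there i) | no ¬e = ∈⇒occurs gs s i

    module Cut {f : Fin m} (f∈ : f ∈ₑ p₀) where

      k : ℕ
      k = rk (proj₁ (Joins-walk p₀ f∈))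

      side : Fin n → Sign
      side v = indicator (rk v ℕ.≤? k)

      side-low : rk v ≤ k → side v ≡ Sign.-
      side-low {v} l with rk v ℕ.≤? k
      ... | yes _ = refl
      ... | no ¬l = contradiction l ¬l

      side-high : k < rk v → side v ≡ Sign.+
      side-high {v} l with rk v ℕ.≤? k
      ... | yes l′ = contradiction l′ (ℕ.<⇒≱ l)
      ... | no _ = refl

      f-ends : ∃₂ λ s t → Joins f s t × rk s ≡ k × rk t ≡ suc k
      f-ends with Joins-walk p₀ f∈
      ... | s , t , q , j , r , eq = s , t , j , refl , rank-step p₀ simple₀ q j r eq

      f-unique : g ∈ₑ p₀ → Joins g u v → rk u ≡ k → rk v ≡ suc k → g ≡ f
      f-unique {g} g∈ i u≡ v≡ with Joins-walk p₀ f∈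
      ... | s , t , q , j , r , eq with ∈ₑ-·⁻ q (subst (g ∈ₑ_) eq g∈)
      ... | inj₁ g∈q = contradiction (subst₂ _≤_ v≡ refl
              (subst (λ p → rank p _ ≤ rank p s) (sym eq) (rank-prefix q (subst Simple eq simple₀) (Incident⇒∈ᵥ q g∈q (Joins⇒Incidentʳ i)))))
              (ℕ.<⇒≱ (ℕ.n<1+n _))
      ... | inj₂ (here g≡f) = g≡f
      ... | inj₂ (there g∈r) with Simple-fresh j r (Simple-·ʳ q (subst Simple eq simple₀)) (Incident⇒∈ᵥ r g∈r (Joins⇒Incidentˡ i))
      ... | s≢u = contradiction (sym (rk-injective (edge-On g∈ i) (edge-On f∈ j) u≡)) s≢u

      -- An edge of `p₀` joins consecutive ranks, so it changes sides only between `k` and `k + 1`,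
      -- where it is `f`. The edge `e` joins the extreme ranks and always changes sides.
      crossing : Joins g u v → g ∈ C → side u * side v ≡ indicator (f ≟ g) * indicator (e ≟ g)
      crossing {g} {u} {v} i g∈C with ∈C⁻ g∈C
      crossing {g} {u} {v} i g∈C | inj₁ refl with f ≟ e | e ≟ e | Joins-unique i eⱼ | f-ends
      ... | yes refl | _ | _ | _ = contradiction f∈ e∉p₀
      ... | no _ | no ¬e | _ | _ = contradiction refl ¬e
      ... | no _ | yes _ | inj₁ (refl , refl) | s , t , j , s≡ , t≡ =
        cong₂ _*_ (side-low {a} rk-a≤k) (side-high {z} k<rk-z)
        where
        rk-a≤k = subst (rk a ≤_) s≡ rk-a≤
        k<rk-z = subst (_≤ rk z) t≡ (rk≤rk-z (edge-On f∈ (Joins-sym j)))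
      ... | no _ | yes _ | inj₂ (refl , refl) | s , t , j , s≡ , t≡ =
        cong₂ _*_ (side-high {z} k<rk-z) (side-low {a} rk-a≤k)
        where
        rk-a≤k = subst (rk a ≤_) s≡ rk-a≤
        k<rk-z = subst (_≤ rk z) t≡ (rk≤rk-z (edge-On f∈ (Joins-sym j)))
      crossing {g} {u} {v} i g∈C | inj₂ g∈ with e ≟ g
      ... | yes refl = contradiction g∈ e∉p₀
      ... | no _ with f ≟ g | f-ends
      ...   | yes refl | s , t , j , s≡ , t≡ with Joins-unique i j
      ...     | inj₁ (refl , refl) = cong₂ _*_ (side-low {s} (ℕ.≤-reflexive s≡)) (side-high {t} (ℕ.≤-reflexive (sym t≡)))
      ...     | inj₂ (refl , refl) = cong₂ _*_ (side-high {t} (ℕ.≤-reflexive (sym t≡))) (side-low {s} (ℕ.≤-reflexive s≡))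
      crossing {g} {u} {v} i g∈C | inj₂ g∈ | no _ | no f≢g | _ with rk-edge g∈ i | ℕ.<-cmp (rk u) k | ℕ.<-cmp (rk v) k
      ... | inj₁ v≡ | tri< u<k _ _ | _ = cong₂ _*_ (side-low {u} (ℕ.<⇒≤ u<k)) (side-low {v} (subst (_≤ k) (sym v≡) u<k))
      ... | inj₁ v≡ | tri≈ _ u≡k _ | _ = contradiction (sym (f-unique g∈ i u≡k (trans v≡ (cong suc u≡k)))) f≢g
      ... | inj₁ v≡ | tri> _ _ k<u | _ = cong₂ _*_ (side-high {u} k<u) (side-high {v} (ℕ.≤-trans k<u (subst (rk u ≤_) (sym v≡) (ℕ.n≤1+n _))))
      ... | inj₂ u≡ | _ | tri< v<k _ _ = cong₂ _*_ (side-low {u} (subst (_≤ k) (sym u≡) v<k)) (side-low {v} (ℕ.<⇒≤ v<k))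
      ... | inj₂ u≡ | _ | tri≈ _ v≡k _ = contradiction (sym (f-unique g∈ (Joins-sym i) v≡k (trans u≡ (cong suc v≡k)))) f≢g
      ... | inj₂ u≡ | _ | tri> _ _ k<v = cong₂ _*_ (side-high {u} (ℕ.≤-trans k<v (subst (rk v ≤_) (sym u≡) (ℕ.n≤1+n _)))) (side-high {v} k<v)

      parity : (q : Walk u w) → (∀ {g} → g ∈ₑ q → g ∈ C) →
               side u * side w ≡ occurs f (edges q) * occurs e (edges q)
      parity {u} [] _ = Sign.s*s≡+ (side u)
      parity {u} {w} (step {v = v} g j q) q⊆ =
        chain (side u) (side v) (side w) (indicator (f ≟ g)) (indicator (e ≟ g)) _ _ (crossing j (q⊆ (here refl))) (parity q (q⊆ ∘ there))
        where
        chain : ∀ a b c d d′ o o′ → a * b ≡ d * d′ → b * c ≡ o * o′ →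
                a * c ≡ (d * o) * (d′ * o′)
        chain = from-yes (∀⁵ λ a b c d d′ → ∀² λ o o′ → (a * b Sign.≟ d * d′) →-dec ((b * c Sign.≟ o * o′) →-dec
          (a * c Sign.≟ (d * o) * (d′ * o′))))

  module _ (q q′ : Walk u w) (s : Simple q) (s′ : Simple q′)
           (q⊆ : ∀ {g} → g ∈ₑ q → g ∈ C) (q′⊆ : ∀ {g} → g ∈ₑ q′ → g ∈ C)
           (e⇒ : e ∈ₑ q → e ∈ₑ q′) (e⇐ : e ∈ₑ q′ → e ∈ₑ q) where

    -- Both walks have the same ends, so `parity` gives equal products of the parities of `f` and
    -- `e`. Those of `e` agree by hypothesis, hence so do those of `f`, and on a simple walk odd
    -- parity is membership. In this way an arc given only by a definition is recognised as a
    -- segment or as `outer`.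
    arc-edges : f ∈ₑ q → f ∈ₑ q′
    arc-edges {f} i with ∈C⁻ (q⊆ i)
    ... | inj₁ refl = e⇒ i
    ... | inj₂ f∈ = occurs⇒∈ (edges q′) (trans (sym same-f) (∈⇒occurs (edges q) (Simple⇒Unique-edges q s) i))
      where
      same-e : occurs e (edges q) ≡ occurs e (edges q′)
      same-e with occurs e (edges q) in eq | occurs e (edges q′) in eq′
      ... | Sign.+ | Sign.+ = refl
      ... | Sign.- | Sign.- = refl
      ... | Sign.- | Sign.+ = trans (sym (∈⇒occurs (edges q′) (Simple⇒Unique-edges q′ s′) (e⇒ (occurs⇒∈ (edges q) eq)))) eq′
      ... | Sign.+ | Sign.- = trans (sym eq) (∈⇒occurs (edges q) (Simple⇒Unique-edges q s) (e⇐ (occurs⇒∈ (edges q′) eq′)))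
      same-f : occurs f (edges q) ≡ occurs f (edges q′)
      same-f = Sign.*-cancelʳ-≡ (occurs e (edges q)) _ _ (trans (sym (Cut.parity f∈ q q⊆))
        (trans (Cut.parity f∈ q′ q′⊆) (cong (occurs f (edges q′) *_) (sym same-e))))

    arc-vertices : u ≢ w → v ∈ᵥ q → v ∈ᵥ q′
    arc-vertices u≢w i = let f , f∈ , inc = ∈ᵥ⇒Incident q u≢w i in Incident⇒∈ᵥ q′ (arc-edges f∈) inc

  arc-edgeSet : (q q′ : Walk u w) → Simple q → Simple q′ → (∀ {g} → g ∈ₑ q → g ∈ C) → (∀ {g} → g ∈ₑ q′ → g ∈ C) →
                (e ∈ₑ q → e ∈ₑ q′) → (e ∈ₑ q′ → e ∈ₑ q) → edgeSet q ≡ edgeSet q′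
  arc-edgeSet q q′ s s′ q⊆ q′⊆ e⇒ e⇐ = ⊆-antisym
    (λ i → ∈-edgeSet⁺ q′ (arc-edges q q′ s s′ q⊆ q′⊆ e⇒ e⇐ (∈-edgeSet⁻ q i)))
    (λ i → ∈-edgeSet⁺ q (arc-edges q′ q s′ s q′⊆ q⊆ e⇐ e⇒ (∈-edgeSet⁻ q′ i)))

  -- Bridges, their attachments, and paths through them.

  infix 4 _∈ᴮ_
  _∈ᴮ_ : Fin m → Bridge C → Set
  f ∈ᴮ D = FiniteGraph._∈ᵇ_ G C f D

  Att : Bridge C → Fin n → Set
  Att = FiniteGraph.Attachment G C

  Att⇒On : ∀ D → Att D v → On v
  Att⇒On D (t , _) = Touches⇒On t

  ∈ᴮ⇒∉C : ∀ D → f ∈ᴮ D → f ∉ C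
  ∈ᴮ⇒∉C (chord _ (x∉ , _)) refl = x∉
  ∈ᴮ⇒∉C (component D isD) (u , w , j , u∈ , _) f∈ = avoids u u∈ (_ , f∈ , Joins⇒Incidentˡ j)
    where open IsOuterComponent isD

  ∈ᴮ⇒Att : ∀ D → f ∈ᴮ D → Incident f v → On v → Att D v
  ∈ᴮ⇒Att D f∈ i v∈ = On⇒Touches v∈ , _ , f∈ , i

  Interior : Bridge C → Fin n → Set
  Interior (chord _ _)     v = Empty
  Interior (component D _) v = v ∈ D

  ∈ᴮ⇒Interior : ∀ D → f ∈ᴮ D → Incident f v → ¬ On v → Interior D v
  ∈ᴮ⇒Interior (chord _ (_ , u , w , _ , j , tu , tw)) refl i v∉ with Incident-Joins j i
  ... | inj₁ refl = v∉ (Touches⇒On tu)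
  ... | inj₂ refl = v∉ (Touches⇒On tw)
  ∈ᴮ⇒Interior (component D _) (u , w , j , u∈ , w∈) i v∉ with Incident-Joins j i | w∈
  ... | inj₁ refl | _       = u∈
  ... | inj₂ refl | inj₁ w∈D = w∈D
  ... | inj₂ refl | inj₂ tw = contradiction (Touches⇒On tw) v∉

  record Ear (D : Bridge C) (x y : Fin n) : Set where
    field
      path   : Walk x y
      simple : Simple path
      within : f ∈ₑ path → f ∈ᴮ D
      onC    : v ∈ᵥ path → On v → v ≡ x ⊎ v ≡ y

  Ear-interior : ∀ {D} → x ≢ y → (E : Ear D x y) → v ∈ᵥ Ear.path E → ¬ On v → Interior D v
  Ear-interior {D = D} x≢y E i v∉ =
    let f , f∈ , inc = ∈ᵥ⇒Incident (Ear.path E) x≢y i in ∈ᴮ⇒Interior D (Ear.within E f∈) inc v∉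

  module _ {D : Subset n} (isD : IsOuterComponent C D) where
    open IsOuterComponent isD

    walk-within : (q : Walk u w) → (∀ {t} → t ∈ᵥ q → t ∈ D) → f ∈ₑ q → f ∈ᴮ component D isD
    walk-within {f = f} q q⊆ i with Incident⇒Joins f (inj₁ refl)
    ... | t , j = _ , t , j , q⊆ (Incident⇒∈ᵥ q i (Joins⇒Incidentˡ j)) , inj₁ (q⊆ (Incident⇒∈ᵥ q i (Joins⇒Incidentʳ j)))

    -- Maximality of `D` keeps the walk in `D` until it meets `C`, which by `only` happens at its
    -- last vertex.
    escape-within : (q : Walk v w) → Simple q → v ∈ D → On w → (∀ {t} → t ∈ᵥ q → On t → t ≡ w) →
                    f ∈ₑ q → f ∈ᴮ component D isD
    escape-within (step {v = y} g j q) (_ ∷ s) v∈ w∈ only i with on? y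
    escape-within (step g j q) (_ ∷ s) v∈ w∈ only i | yes y∈ with only (there (start∈ q)) y∈
    ... | refl with Simple-loop q s | i
    ... | refl | here refl = _ , _ , j , v∈ , inj₂ (On⇒Touches y∈)
    escape-within (step g j q) (_ ∷ s) v∈ w∈ only i | no y∉
      with i | maximal g _ _ j v∈ (y∉ ∘ Touches⇒On)
    ... | here refl | y∈D = _ , _ , j , v∈ , inj₁ y∈D
    ... | there k   | y∈D = escape-within q s y∈D w∈ (only ∘ there) k

    foot : Att (component D isD) x → ∃₂ λ f u → Joins f u x × u ∈ D
    foot (tx , f , (u , w , j , u∈ , _) , inc) with Incident-Joins j inc
    ... | inj₁ refl = contradiction tx (avoids _ u∈)
    ... | inj₂ refl = f , u , j , u∈

    inD⇒¬On : u ∈ D → ¬ On u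
    inD⇒¬On u∈ i = avoids _ u∈ (On⇒Touches i)

    leg : Att (component D isD) x → u ∈ D → Σ[ q ∈ Walk x u ] Simple q ×
          (∀ {t} → t ∈ᵥ q → t ≡ x ⊎ t ∈ D) × (∀ {f} → f ∈ₑ q → f ∈ᴮ component D isD)
    leg {x} {u} ax u∈ with foot ax
    ... | f , s , j , s∈ with connected s u s∈ u∈
    ... | p , p⊆ with simplify (step f (Joins-sym j) p)
    ... | q , sq , v⊆ , e⊆ = q , sq , (λ i → vert (v⊆ i)) , (λ i → edg (e⊆ i))
      where
      vert : ∀ {t} → t ∈ᵥ step f (Joins-sym j) p → t ≡ x ⊎ t ∈ D
      vert (here refl) = inj₁ refl
      vert (there i)   = inj₂ (All.lookup p⊆ i)
      edg : ∀ {g} → g ∈ₑ step f (Joins-sym j) p → g ∈ᴮ component D isD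
      edg (here refl) = s , x , j , s∈ , inj₂ (proj₁ ax)
      edg (there i)   = walk-within p (All.lookup p⊆) i

  ear : ∀ D → Att D x → Att D y → x ≢ y → Ear D x y
  ear (chord f (_ , u , w , _ , j , _)) (_ , _ , refl , i) (_ , _ , refl , k) x≢y = record
    { path = step f joins [] ; simple = Simple-step joins x≢y
    ; within = λ { (here e) → e } ; onC = λ { (here e) _ → inj₁ e ; (there (here e)) _ → inj₂ e } }
    where
    joins : Joins f _ _
    joins with Incident-Joins j i | Incident-Joins j k
    ... | inj₁ refl | inj₁ refl = contradiction refl x≢y
    ... | inj₁ refl | inj₂ refl = j
    ... | inj₂ refl | inj₁ refl = Joins-sym j
    ... | inj₂ refl | inj₂ refl = contradiction refl x≢y
  ear {x} {y} (component D isD) ax ay x≢y with foot isD ay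
  ... | g , u , j , u∈ with leg isD ax u∈
  ... | p , _ , p⊆ , pᴮ with simplify (p · step g j [])
  ... | q , s , v⊆ , e⊆ = record
    { path = q ; simple = s ; within = λ i → edg (e⊆ i) ; onC = λ i → vert (v⊆ i) }
    where
    edg : ∀ {f} → f ∈ₑ p · step g j [] → f ∈ᴮ component D isD
    edg i with ∈ₑ-·⁻ p i
    ... | inj₁ k = pᴮ k
    ... | inj₂ (here refl) = u , y , j , u∈ , inj₂ (proj₁ ay)
    vert : ∀ {v} → v ∈ᵥ p · step g j [] → On v → v ≡ x ⊎ v ≡ y
    vert i v∈ with ∈ᵥ-·⁻ p i
    ... | inj₂ (there (here e)) = inj₂ e
    ... | inj₂ (here refl) = contradiction v∈ (inD⇒¬On isD u∈)
    ... | inj₁ k with p⊆ k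
    ...   | inj₁ e = inj₁ e
    ...   | inj₂ v∈D = contradiction v∈ (inD⇒¬On isD v∈D)

  -- A path from `y` into the bridge is stopped where it first hits `E`, at `c`. The three legs at
  -- `c` give three ears, and the leg from `y` occurs in both `E₁` and `E₂`, so it cancels in the
  -- product. A chord has only two ends, so only a component can have three attachments.
  tripod : ∀ σ D → Att D x → Att D y → Att D w → x ≢ y → x ≢ w → y ≢ w →
           Σ[ E ∈ Ear D x w ] Σ[ E₁ ∈ Ear D x y ] Σ[ E₂ ∈ Ear D y w ]
           walkSign σ (Ear.path E) ≡ walkSign σ (Ear.path E₁) * walkSign σ (Ear.path E₂)
  tripod σ (chord f (_ , _ , _ , _ , j , _)) (_ , _ , refl , i) (_ , _ , refl , k) (_ , _ , refl , l) x≢y x≢w y≢w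
    with Incident-Joins j i | Incident-Joins j k | Incident-Joins j l
  ... | inj₁ refl | inj₁ refl | _ = contradiction refl x≢y
  ... | inj₂ refl | inj₂ refl | _ = contradiction refl x≢y
  ... | inj₁ refl | inj₂ refl | inj₁ refl = contradiction refl x≢w
  ... | inj₁ refl | inj₂ refl | inj₂ refl = contradiction refl y≢w
  ... | inj₂ refl | inj₁ refl | inj₁ refl = contradiction refl y≢w
  ... | inj₂ refl | inj₁ refl | inj₂ refl = contradiction refl x≢w
  tripod {x} {y} {w} σ D′@(component D isD) ax ay aw x≢y x≢w y≢w with ear D′ ax aw x≢w
  -- Every edge of a component bridge has an end in `D`, so `E` has a vertex in `D` at which the leg
  -- from `y` can aim.
  ... | E with interiorVertex (Ear.path E) (Ear.within E) x≢w
    where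
    interiorVertex : (p : Walk x w) → (∀ {f} → f ∈ₑ p → f ∈ᴮ D′) → x ≢ w → ∃[ u ] u ∈ᵥ p × u ∈ D
    interiorVertex []           _  x≢w = contradiction refl x≢w
    interiorVertex p@(step f j q) p⊆ x≢w with p⊆ (here refl)
    ... | u , _ , k , u∈ , _ = u , Incident⇒∈ᵥ p (here refl) (Joins⇒Incidentˡ k) , u∈
  ... | u , u∈E , u∈D with leg isD ay u∈D
  ... | R , sR , R⊆ , Rᴮ with firstHit (λ v → v ∈ₗ? vertices (Ear.path E)) R u∈E (end∈ R)
  ... | c , Q , R₂ , refl , c∈E , first with splitAt (Ear.path E) c∈E
  ... | P₁ , P₂ , eq = E , E₁ , E₂ , sign
    where
    P  = Ear.path E
    y∉E : ¬ y ∈ᵥ P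
    y∉E i with Ear.onC E i (Att⇒On D′ ay)
    ... | inj₁ e = x≢y (sym e)
    ... | inj₂ e = y≢w e
    c∉C : ¬ On c
    c∉C with R⊆ (∈ᵥ-·ˡ Q (end∈ Q))
    ... | inj₁ refl = contradiction c∈E y∉E
    ... | inj₂ c∈D = inD⇒¬On isD c∈D
    simple : Simple (P₁ · P₂)
    simple = subst Simple eq (Ear.simple E)
    in₁ : ∀ {v} → v ∈ᵥ P₁ → v ∈ᵥ P
    in₁ i = subst (_ ∈ᵥ_) (sym eq) (∈ᵥ-·ˡ P₁ i)
    in₂ : ∀ {v} → v ∈ᵥ P₂ → v ∈ᵥ P
    in₂ i = subst (_ ∈ᵥ_) (sym eq) (∈ᵥ-·ʳ P₁ i)
    onQ : ∀ {v} → v ∈ᵥ Q → On v → v ≡ y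
    onQ i v∈ with R⊆ (∈ᵥ-·ˡ Q i)
    ... | inj₁ e = e
    ... | inj₂ v∈D = contradiction v∈ (inD⇒¬On isD v∈D)
    on₁ : ∀ {v} → v ∈ᵥ P₁ → On v → v ≡ x
    on₁ i v∈ with Ear.onC E (in₁ i) v∈
    ... | inj₁ e = e
    ... | inj₂ refl = contradiction (subst On (Simple-·-meet P₁ simple i (end∈ P₂)) v∈) c∉C
    on₂ : ∀ {v} → v ∈ᵥ P₂ → On v → v ≡ w
    on₂ i v∈ with Ear.onC E (in₂ i) v∈
    ... | inj₂ e = e
    ... | inj₁ refl = contradiction (subst On (Simple-·-meet P₁ simple (start∈ P₁) i) v∈) c∉C
    E₁ : Ear D′ x y
    E₁ = record
      { path = P₁ · reverse Q
      ; simple = Simple-·⁺ P₁ _ (Simple-·ˡ P₁ simple) (Simple-reverse Q (Simple-·ˡ Q sR))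
                   λ i k → first (∈ᵥ-reverse⁻ Q k) (in₁ i)
      ; within = λ i → case ∈ₑ-·⁻ P₁ i of λ
          { (inj₁ k) → Ear.within E (subst (_ ∈ₑ_) (sym eq) (∈ₑ-·ˡ P₁ k))
          ; (inj₂ k) → Rᴮ (∈ₑ-·ˡ Q (∈ₑ-reverse⁻ Q k)) }
      ; onC = λ i v∈ → case ∈ᵥ-·⁻ P₁ i of λ
          { (inj₁ k) → inj₁ (on₁ k v∈) ; (inj₂ k) → inj₂ (onQ (∈ᵥ-reverse⁻ Q k) v∈) } }
    E₂ : Ear D′ y w
    E₂ = record
      { path = Q · P₂
      ; simple = Simple-·⁺ Q _ (Simple-·ˡ Q sR) (Simple-·ʳ P₁ simple) λ i k → first i (in₂ k)
      ; within = λ i → case ∈ₑ-·⁻ Q i of λ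
          { (inj₁ k) → Rᴮ (∈ₑ-·ˡ Q k)
          ; (inj₂ k) → Ear.within E (subst (_ ∈ₑ_) (sym eq) (∈ₑ-·ʳ P₁ k)) }
      ; onC = λ i v∈ → case ∈ᵥ-·⁻ Q i of λ
          { (inj₁ k) → inj₁ (onQ k v∈) ; (inj₂ k) → inj₂ (on₂ k v∈) } }
    cancel : ∀ a b q → a * b ≡ (a * q) * (q * b)
    cancel = from-yes (∀³ λ a b q → a * b Sign.≟ (a * q) * (q * b))
    sign : walkSign σ P ≡ walkSign σ (P₁ · reverse Q) * walkSign σ (Q · P₂)
    sign = trans (cong (walkSign σ) eq) (trans (walkSign-· σ P₁ P₂) (trans (cancel (walkSign σ P₁) (walkSign σ P₂) (walkSign σ Q))
      (sym (cong₂ _*_ (trans (walkSign-· σ P₁ _) (cong (walkSign σ P₁ *_) (walkSign-reverse σ Q)))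
                           (walkSign-· σ Q P₂)))))

  -- Components of the complement of `C` that share a vertex have the same vertices, but as bridges
  -- they may still differ in their proofs; therefore attachments are compared and not bridges.
  same-or-disjoint : ∀ D D′ → (∀ v → Att D v ⇔ Att D′ v) ⊎ (∀ v → Interior D v → ¬ Interior D′ v)
  same-or-disjoint (chord _ _)     D′          = inj₂ λ _ ()
  same-or-disjoint (component _ _) (chord _ _) = inj₂ λ _ _ ()
  same-or-disjoint (component D isD) (component D′ isD′) with any? (λ v → (v ∈? D) ×-dec (v ∈? D′))
  ... | no none = inj₂ λ v i k → none (v , i , k)
  ... | yes (v , i , k) = inj₁ λ _ → mk⇔ (transport isD isD′ (sub isD isD′ i k)) (transport isD′ isD (sub isD′ isD k i))
    where
    module I = IsOuterComponent
    sub : ∀ {D D′} (isD : IsOuterComponent C D) (isD′ : IsOuterComponent C D′) → v ∈ D → v ∈ D′ → D ⊆ D′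
    sub isD isD′ i k l = let p , p⊆ = I.connected isD v _ i l in
      follow p (I.avoids isD _ ∘ All.lookup p⊆) k
      where
      follow : ∀ {u w} (p : Walk u w) → (∀ {t} → t ∈ᵥ p → ¬ Touches C t) → u ∈ _ → w ∈ _
      follow []           _   u∈ = u∈
      follow (step f j p) out u∈ = follow p (out ∘ there) (I.maximal isD′ f _ _ j u∈ (out (there (start∈ p))))
    transport : ∀ {D D′} (isD : IsOuterComponent C D) (isD′ : IsOuterComponent C D′) → D ⊆ D′ →
                Att (component D isD) u → Att (component D′ isD′) u
    transport _ _ D⊆ (t , f , (u , w , j , u∈ , w∈) , inc) =
      t , f , (u , w , j , D⊆ u∈ , [ inj₁ ∘ D⊆ , inj₂ ]′ w∈) , inc

  module _ (connected : ∀ u v → Walk u v) (noCutpoint : ∀ v → ¬ IsCutpoint v) where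

    -- For a component, connectivity gives one attachment. The second comes from `return`: without
    -- it the first would be a cutpoint.
    two-attachments : ∀ D → ∃₂ λ x y → x ≢ y × Att D x × Att D y
    two-attachments (chord f (_ , u , w , u≢w , j , tu , tw)) =
      u , w , u≢w , (tu , f , refl , Joins⇒Incidentˡ j) , (tw , f , refl , Joins⇒Incidentʳ j)
    two-attachments D′@(component D isD) = result (I.nonempty)
      where
      module I = IsOuterComponent isD
      boundary : Walk u w → u ∈ D → On w →
                 Σ[ f ∈ Fin m ] Σ[ s ∈ Fin n ] Σ[ t ∈ Fin n ] Joins f s t × s ∈ D × On t
      boundary []           u∈ w∈ = contradiction w∈ (inD⇒¬On isD u∈)
      boundary (step {v = v} f j p) u∈ w∈ with on? v
      ... | yes v∈ = f , _ , v , j , u∈ , v∈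
      ... | no v∉ = boundary p (I.maximal f _ _ j u∈ (v∉ ∘ Touches⇒On)) w∈
      result : ∃[ d ] d ∈ D → ∃₂ λ x y → x ≢ y × Att D′ x × Att D′ y
      result (d , d∈) with boundary (connected d a) d∈ (start∈ p₀)
      ... | f , u , x , j , u∈ , x∈ with ∈ᵥ⇒Incident p₀ a≢z x∈
      ... | g , g∈ , ginc with Incident⇒Joins g ginc
      ... | x′ , gⱼ with return noCutpoint on? (Joins-sym j) gⱼ x∈ (edge-On g∈ (Joins-sym gⱼ)) (inD⇒¬On isD u∈)
      ... | y , y∈ , y≢x , q , s , only with ∈ᵥ⇒Incident q (λ eq → inD⇒¬On isD (subst (_∈ D) eq u∈) y∈) (end∈ q)
      ... | h , h∈ , hinc = x , y , ≢-sym y≢x ,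
            (On⇒Touches x∈ , f , (u , x , j , u∈ , inj₂ (On⇒Touches x∈)) , Joins⇒Incidentʳ j) ,
            (On⇒Touches y∈ , h , escape-within isD q s u∈ y∈ only h∈ , hinc)

  -- Spans of bridges, and how a battery constrains them.

  record Span (D : Bridge C) (x y : Fin n) : Set where
    field
      attˡ : Att D x
      attʳ : Att D y
      x<y  : rk x < rk y
      only : Att D v → v ≡ x ⊎ v ≡ y

    onˡ : On x
    onˡ = Att⇒On D attˡ
    onʳ : On y
    onʳ = Att⇒On D attʳ
    x≢y : x ≢ y
    x≢y refl = ℕ.<-irrefl refl x<y

  Nested : (x y x′ y′ : Fin n) → Set
  Nested x y x′ y′ = (rk x ≤ rk x′ × rk y′ ≤ rk y) ⊎ (rk x′ ≤ rk x × rk y ≤ rk y′)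

  -- A strict shift of both ends in the same direction covers crossing spans, disjoint spans and
  -- spans that merely touch. Every other position of two intervals is an inclusion.
  unstaggered⇒nested : ¬ (rk x < rk x′ × rk y < rk y′) → ¬ (rk x′ < rk x × rk y′ < rk y) → Nested x y x′ y′
  unstaggered⇒nested {x} {x′} {y} {y′} ¬s ¬s′ with ℕ.<-cmp (rk x) (rk x′) | ℕ.<-cmp (rk y) (rk y′)
  ... | tri< l _ _ | tri< r _ _ = contradiction (l , r) ¬s
  ... | tri> _ _ l | tri> _ _ r = contradiction (l , r) ¬s′
  ... | tri< l _ _ | tri> _ _ r = inj₁ (ℕ.<⇒≤ l , ℕ.<⇒≤ r)
  ... | tri< l _ _ | tri≈ _ r _ = inj₁ (ℕ.<⇒≤ l , ℕ.≤-reflexive (sym r))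
  ... | tri≈ _ l _ | tri> _ _ r = inj₁ (ℕ.≤-reflexive l , ℕ.<⇒≤ r)
  ... | tri≈ _ l _ | tri≈ _ r _ = inj₁ (ℕ.≤-reflexive l , ℕ.≤-reflexive (sym r))
  ... | tri≈ _ l _ | tri< r _ _ = inj₂ (ℕ.≤-reflexive (sym l) , ℕ.<⇒≤ r)
  ... | tri> _ _ l | tri≈ _ r _ = inj₂ (ℕ.<⇒≤ l , ℕ.≤-reflexive r)
  ... | tri> _ _ l | tri< r _ _ = inj₂ (ℕ.<⇒≤ l , ℕ.<⇒≤ r)

  Span-same : Span D x y → Span D′ x′ y′ → (∀ v → Att D v ⇔ Att D′ v) → x ≡ x′ × y ≡ y′
  Span-same S S′ same
    with Span.only S′ (Equivalence.to (same _) (Span.attˡ S)) | Span.only S′ (Equivalence.to (same _) (Span.attʳ S))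
  ... | inj₁ refl | inj₂ refl = refl , refl
  ... | inj₁ refl | inj₁ refl = contradiction refl (Span.x≢y S)
  ... | inj₂ refl | inj₂ refl = contradiction refl (Span.x≢y S)
  ... | inj₂ refl | inj₁ refl = contradiction (Span.x<y S) (ℕ.<-asym (Span.x<y S′))

  attached⇒span : Att D u → Att D w → u ≢ w → (∀ {v} → Att D v → v ≡ u ⊎ v ≡ w) →
                  Span D u w ⊎ Span D w u
  attached⇒span {D} {u} {w} au aw u≢w only with ℕ.<-cmp (rk u) (rk w)
  ... | tri< l _ _ = inj₁ record { attˡ = au ; attʳ = aw ; x<y = l ; only = only }
  ... | tri> _ _ l = inj₂ record { attˡ = aw ; attʳ = au ; x<y = l ; only = swap ∘ only }
  ... | tri≈ _ q _ = contradiction (rk-injective (Att⇒On D au) (Att⇒On D aw) q) u≢w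

  Ear-outside : (E : Ear D x y) → x ≢ y → ∃[ f ] f ∈ₑ Ear.path E × f ∉ C
  Ear-outside {D = D} E x≢y = let f , f∈ , _ = ∈ᵥ⇒Incident (Ear.path E) x≢y (start∈ (Ear.path E)) in
                              f , f∈ , ∈ᴮ⇒∉C D (Ear.within E f∈)

  e∉Ear : (E : Ear D x y) → ¬ e ∈ₑ Ear.path E
  e∉Ear {D = D} E i = ∈ᴮ⇒∉C D (Ear.within E i) e∈C

  module Unique-path (connected : ∀ u v → Walk u v) (noCutpoint : ∀ v → ¬ IsCutpoint v) (σ : Fin m → Sign)
    (negates : (q : Walk a z) → Simple q → ¬ e ∈ₑ q → (∃[ f ] f ∈ₑ q × f ∉ C) →
               walkSign σ q ≡ opposite (walkSign σ p₀)) where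
    open Signs σ

    -- The ear replaces the segment of `p₀` from `x` to `y`; the two pieces that are kept cancel
    -- against `p₀`, and the change of sign is left to the ear.
    ear-sign : (E : Ear D x y) → On x → On y → rk x < rk y → walkSign σ (Ear.path E) ≡ opposite (ψ x * ψ y)
    ear-sign {D} {x} {y} E x∈ y∈ x<y = cancel (ψ x) (ψ y) (ψ z) (walkSign σ P) (trans (sym sign-q) (trans
        (negates q simple-q e∉q (let f , f∈ , f∉ = Ear-outside E x≢y in f , ∈ₑ-·ʳ A.walk (∈ₑ-·ˡ P f∈) , f∉))
        (cong opposite (sym ψ-z))))
      where
      open Ear E renaming (path to P)
      module A = Segment (segment (start∈ p₀) x∈ rk-a≤)
      module Z = Segment (segment y∈ (end∈ p₀) (rk≤rk-z y∈))
      x≢y : x ≢ y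
      x≢y refl = ℕ.<-irrefl refl x<y
      q : Walk a z
      q = A.walk · (P · Z.walk)
      simple-q : Simple q
      simple-q = Simple-·⁺ A.walk _ A.simple
        (Simple-·⁺ P _ simple Z.simple (λ i k → case onC i (Z.on k) of λ
          { (inj₁ refl) → contradiction (Z.above k) (ℕ.<⇒≱ x<y) ; (inj₂ e) → e }))
        λ i k → case ∈ᵥ-·⁻ P k of λ
          { (inj₁ l) → case onC l (A.on i) of λ
              { (inj₁ e) → e ; (inj₂ refl) → contradiction (A.below i) (ℕ.<⇒≱ x<y) }
          ; (inj₂ l) → contradiction (ℕ.≤-trans (Z.above l) (A.below i)) (ℕ.<⇒≱ x<y) }
      e∉q : ¬ e ∈ₑ q
      e∉q i with ∈ₑ-·⁻ A.walk i
      ... | inj₁ k = e∉p₀ (A.edges⊆ k)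
      ... | inj₂ k with ∈ₑ-·⁻ P k
      ...   | inj₁ l = e∉Ear E l
      ...   | inj₂ l = e∉p₀ (Z.edges⊆ l)
      sign-q : walkSign σ q ≡ ψ x * (walkSign σ P * (ψ y * ψ z))
      sign-q = trans (walkSign-· σ A.walk _) (cong₂ _*_
        (trans (walkSign-along A.walk A.edges⊆) (cong (_* ψ x) ψ-a))
        (trans (walkSign-· σ P _) (cong (walkSign σ P *_) (walkSign-along Z.walk Z.edges⊆))))
      cancel : ∀ x y z p → x * (p * (y * z)) ≡ opposite z → p ≡ opposite (x * y)
      cancel = from-yes (∀⁴ λ x y z p → (x * (p * (y * z)) Sign.≟ opposite z) →-dec (p Sign.≟ opposite (x * y)))

    -- The path from a along p₀ to x, through both ears and from y′ on along p₀ would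
    -- have the sign of p₀.
    two-ears : (E : Ear D x y) (E′ : Ear D′ x′ y′) → (∀ v → Interior D v → ¬ Interior D′ v) →
               On x → On y → On x′ → On y′ → rk x < rk y → rk x′ < rk y′ → rk x < rk y′ →
               (N : Walk y x′) → Simple N → (∀ {f} → f ∈ₑ N → f ∈ₑ p₀) →
               (∀ {v} → v ∈ᵥ N → On v × rk x < rk v × rk v < rk y′) → Empty
    two-ears {D} {x} {y} {D′} {x′} {y′} E E′ disjoint x∈ y∈ x′∈ y′∈ x<y x′<y′ x<y′ N sN N⊆ N-mid =
      conflict (ψ x) (ψ y) (ψ x′) (ψ y′) (ψ z) (trans (sym sign-q) (trans
        (negates q simple-q e∉q (let f , f∈ , f∉ = Ear-outside E x≢y in f , ∈ₑ-·ʳ A.walk (∈ₑ-·ˡ P f∈) , f∉))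
        (cong opposite (sym ψ-z))))
      where
      open Ear E renaming (path to P)
      open Ear E′ using () renaming (path to P′; simple to simple′; onC to onC′; within to within′)
      module A = Segment (segment (start∈ p₀) x∈ rk-a≤)
      module Z = Segment (segment y′∈ (end∈ p₀) (rk≤rk-z y′∈))
      x≢y : x ≢ y
      x≢y refl = ℕ.<-irrefl refl x<y
      x′≢y′ : x′ ≢ y′
      x′≢y′ refl = ℕ.<-irrefl refl x′<y′
      q : Walk a z
      q = A.walk · (P · (N · (P′ · Z.walk)))
      x<x′ : rk x < rk x′
      x<x′ = proj₁ (proj₂ (N-mid (end∈ N)))
      y<y′ : rk y < rk y′
      y<y′ = proj₂ (proj₂ (N-mid (start∈ N)))
      A-N : v ∈ᵥ A.walk → ¬ v ∈ᵥ N
      A-N i k = ℕ.<⇒≱ (proj₁ (proj₂ (N-mid k))) (A.below i)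
      N-Z : v ∈ᵥ N → ¬ v ∈ᵥ Z.walk
      N-Z i k = ℕ.<⇒≱ (proj₂ (proj₂ (N-mid i))) (Z.above k)
      A-Z : v ∈ᵥ A.walk → ¬ v ∈ᵥ Z.walk
      A-Z i k = ℕ.<⇒≱ x<y′ (ℕ.≤-trans (Z.above k) (A.below i))
      P-Z : v ∈ᵥ P → ¬ v ∈ᵥ Z.walk
      P-Z i k with onC i (Z.on k)
      ... | inj₁ refl = A-Z (end∈ A.walk) k
      ... | inj₂ refl = N-Z (start∈ N) k
      A-P′ : v ∈ᵥ A.walk → ¬ v ∈ᵥ P′
      A-P′ i k with onC′ k (A.on i)
      ... | inj₁ refl = A-N i (end∈ N)
      ... | inj₂ refl = A-Z i (start∈ Z.walk)
      P-P′ : v ∈ᵥ P → v ∈ᵥ P′ → v ≡ y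
      P-P′ {v} i k with on? v
      ... | no v∉ = contradiction (Ear-interior x′≢y′ E′ k v∉) (disjoint v (Ear-interior x≢y E i v∉))
      ... | yes v∈ with onC i v∈
      ...   | inj₂ e = e
      ...   | inj₁ refl = contradiction k (A-P′ (end∈ A.walk))
      simple-q : Simple q
      simple-q =
        Simple-·⁺ A.walk _ A.simple
          (Simple-·⁺ P _ simple
            (Simple-·⁺ N _ sN
              (Simple-·⁺ P′ _ simple′ Z.simple λ i k → case onC′ i (Z.on k) of λ
                { (inj₁ refl) → contradiction k (N-Z (end∈ N)) ; (inj₂ e) → e })
              λ i k → case ∈ᵥ-·⁻ P′ k of λ
                { (inj₁ l) → case onC′ l (proj₁ (N-mid i)) of λ
                    { (inj₁ e) → e ; (inj₂ refl) → contradiction (start∈ Z.walk) (N-Z i) }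
                ; (inj₂ l) → contradiction l (N-Z i) })
            λ i k → case ∈ᵥ-·⁻ N k of λ
              { (inj₁ l) → case onC i (proj₁ (N-mid l)) of λ
                  { (inj₁ refl) → contradiction l (A-N (end∈ A.walk)) ; (inj₂ e) → e }
              ; (inj₂ l) → case ∈ᵥ-·⁻ P′ l of λ
                  { (inj₁ r) → P-P′ i r ; (inj₂ r) → contradiction r (P-Z i) } })
          λ i k → case ∈ᵥ-·⁻ P k of λ
            { (inj₁ l) → case onC l (A.on i) of λ
                { (inj₁ e) → e ; (inj₂ refl) → contradiction (start∈ N) (A-N i) }
            ; (inj₂ l) → case ∈ᵥ-·⁻ N l of λ
                { (inj₁ r) → contradiction r (A-N i)
                ; (inj₂ r) → case ∈ᵥ-·⁻ P′ r of λ
                    { (inj₁ s) → contradiction s (A-P′ i) ; (inj₂ s) → contradiction s (A-Z i) } } }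
      e∉q : ¬ e ∈ₑ q
      e∉q i with ∈ₑ-·⁻ A.walk i
      ... | inj₁ k = e∉p₀ (A.edges⊆ k)
      ... | inj₂ k with ∈ₑ-·⁻ P k
      ... | inj₁ l = e∉Ear E l
      ... | inj₂ l with ∈ₑ-·⁻ N l
      ... | inj₁ r = e∉p₀ (N⊆ r)
      ... | inj₂ r with ∈ₑ-·⁻ P′ r
      ... | inj₁ s = e∉Ear E′ s
      ... | inj₂ s = e∉p₀ (Z.edges⊆ s)
      sign-q : walkSign σ q ≡ ψ x * (opposite (ψ x * ψ y) * ((ψ y * ψ x′) *
                 (opposite (ψ x′ * ψ y′) * (ψ y′ * ψ z))))
      sign-q = trans (walkSign-· σ A.walk _) (cong₂ _*_
        (trans (walkSign-along A.walk A.edges⊆) (cong (_* ψ x) ψ-a))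
        (trans (walkSign-· σ P _) (cong₂ _*_ (ear-sign E x∈ y∈ x<y)
        (trans (walkSign-· σ N _) (cong₂ _*_ (walkSign-along N N⊆)
        (trans (walkSign-· σ P′ _) (cong₂ _*_ (ear-sign E′ x′∈ y′∈ x′<y′) (walkSign-along Z.walk Z.edges⊆))))))))
      conflict : ∀ x y x′ y′ z → x * (opposite (x * y) * ((y * x′) *
                 (opposite (x′ * y′) * (y′ * z)))) ≢ opposite z
      conflict = from-yes (∀⁵ λ x y x′ y′ z → ¬? (x * (opposite (x * y) * ((y * x′) *
                 (opposite (x′ * y′) * (y′ * z)))) Sign.≟ opposite z))

    -- The ears are joined by the piece of `p₀` between `y` and `x′`, run forwards if the spans do
    -- not overlap and backwards if they cross. Staggering keeps this piece strictly between `x` and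
    -- `y′`, away from the outer pieces of `p₀`.
    staggered : Span D x y → Span D′ x′ y′ → (∀ v → Interior D v → ¬ Interior D′ v) →
                ¬ (rk x < rk x′ × rk y < rk y′)
    staggered {D} {x} {y} {D′} {x′} {y′} S S′ disjoint (x<x′ , y<y′) with ℕ.≤-total (rk y) (rk x′)
    ... | inj₁ y≤x′ = two-ears (ear D S.attˡ S.attʳ S.x≢y) (ear D′ S′.attˡ S′.attʳ S′.x≢y) disjoint
          S.onˡ S.onʳ S′.onˡ S′.onʳ S.x<y S′.x<y (ℕ.<-trans S.x<y y<y′) N.walk N.simple N.edges⊆
          λ i → N.on i , ℕ.<-≤-trans S.x<y (N.above i) , ℕ.≤-<-trans (N.below i) S′.x<y
      where
      module S = Span S
      module S′ = Span S′
      module N = Segment (segment S.onʳ S′.onˡ y≤x′)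
    ... | inj₂ x′≤y = two-ears (ear D S.attˡ S.attʳ S.x≢y) (ear D′ S′.attˡ S′.attʳ S′.x≢y) disjoint
          S.onˡ S.onʳ S′.onˡ S′.onʳ S.x<y S′.x<y (ℕ.<-trans S.x<y y<y′) (reverse N.walk) (Simple-reverse N.walk N.simple)
          (N.edges⊆ ∘ ∈ₑ-reverse⁻ N.walk)
          λ i → let k = ∈ᵥ-reverse⁻ N.walk i in N.on k , ℕ.<-≤-trans x<x′ (N.above k) , ℕ.≤-<-trans (N.below k) y<y′
      where
      module S = Span S
      module S′ = Span S′
      module N = Segment (segment S′.onˡ S.onʳ x′≤y)

    nested : Span D x y → Span D′ x′ y′ → Nested x y x′ y′
    nested {D} {x} {y} {D′} {x′} {y′} S S′ with same-or-disjoint D D′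
    ... | inj₁ same with Span-same S S′ same
    ...   | refl , refl = inj₁ (ℕ.≤-refl , ℕ.≤-refl)
    nested S S′ | inj₂ disjoint = unstaggered⇒nested (staggered S S′ disjoint) (staggered S′ S λ v i k → disjoint v k i)

    -- In the tripod the signs of two ears multiply to that of the third. Each ear is opposite to
    -- its interval, so two changes of sign would have to equal one.
    no-third : Att D x → Att D y → Att D w → rk x < rk y → rk y < rk w → Empty
    no-third {D} {x} {y} {w} ax ay aw x<y y<w with tripod σ D ax ay aw
        (λ { refl → ℕ.<-irrefl refl x<y }) (λ { refl → ℕ.<-asym x<y y<w }) (λ { refl → ℕ.<-irrefl refl y<w })
    ... | E , E₁ , E₂ , sign = conflict (ψ x) (ψ y) (ψ w) (trans (sym (ear-sign E x∈ w∈ (ℕ.<-trans x<y y<w)))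
            (trans sign (cong₂ _*_ (ear-sign E₁ x∈ y∈ x<y) (ear-sign E₂ y∈ w∈ y<w))))
      where
      x∈ = Att⇒On D ax
      y∈ = Att⇒On D ay
      w∈ = Att⇒On D aw
      conflict : ∀ x y w → opposite (x * w) ≢ opposite (x * y) * opposite (y * w)
      conflict = from-yes (∀³ λ x y w → ¬? (opposite (x * w) Sign.≟ opposite (x * y) * opposite (y * w)))

    spans : ∀ D → ∃₂ λ x y → Span D x y
    spans D with two-attachments connected noCutpoint D
    ... | u , w , u≢w , au , aw = [ (λ S → u , w , S) , (λ S → w , u , S) ]′ (attached⇒span au aw u≢w only)
      where
      sorted : ∀ {u w v} → Att D u → Att D w → Att D v → rk u < rk w → v ≡ u ⊎ v ≡ w
      sorted {u} {w} {v} au aw av u<w with ℕ.<-cmp (rk v) (rk u) | ℕ.<-cmp (rk v) (rk w)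
      ... | tri≈ _ q _ | _ = inj₁ (rk-injective (Att⇒On D av) (Att⇒On D au) q)
      ... | _ | tri≈ _ q _ = inj₂ (rk-injective (Att⇒On D av) (Att⇒On D aw) q)
      ... | tri< l _ _ | _ = ⊥-elim (no-third av au aw l u<w)
      ... | tri> _ _ l | tri< l′ _ _ = ⊥-elim (no-third au av aw l l′)
      ... | tri> _ _ _ | tri> _ _ l = ⊥-elim (no-third au aw av u<w l)
      only : ∀ {v} → Att D v → v ≡ u ⊎ v ≡ w
      only av with ℕ.<-cmp (rk u) (rk w)
      ... | tri< l _ _ = sorted au aw av l
      ... | tri> _ _ l = swap (sorted aw au av l)
      ... | tri≈ _ q _ = contradiction (rk-injective (Att⇒On D au) (Att⇒On D aw) q) u≢w

  -- Paths between the ends of `e` when the spans are nested.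

  outerComponent : ¬ On v → Σ[ D ∈ Subset n ] IsOuterComponent C D × v ∈ D
  outerComponent {v} v∉ = carrier , record
    { nonempty = v , root
    ; avoids = λ w w∈ t → within w∈ (Touches⇒On t)
    ; connected = λ s t s∈ t∈ → let p , p⊆ = reachable s∈ ; q , q⊆ = reachable t∈ in
        reverse p · q , All.tabulate λ i → case ∈ᵥ-·⁻ (reverse p) i of λ
          { (inj₁ k) → p⊆ (∈ᵥ-reverse⁻ p k) ; (inj₂ k) → q⊆ k }
    ; maximal = λ f s t j s∈ ¬t → closed j s∈ (¬t ∘ On⇒Touches)
    } , root
    where open Component (componentOf (¬? ∘ on?) v v∉)

  bridgeAt : On x → Incident f x → f ∉ C → ∃[ D ] f ∈ᴮ D × Att D x
  bridgeAt {x} {f} x∈ inc f∉ with Incident⇒Joins f inc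
  ... | y , j with on? y
  ... | yes y∈ = chord f (f∉ , x , y , (λ { refl → loopless j }) , j , On⇒Touches x∈ , On⇒Touches y∈) ,
                 refl , On⇒Touches x∈ , f , refl , inc
  ... | no y∉ with outerComponent y∉
  ... | D , isD , y∈D = component D isD , f∈ , On⇒Touches x∈ , f , f∈ , inc
    where f∈ = y , x , Joins-sym j , y∈D , inj₂ (On⇒Touches x∈)

  -- A path cut at its visits to `C`, into single edges of `p₀` and passages through one bridge
  -- each.
  data Trek : Walk x y → Set where
    done  : Trek {x} []
    along : f ∈ₑ p₀ → (j : Joins f x y) {q : Walk y w} → Trek q → Trek (step f j q)
    over  : ∀ D (P : Walk x y) {q : Walk y w} → (∀ {f} → f ∈ₑ P → f ∈ᴮ D) → x ≢ y → On x → On y →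
            Trek q → Trek (P · q)

  trek : (q : Walk x w) → Simple q → On x → On w → ¬ e ∈ₑ q → Trek q
  trek q s x∈ w∈ e∉ = go (len q) q ℕ.≤-refl s x∈ w∈ e∉
    where
    -- The bound `k` on the length makes the recursion terminate: the remainder after a passage
    -- comes from `firstHit` and is not structurally smaller.
    go : ∀ k (q : Walk x w) → len q ≤ k → Simple q → On x → On w → ¬ e ∈ₑ q → Trek q
    go k [] _ _ _ _ _ = done
    go (suc k) (step {v = y} f j q) (s≤s l) (a ∷ s) x∈ w∈ e∉ with f ∈? C
    ... | yes f∈C with ∈C⁻ f∈C
    ...   | inj₁ refl = contradiction (here refl) e∉
    ...   | inj₂ f∈ = along f∈ j (go k q l s (edge-On f∈ (Joins-sym j)) w∈ (e∉ ∘ there))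
    go {x} (suc k) (step {v = y} f j q) (s≤s l) (a ∷ s) x∈ w∈ e∉ | no f∉ with on? y
    ...   | yes y∈ = over (chord f (f∉ , x , y , x≢y , j , On⇒Touches x∈ , On⇒Touches y∈)) (step f j [])
                       (λ { (here eq) → eq }) x≢y x∈ y∈ (go k q l s y∈ w∈ (e∉ ∘ there))
      where x≢y = All.lookup a (start∈ q)
    ...   | no y∉ with outerComponent y∉ | firstHit on? q w∈ (end∈ q)
    ...     | D , isD , y∈D | c , Q , r , refl , c∈ , first =
      over (component D isD) (step f j Q)
        (λ { (here refl) → y , x , Joins-sym j , y∈D , inj₂ (On⇒Touches x∈)
           ; (there i) → escape-within isD Q (Simple-·ˡ Q s) y∈D c∈ first i })
        (All.lookup a (∈ᵥ-·ʳ Q (start∈ r))) x∈ c∈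
        (go k r (ℕ.≤-trans (subst (len r ≤_) (sym (len-· Q r)) (ℕ.m≤n+m _ _)) l) (Simple-·ʳ Q s) c∈ w∈
          (e∉ ∘ there ∘ ∈ₑ-·ʳ Q))

  record Detour (q : Walk x z) : Set where
    field
      {bridge}    : Bridge C
      {from} {to} : Fin n
      span        : Span bridge from to
      before      : Walk x from
      path        : Walk from to
      after       : Walk to z
      split       : q ≡ before · (path · after)
      before⊆     : f ∈ₑ before → f ∈ₑ p₀
      path⊆       : f ∈ₑ path → f ∈ᴮ bridge
      after⊆      : f ∈ₑ after → f ∈ₑ p₀

  -- If the spans of the bridges are nested, a path from a to z that leaves p₀
  -- over a bridge is confined: stepping back below the far end of the bridge, it
  -- could leave the span only through the ends of the span, which it has used.
  module _ (spans : ∀ D → ∃₂ λ x y → Span D x y)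
           (nested : ∀ {D D′ x y x′ y′} → Span D x y → Span D′ x′ y′ → Nested x y x′ y′) where

    private
      over-attached : ∀ D (P : Walk x y) → (∀ {f} → f ∈ₑ P → f ∈ᴮ D) → x ≢ y → On x → On y → Att D x × Att D y
      over-attached D P P⊆ x≢y x∈ y∈ =
        let f , f∈ , i = ∈ᵥ⇒Incident P x≢y (start∈ P)
            g , g∈ , k = ∈ᵥ⇒Incident P x≢y (end∈ P)
        in ∈ᴮ⇒Att D (P⊆ f∈) i x∈ , ∈ᴮ⇒Att D (P⊆ g∈) k y∈

      over-span : ∀ D (P : Walk x y) → (∀ {f} → f ∈ₑ P → f ∈ᴮ D) → x ≢ y → On x → On y → Span D x y ⊎ Span D y x
      over-span D P P⊆ x≢y x∈ y∈ with over-attached D P P⊆ x≢y x∈ y∈ | spans D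
      ... | ax , ay | x₀ , y₀ , S with Span.only S ax | Span.only S ay
      ...   | inj₁ refl | inj₂ refl = inj₁ S
      ...   | inj₂ refl | inj₁ refl = inj₂ S
      ...   | inj₁ refl | inj₁ refl = contradiction refl x≢y
      ...   | inj₂ refl | inj₂ refl = contradiction refl x≢y

      On≢⇒< : On u → On v → rk u ≤ rk v → u ≢ v → rk u < rk v
      On≢⇒< u∈ v∈ l u≢v = ℕ.≤∧≢⇒< l (u≢v ∘ rk-injective u∈ v∈)

      -- The walk stays strictly between `x` and `y`: an edge of `p₀` cannot jump over `y`, and by
      -- nestedness a bridge attached strictly inside the span does not reach past `y`. But it has
      -- to arrive at `z`, whose rank is at least that of `y`.
      trapped : Span D x y → {q : Walk t z} → Trek q → Simple q → On t → rk x < rk t → rk t < rk y →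
                (∀ {v} → v ∈ᵥ q → On v → rk x < rk v) → ¬ y ∈ᵥ q → Empty
      trapped S done s t∈ x<t t<y high y∉ = ℕ.<⇒≱ t<y (rk≤rk-z (Span.onʳ S))
      trapped {x = x} {y} {t} S (along {y = v} f∈ j {q} tq) (a ∷ s) t∈ x<t t<y high y∉ =
        trapped S tq s v∈ (high (there (start∈ q)) v∈) (On≢⇒< v∈ (Span.onʳ S) (v≤y (rk-edge f∈ j))
          λ { refl → y∉ (there (start∈ q)) }) (high ∘ there) (y∉ ∘ there)
        where
        v∈ : On v
        v∈ = edge-On f∈ (Joins-sym j)
        v≤y : rk v ≡ suc (rk t) ⊎ rk t ≡ suc (rk v) → rk v ≤ rk y
        v≤y (inj₁ eq) = subst (_≤ rk y) (sym eq) t<y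
        v≤y (inj₂ eq) = ℕ.≤-trans (ℕ.n≤1+n _) (subst (_≤ rk y) eq (ℕ.<⇒≤ t<y))
      trapped {x = x} {y} {t} S (over {y = v} D P {q} P⊆ t≢v t∈ v∈ tq) s _ x<t t<y high y∉ =
        trapped S tq (Simple-·ʳ P s) v∈ (high (∈ᵥ-·ʳ P (start∈ q)) v∈)
          (On≢⇒< v∈ (Span.onʳ S) (v≤y (over-span D P P⊆ t≢v t∈ v∈)) λ { refl → y∉ (∈ᵥ-·ʳ P (start∈ q)) })
          (high ∘ ∈ᵥ-·ʳ P) (y∉ ∘ ∈ᵥ-·ʳ P)
        where
        v≤y : Span D t v ⊎ Span D v t → rk v ≤ rk y
        v≤y (inj₂ S′) = ℕ.≤-trans (ℕ.<⇒≤ (Span.x<y S′)) (ℕ.<⇒≤ t<y)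
        v≤y (inj₁ S′) with nested S S′
        ... | inj₁ (_ , l) = l
        ... | inj₂ (l , _) = contradiction l (ℕ.<⇒≱ x<t)

      -- At or above `y`, a further passage would use a bridge whose span lies entirely above that
      -- of `D`, against nestedness, and a step below `y` leads to `trapped`. The vertex `y` is
      -- still allowed as the start, since the walk enters this phase there.
      beyond : Span D x y → {q : Walk t z} → Trek q → Simple q → On t → rk y ≤ rk t →
               (∀ {v} → v ∈ᵥ q → On v → rk x < rk v) → (y ∈ᵥ q → t ≡ y) → f ∈ₑ q → f ∈ₑ p₀
      beyond S done s t∈ y≤t high y-start ()
      beyond S (along f∈ j tq) (a ∷ s) t∈ y≤t high y-start (here refl) = f∈
      beyond {x = x} {y} {t} S (along {y = v} f∈ j {q} tq) (a ∷ s) t∈ y≤t high y-start (there i) with rk y ℕ.≤? rk v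
      ... | yes y≤v = beyond S tq s (edge-On f∈ (Joins-sym j)) y≤v (high ∘ there)
              (λ k → contradiction (y-start (there k)) (All.lookup a k)) i
      ... | no ¬y≤v = ⊥-elim (trapped S tq s v∈ (high (there (start∈ q)) v∈) (ℕ.≰⇒> ¬y≤v) (high ∘ there)
              λ k → contradiction (y-start (there k)) (All.lookup a k))
        where
        v∈ : On v
        v∈ = edge-On f∈ (Joins-sym j)
      beyond {x = x} {y} {t} S (over {y = v} D P {q} P⊆ t≢v t∈ v∈ tq) s _ y≤t high y-start i with rk y ℕ.≤? rk v
      ... | no ¬y≤v = ⊥-elim (trapped S tq (Simple-·ʳ P s) v∈ (high (∈ᵥ-·ʳ P (start∈ q)) v∈) (ℕ.≰⇒> ¬y≤v)
              (high ∘ ∈ᵥ-·ʳ P) λ k → case y-start (∈ᵥ-·ʳ P k) of λ { refl → t≢v (Simple-·-meet P s (start∈ P) k) })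
      ... | yes y≤v with over-span D P P⊆ t≢v t∈ v∈
      ...   | inj₁ S′ with nested S S′
      ...     | inj₁ (_ , l) = contradiction (ℕ.<-≤-trans (Span.x<y S′) (ℕ.≤-trans l y≤t)) (ℕ.<-irrefl refl)
      ...     | inj₂ (l , _) = contradiction (ℕ.<-≤-trans (Span.x<y S) (ℕ.≤-trans y≤t l)) (ℕ.<-irrefl refl)
      beyond {x = x} {y} {t} S (over {y = v} D P {q} P⊆ t≢v t∈ v∈ tq) s _ y≤t high y-start i | yes y≤v | inj₂ S′ with nested S S′
      ...     | inj₁ (_ , l) = contradiction (ℕ.<-≤-trans (Span.x<y S′) (ℕ.≤-trans l y≤v)) (ℕ.<-irrefl refl)
      ...     | inj₂ (l , _) = contradiction (ℕ.<-≤-trans (Span.x<y S) (ℕ.≤-trans y≤v l)) (ℕ.<-irrefl refl)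

      -- The invariant is that no later vertex of `C` lies below the current one. It holds at `a`,
      -- forces every step along `p₀` to go upwards, is thereby preserved, and makes the first
      -- passage start at the lower end of its span.
      trek-shape : {q : Walk x z} → Trek q → Simple q → On x → (∀ {v} → v ∈ᵥ q → On v → rk x ≤ rk v) →
                   (∀ {f} → f ∈ₑ q → f ∈ₑ p₀) ⊎ Detour q
      trek-shape done s x∈ low = inj₁ λ ()
      trek-shape {x} (along {y = v} f∈ j {q} tq) (a ∷ s) x∈ low with trek-shape tq s v∈ low′
        where
        v∈ : On v
        v∈ = edge-On f∈ (Joins-sym j)
        low′ : ∀ {w} → w ∈ᵥ q → On w → rk v ≤ rk w
        low′ i w∈ with rk-edge f∈ j
        ... | inj₁ eq = subst (_≤ _) (sym eq) (On≢⇒< x∈ w∈ (low (there i) w∈) (All.lookup a i))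
        ... | inj₂ eq = contradiction (subst (_≤ rk v) eq (low (there (start∈ q)) v∈)) (ℕ.<⇒≱ (ℕ.n<1+n _))
      ... | inj₁ q⊆ = inj₁ λ { (here refl) → f∈ ; (there i) → q⊆ i }
      ... | inj₂ d = inj₂ record
        { span = span ; before = step _ j before ; path = path ; after = after ; split = cong (step _ j) split
        ; before⊆ = λ { (here refl) → f∈ ; (there i) → before⊆ i } ; path⊆ = path⊆ ; after⊆ = after⊆ }
        where open Detour d
      trek-shape {x} (over {y = v} D P {q} P⊆ x≢v x∈ v∈ tq) s _ low with over-span D P P⊆ x≢v x∈ v∈
      ... | inj₂ S = contradiction (low (∈ᵥ-·ʳ P (start∈ q)) v∈) (ℕ.<⇒≱ (Span.x<y S))
      ... | inj₁ S = inj₂ record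
        { span = S ; before = [] ; path = P ; after = q ; split = refl ; before⊆ = λ () ; path⊆ = P⊆
        ; after⊆ = beyond S tq (Simple-·ʳ P s) v∈ ℕ.≤-refl
            (λ i w∈ → On≢⇒< x∈ w∈ (low (∈ᵥ-·ʳ P i) w∈) λ { refl → x≢v (Simple-·-meet P s (start∈ P) i) })
            (λ _ → refl) }

    shape : (q : Walk a z) → Simple q → ¬ e ∈ₑ q → (∀ {f} → f ∈ₑ q → f ∈ₑ p₀) ⊎ Detour q
    shape q s e∉ = trek-shape (trek q s (start∈ p₀) (end∈ p₀) e∉) s (start∈ p₀) λ _ _ → rk-a≤

-- Any two sides of the branch vertices are joined by at least three of the paths.
module K₄Cut {n : ℕ} {E : Set} {G : Graph (Fin n) E} {F : E → Set} (κ : Graph.IsK₄Subdivision G F) where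
  open Walks G
  open Graph.IsK₄Subdivision κ
  private variable
    i j k l : Fin 4
    u v : Fin n

  OnPath : Fin 4 → Fin 4 → Fin n → Set
  OnPath i j v = (Σ[ i<j ∈ i Fin.< j ] v ∈ᵥ path i j i<j) ⊎ (Σ[ j<i ∈ j Fin.< i ] v ∈ᵥ path j i j<i)

  SamePair : Fin 4 → Fin 4 → Fin 4 → Fin 4 → Set
  SamePair i j k l = (i ≡ k × j ≡ l) ⊎ (i ≡ l × j ≡ k)

  OnPath-meet : ¬ SamePair i j k l → OnPath i j v → OnPath k l v → v ≡ branch i ⊎ v ≡ branch j
  OnPath-meet ¬s (inj₁ (p , a)) (inj₁ (q , b)) = independent _ _ p _ _ q (¬s ∘ inj₁) _ a b
  OnPath-meet ¬s (inj₁ (p , a)) (inj₂ (q , b)) = independent _ _ p _ _ q (¬s ∘ inj₂) _ a b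
  OnPath-meet ¬s (inj₂ (p , a)) (inj₁ (q , b)) = swap (independent _ _ p _ _ q (λ { (x , y) → ¬s (inj₂ (y , x)) }) _ a b)
  OnPath-meet ¬s (inj₂ (p , a)) (inj₂ (q , b)) = swap (independent _ _ p _ _ q (λ { (x , y) → ¬s (inj₁ (y , x)) }) _ a b)

  SamePair-sym : SamePair i j k l → SamePair k l i j
  SamePair-sym (inj₁ (refl , refl)) = inj₁ (refl , refl)
  SamePair-sym (inj₂ (refl , refl)) = inj₂ (refl , refl)

  samePair? : ∀ i j k l → Dec (SamePair i j k l)
  samePair? i j k l = ((i ≟ k) ×-dec (j ≟ l)) ⊎-dec ((i ≟ l) ×-dec (j ≟ k))

  -- A vertex shared by paths of different pairs is an end of both. Two shared vertices would be
  -- both ends of both paths, so that the pairs agree after all.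
  OnPath-two : u ≢ v → OnPath i j u → OnPath i j v → OnPath k l u → OnPath k l v → SamePair i j k l
  OnPath-two {i = i} {j} {k} {l} u≢v a b c d with samePair? i j k l
  ... | yes s = s
  ... | no ¬s with OnPath-meet ¬s a c | OnPath-meet ¬s b d
                 | OnPath-meet (¬s ∘ SamePair-sym) c a | OnPath-meet (¬s ∘ SamePair-sym) d b
  ... | inj₁ p | inj₁ q | _ | _ = contradiction (trans p (sym q)) u≢v
  ... | inj₂ p | inj₂ q | _ | _ = contradiction (trans p (sym q)) u≢v
  ... | _ | _ | inj₁ r | inj₁ s = contradiction (trans r (sym s)) u≢v
  ... | _ | _ | inj₂ r | inj₂ s = contradiction (trans r (sym s)) u≢v
  ... | inj₁ p | inj₂ q | inj₁ r | inj₂ s = inj₁ (branch-inj (trans (sym p) r) , branch-inj (trans (sym q) s))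
  ... | inj₁ p | inj₂ q | inj₂ r | inj₁ s = inj₂ (branch-inj (trans (sym p) r) , branch-inj (trans (sym q) s))
  ... | inj₂ p | inj₁ q | inj₁ r | inj₂ s = inj₂ (branch-inj (trans (sym q) s) , branch-inj (trans (sym p) r))
  ... | inj₂ p | inj₁ q | inj₂ r | inj₁ s = inj₁ (branch-inj (trans (sym q) s) , branch-inj (trans (sym p) r))

  others : ∀ (s t : Fin 4) → s ≢ t → ∃₂ λ p q → p ≢ s × p ≢ t × q ≢ s × q ≢ t × p ≢ q
  others = from-yes (all? {n = 4} λ s → all? λ t → ¬? (s ≟ t) →-dec any? λ p → any? λ q →
    ¬? (p ≟ s) ×-dec ¬? (p ≟ t) ×-dec ¬? (q ≟ s) ×-dec ¬? (q ≟ t) ×-dec ¬? (p ≟ q))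

  module _ {S : Fin n → Set} (S? : Decidable S) where

    Crosses : Fin n → Fin n → Set
    Crosses u v = S u × ¬ S v × ∃[ x ] F x × Joins x u v

    crossing : (p : Walk u v) → All F (edges p) → S u → ¬ S v →
               ∃₂ λ s t → Crosses s t × s ∈ᵥ p × t ∈ᵥ p
    crossing []           _       Su ¬Sv = contradiction Su ¬Sv
    crossing (step {v = t} x j p) (Fx ∷ a) Su ¬Sv with S? t
    ... | no ¬St = _ , t , (Su , ¬St , x , Fx , j) , here refl , there (start∈ p)
    ... | yes St = let s , t , c , s∈ , t∈ = crossing p a St ¬Sv in s , t , c , there s∈ , there t∈

    path-crossing : S (branch i) → ¬ S (branch j) → ∃₂ λ u v → Crosses u v × OnPath i j u × OnPath i j v
    path-crossing {i} {j} Si ¬Sj with <-cmp i j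
    ... | tri≈ _ refl _ = contradiction Si ¬Sj
    ... | tri< i<j _ _ = let u , v , c , a , b = crossing (path i j i<j) (proj₂ (path-isPathIn i j i<j)) Si ¬Sj
                         in u , v , c , inj₁ (i<j , a) , inj₁ (i<j , b)
    ... | tri> _ _ j<i =
      let p = path j i j<i
          u , v , c , a , b = crossing (reverse p)
            (All.tabulate λ x∈ → All.lookup (proj₂ (path-isPathIn j i j<i)) (∈ₑ-reverse⁻ p x∈)) Si ¬Sj
      in u , v , c , inj₂ (j<i , ∈ᵥ-reverse⁻ p a) , inj₂ (j<i , ∈ᵥ-reverse⁻ p b)

    module _ {Q₁ Q₂ : Fin n → Fin n → Set} (classify : ∀ {u v} → Crosses u v → Q₁ u v ⊎ Q₂ u v)
      (functional₁ : ∀ {u v u′ v′} → Q₁ u v → Q₁ u′ v′ → u ≡ u′ × v ≡ v′)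
      (functional₂ : ∀ {u v u′ v′} → Q₂ u v → Q₂ u′ v′ → u ≡ u′ × v ≡ v′) where

      private
        Arm : Fin 4 → Fin 4 → Set
        Arm i j = ∃₂ λ u v → Crosses u v × OnPath i j u × OnPath i j v

        same : (α : Arm i j) (β : Arm k l) → proj₁ α ≡ proj₁ β × proj₁ (proj₂ α) ≡ proj₁ (proj₂ β) → SamePair i j k l
        same (u , v , (Su , ¬Sv , _) , a , b) (u , v , _ , c , d) (refl , refl) =
          OnPath-two (λ { refl → ¬Sv Su }) a b c d

        three : ∀ {i j k l i′ j′} → Arm i j → Arm k l → Arm i′ j′ →
                SamePair i j k l ⊎ SamePair i j i′ j′ ⊎ SamePair k l i′ j′
        three α@(_ , _ , c , _) β@(_ , _ , d , _) γ@(_ , _ , g , _) with classify c | classify d | classify g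
        ... | inj₁ p | inj₁ q | _      = inj₁ (same α β (functional₁ p q))
        ... | inj₂ p | inj₂ q | _      = inj₁ (same α β (functional₂ p q))
        ... | inj₁ p | inj₂ _ | inj₁ q = inj₂ (inj₁ (same α γ (functional₁ p q)))
        ... | inj₂ p | inj₁ _ | inj₂ q = inj₂ (inj₁ (same α γ (functional₂ p q)))
        ... | inj₁ _ | inj₂ p | inj₂ q = inj₂ (inj₂ (same β γ (functional₂ p q)))
        ... | inj₂ _ | inj₁ p | inj₁ q = inj₂ (inj₂ (same β γ (functional₁ p q)))

        -- The branch vertex `p` is on the side of `s` or on that of `t`, and its path to the other
        -- one crosses. The last component records that no fourth branch vertex is involved, which
        -- keeps the arms of different `p` apart.
        arm : ∀ {s t} p → S (branch s) → ¬ S (branch t) →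
              ∃₂ λ i j → Arm i j × (p ≡ i ⊎ p ≡ j) × (∀ {r} → r ≡ i ⊎ r ≡ j → r ≡ p ⊎ r ≡ s ⊎ r ≡ t)
        arm {s} {t} p Ss ¬St with S? (branch p)
        ... | yes Sp = p , t , path-crossing Sp ¬St , inj₁ refl , λ { (inj₁ e) → inj₁ e ; (inj₂ e) → inj₂ (inj₂ e) }
        ... | no ¬Sp = s , p , path-crossing Ss ¬Sp , inj₂ refl , λ { (inj₁ e) → inj₂ (inj₁ e) ; (inj₂ e) → inj₁ e }

        transfer : ∀ {r} → SamePair i j k l → r ≡ k ⊎ r ≡ l → r ≡ i ⊎ r ≡ j
        transfer (inj₁ (refl , refl)) = id
        transfer (inj₂ (refl , refl)) = swap

      -- The path between `s` and `t` and the arms of the two remaining branch vertices belong to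
      -- three different pairs, and each contains a crossing. As only two crossings exist, two of
      -- the paths share one, against `OnPath-two`.
      not-separated : S (branch i) → ¬ ¬ S (branch j)
      not-separated {i = s} {j = t} Ss ¬St with others s t (λ { refl → ¬St Ss })
      ... | p , q , p≢s , p≢t , q≢s , q≢t , p≢q with arm p Ss ¬St | arm q Ss ¬St
      ... | _ , _ , α , p∈ , _ | _ , _ , β , q∈ , only with three (path-crossing Ss ¬St) α β
      ... | inj₁ e        = [ p≢s , p≢t ]′ (transfer e p∈)
      ... | inj₂ (inj₁ e) = [ q≢s , q≢t ]′ (transfer e q∈)
      ... | inj₂ (inj₂ e) = case only (transfer (SamePair-sym e) p∈) of λ
            { (inj₁ r) → p≢q r ; (inj₂ (inj₁ r)) → p≢s r ; (inj₂ (inj₂ r)) → p≢t r }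

  branches∉ : (vs : List (Fin n)) → length vs < 4 → ¬ (∀ i → branch i ∈ₗ vs)
  branches∉ vs few in-vs with pigeonhole few (λ i → index (in-vs i))
  ... | i , j , i<j , eq = ℕ.<-irrefl (cong Fin.toℕ (branch-inj (trans (lookup-index (in-vs i))
          (trans (cong (List.lookup vs) eq) (sym (lookup-index (in-vs j))))))) i<j

  branch-incident : ∀ i → ∃[ x ] F x × Incident x (branch i)
  branch-incident i with other i
    where
    other : ∀ (i : Fin 4) → ∃[ j ] i ≢ j
    other = from-yes (all? {n = 4} λ i → any? λ j → ¬? (i ≟ j))
  ... | j , i≢j with <-cmp i j
  ... | tri≈ _ i≡j _ = contradiction i≡j i≢j
  ... | tri< i<j _ _ = let x , x∈ , inc = ∈ᵥ⇒Incident (path i j i<j) (i≢j ∘ branch-inj) (start∈ _)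
                       in x , All.lookup (proj₂ (path-isPathIn i j i<j)) x∈ , inc
  ... | tri> _ _ j<i = let x , x∈ , inc = ∈ᵥ⇒Incident (path j i j<i) (i≢j ∘ sym ∘ branch-inj) (end∈ _)
                       in x , All.lookup (proj₂ (path-isPathIn j i j<i)) x∈ , inc

-- Crossing chords: interleaved ends give a subdivision of K₄, nested ends do not.

data Pair : Fin 4 → Fin 4 → Set where
  p01 : Pair 0F 1F
  p12 : Pair 1F 2F
  p23 : Pair 2F 3F
  p03 : Pair 0F 3F
  p02 : Pair 0F 2F
  p13 : Pair 1F 3F

pair : ∀ i j → i Fin.< j → Pair i j
pair 0F 1F _ = p01
pair 0F 2F _ = p02
pair 0F 3F _ = p03
pair 1F 2F _ = p12
pair 1F 3F _ = p13
pair 2F 3F _ = p23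
pair 1F 1F (s≤s ())
pair 2F 1F (s≤s ())
pair 2F 2F (s≤s (s≤s ()))
pair 3F 1F (s≤s ())
pair 3F 2F (s≤s (s≤s ()))
pair 3F 3F (s≤s (s≤s (s≤s ())))

unpair : ∀ {i j} → Pair i j → i Fin.< j
unpair p01 = s≤s z≤n
unpair p12 = s≤s (s≤s z≤n)
unpair p23 = s≤s (s≤s (s≤s z≤n))
unpair p03 = s≤s z≤n
unpair p02 = s≤s z≤n
unpair p13 = s≤s (s≤s z≤n)

pair-unique : ∀ {i j} (p q : Pair i j) → p ≡ q
pair-unique p01 p01 = refl
pair-unique p12 p12 = refl
pair-unique p23 p23 = refl
pair-unique p03 p03 = refl
pair-unique p02 p02 = refl
pair-unique p13 p13 = refl

module Crossing {n m : ℕ} {G : Graph (Fin n) (Fin m)} (loopless : Circles.Loopless G)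
                {C : Subset m} {e : Fin m} (route : Route G C e)
                {I : Set} (chordEnds : I → Fin n × Fin n) where
  open Circles G
  open Route route
  open CircleThrough loopless route
  open FiniteGraph.WithChords G C chordEnds using (C⁺; C∪_∪_; Cross)
  module W = Walks C⁺
  private variable
    u v w x y x′ y′ : Fin n
    f : Fin m
    i j k : I

  JoinsChord : I → Fin n → Fin n → Set
  JoinsChord k u v = W.Joins (inj₂ k) u v

  lift : (p : Walk u w) → (∀ {f} → f ∈ₑ p → f ∈ C) → W.Walk u w
  lift []           p⊆ = W.[]
  lift (step f j p) p⊆ = W.step (inj₁ (f , p⊆ (here refl))) j (lift p (p⊆ ∘ there))

  lift-vertices : (p : Walk u w) (p⊆ : ∀ {f} → f ∈ₑ p → f ∈ C) → W.vertices (lift p p⊆) ≡ vertices p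
  lift-vertices []           p⊆ = refl
  lift-vertices (step f j p) p⊆ = cong (_ ∷_) (lift-vertices p (p⊆ ∘ there))

  -- An edge of `C⁺` that comes from `C` carries a proof of membership; `[]=-irrelevant` makes the
  -- choice of this proof immaterial.
  lift-edges : (p : Walk u w) (p⊆ : ∀ {f} → f ∈ₑ p → f ∈ C) → f ∈ₑ p → (f∈ : f ∈ C) → inj₁ (f , f∈) W.∈ₑ lift p p⊆
  lift-edges (step f j p) p⊆ (here refl) f∈ = here (cong (λ i → inj₁ (f , i)) ([]=-irrelevant f∈ (p⊆ (here refl))))
  lift-edges (step f j p) p⊆ (there i)   f∈ = there (lift-edges p (p⊆ ∘ there) i f∈)

  lift-isPathIn : (p : Walk u w) (p⊆ : ∀ {f} → f ∈ₑ p → f ∈ C) → Simple p → W.IsPathIn (C∪ i ∪ j) (lift p p⊆)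
  lift-isPathIn {i = i} {j} p p⊆ s = subst Unique (sym (lift-vertices p p⊆)) s , all p p⊆
    where
    all : ∀ {u w} (p : Walk u w) (p⊆ : ∀ {f} → f ∈ₑ p → f ∈ C) → All (C∪ i ∪ j) (W.edges (lift p p⊆))
    all []           p⊆ = []
    all (step f j p) p⊆ = tt ∷ all p (p⊆ ∘ there)

  module _ (x∈ : On x) (x′∈ : On x′) (y∈ : On y) (y′∈ : On y′)
           (x<x′ : rk x < rk x′) (x′<y : rk x′ < rk y) (y<y′ : rk y < rk y′)
           (chordᵢ : JoinsChord i x y) (chordⱼ : JoinsChord j x′ y′) where

    private
      x<y  = ℕ.<-trans x<x′ x′<y
      x′<y′ = ℕ.<-trans x′<y y<y′
      x<y′ = ℕ.<-trans x<y y<y′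
      module M₁ = Segment (segment x∈ x′∈ (ℕ.<⇒≤ x<x′))
      module M₂ = Segment (segment x′∈ y∈ (ℕ.<⇒≤ x′<y))
      module M₃ = Segment (segment y∈ y′∈ (ℕ.<⇒≤ y<y′))
      module O = Outer x∈ y′∈ x<y′

      branch : Fin 4 → Fin n
      branch 0F = x
      branch 1F = x′
      branch 2F = y
      branch 3F = y′

      branch-< : ∀ {i j} → Pair i j → rk (branch i) < rk (branch j)
      branch-< p01 = x<x′
      branch-< p12 = x′<y
      branch-< p23 = y<y′
      branch-< p03 = x<y′
      branch-< p02 = x<y
      branch-< p13 = x′<y′

      path : ∀ {i j} → Pair i j → W.Walk (branch i) (branch j)
      path p01 = lift M₁.walk (p₀⊆C ∘ M₁.edges⊆)
      path p12 = lift M₂.walk (p₀⊆C ∘ M₂.edges⊆)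
      path p23 = lift M₃.walk (p₀⊆C ∘ M₃.edges⊆)
      path p03 = lift O.outer O.outer⊆C
      path p02 = W.step (inj₂ i) chordᵢ W.[]
      path p13 = W.step (inj₂ j) chordⱼ W.[]

      ≢branch : ∀ {i j} → Pair i j → branch i ≢ branch j
      ≢branch p eq = ℕ.<-irrefl (cong rk eq) (branch-< p)

      isPathIn : ∀ {k l} (p : Pair k l) → W.IsPathIn (C∪ i ∪ j) (path p)
      isPathIn p01 = lift-isPathIn M₁.walk _ M₁.simple
      isPathIn p12 = lift-isPathIn M₂.walk _ M₂.simple
      isPathIn p23 = lift-isPathIn M₃.walk _ M₃.simple
      isPathIn p03 = lift-isPathIn O.outer _ O.outer-simple
      isPathIn p02 = W.Simple-step {x = inj₂ i} chordᵢ (≢branch p02) , inj₁ refl ∷ []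
      isPathIn p13 = W.Simple-step {x = inj₂ j} chordⱼ (≢branch p13) , inj₂ refl ∷ []

      lower : ∀ {A : Set} {p : Walk u w} {p⊆ : ∀ {f} → f ∈ₑ p → f ∈ C} → (v ∈ᵥ p → A) → v W.∈ᵥ lift p p⊆ → A
      lower {p = p} {p⊆} h i = h (subst (_ ∈ₗ_) (lift-vertices p p⊆) i)

      -- Independence of the six paths is reduced to ranks: a vertex common to two of them lies in a
      -- closed interval of ranks and outside the corresponding open one, and `pinch` leaves only
      -- the ends. For `p03`, which runs through `e`, the two conditions exchange their roles.
      InRange : ∀ {i j} → Pair i j → Fin n → Set
      InRange p01 v = On v × rk x ≤ rk v × rk v ≤ rk x′
      InRange p12 v = On v × rk x′ ≤ rk v × rk v ≤ rk y
      InRange p23 v = On v × rk y ≤ rk v × rk v ≤ rk y′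
      InRange p03 v = On v × (rk v ≤ rk x ⊎ rk y′ ≤ rk v)
      InRange p02 v = v ≡ x ⊎ v ≡ y
      InRange p13 v = v ≡ x′ ⊎ v ≡ y′

      inRange : ∀ {i j} (p : Pair i j) → v W.∈ᵥ path p → InRange p v
      inRange p01 = lower λ k → M₁.on k , M₁.above k , M₁.below k
      inRange p12 = lower λ k → M₂.on k , M₂.above k , M₂.below k
      inRange p23 = lower λ k → M₃.on k , M₃.above k , M₃.below k
      inRange p03 = lower O.outer-vertices⁻
      inRange p02 (here e)         = inj₁ e
      inRange p02 (there (here e)) = inj₂ e
      inRange p13 (here e)         = inj₁ e
      inRange p13 (there (here e)) = inj₂ e

      Off : ℕ → ℕ → Fin n → Set
      Off s t v = rk v ≤ s ⊎ t ≤ rk v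

      off₁ : ∀ {k l} (q : Pair k l) → ¬ (0F ≡ k × 1F ≡ l) → InRange q v → Off (rk x) (rk x′) v
      off₁ p01 ne _ = contradiction (refl , refl) ne
      off₁ p12 _ (_ , l , _) = inj₂ l
      off₁ p23 _ (_ , l , _) = inj₂ (ℕ.≤-trans (ℕ.<⇒≤ x′<y) l)
      off₁ p03 _ (_ , inj₁ l) = inj₁ l
      off₁ p03 _ (_ , inj₂ l) = inj₂ (ℕ.≤-trans (ℕ.<⇒≤ x′<y′) l)
      off₁ p02 _ (inj₁ refl) = inj₁ ℕ.≤-refl
      off₁ p02 _ (inj₂ refl) = inj₂ (ℕ.<⇒≤ x′<y)
      off₁ p13 _ (inj₁ refl) = inj₂ ℕ.≤-refl
      off₁ p13 _ (inj₂ refl) = inj₂ (ℕ.<⇒≤ x′<y′)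

      off₂ : ∀ {k l} (q : Pair k l) → ¬ (1F ≡ k × 2F ≡ l) → InRange q v → Off (rk x′) (rk y) v
      off₂ p12 ne _ = contradiction (refl , refl) ne
      off₂ p01 _ (_ , _ , l) = inj₁ l
      off₂ p23 _ (_ , l , _) = inj₂ l
      off₂ p03 _ (_ , inj₁ l) = inj₁ (ℕ.≤-trans l (ℕ.<⇒≤ x<x′))
      off₂ p03 _ (_ , inj₂ l) = inj₂ (ℕ.≤-trans (ℕ.<⇒≤ y<y′) l)
      off₂ p02 _ (inj₁ refl) = inj₁ (ℕ.<⇒≤ x<x′)
      off₂ p02 _ (inj₂ refl) = inj₂ ℕ.≤-refl
      off₂ p13 _ (inj₁ refl) = inj₁ ℕ.≤-refl
      off₂ p13 _ (inj₂ refl) = inj₂ (ℕ.<⇒≤ y<y′)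

      off₃ : ∀ {k l} (q : Pair k l) → ¬ (2F ≡ k × 3F ≡ l) → InRange q v → Off (rk y) (rk y′) v
      off₃ p23 ne _ = contradiction (refl , refl) ne
      off₃ p01 _ (_ , _ , l) = inj₁ (ℕ.≤-trans l (ℕ.<⇒≤ x′<y))
      off₃ p12 _ (_ , _ , l) = inj₁ l
      off₃ p03 _ (_ , inj₁ l) = inj₁ (ℕ.≤-trans l (ℕ.<⇒≤ x<y))
      off₃ p03 _ (_ , inj₂ l) = inj₂ l
      off₃ p02 _ (inj₁ refl) = inj₁ (ℕ.<⇒≤ x<y)
      off₃ p02 _ (inj₂ refl) = inj₁ ℕ.≤-refl
      off₃ p13 _ (inj₁ refl) = inj₁ (ℕ.<⇒≤ x′<y)
      off₃ p13 _ (inj₂ refl) = inj₂ ℕ.≤-refl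

      off₀ : ∀ {k l} (q : Pair k l) → ¬ (0F ≡ k × 3F ≡ l) → InRange q v → rk x ≤ rk v × rk v ≤ rk y′
      off₀ p03 ne _ = contradiction (refl , refl) ne
      off₀ p01 _ (_ , l , l′) = l , ℕ.≤-trans l′ (ℕ.<⇒≤ x′<y′)
      off₀ p12 _ (_ , l , l′) = ℕ.≤-trans (ℕ.<⇒≤ x<x′) l , ℕ.≤-trans l′ (ℕ.<⇒≤ y<y′)
      off₀ p23 _ (_ , l , l′) = ℕ.≤-trans (ℕ.<⇒≤ x<y) l , l′
      off₀ p02 _ (inj₁ refl) = ℕ.≤-refl , ℕ.<⇒≤ x<y′
      off₀ p02 _ (inj₂ refl) = ℕ.<⇒≤ x<y , ℕ.<⇒≤ y<y′
      off₀ p13 _ (inj₁ refl) = ℕ.<⇒≤ x<x′ , ℕ.<⇒≤ x′<y′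
      off₀ p13 _ (inj₂ refl) = ℕ.<⇒≤ x<y′ , ℕ.≤-refl

      pinch : On u → On w → On v × rk u ≤ rk v × rk v ≤ rk w → Off (rk u) (rk w) v → v ≡ u ⊎ v ≡ w
      pinch u∈ w∈ (v∈ , l , _) (inj₁ r) = inj₁ (rk-injective v∈ u∈ (ℕ.≤-antisym r l))
      pinch u∈ w∈ (v∈ , _ , l) (inj₂ r) = inj₂ (rk-injective v∈ w∈ (ℕ.≤-antisym l r))

      independent : ∀ {i j k l} (p : Pair i j) (q : Pair k l) → ¬ (i ≡ k × j ≡ l) →
                    InRange p v → InRange q v → v ≡ branch i ⊎ v ≡ branch j
      independent p01 q ne a b = pinch x∈ x′∈ a (off₁ q ne b)
      independent p12 q ne a b = pinch x′∈ y∈ a (off₂ q ne b)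
      independent p23 q ne a b = pinch y∈ y′∈ a (off₃ q ne b)
      independent p03 q ne (v∈ , o) b with off₀ q ne b
      ... | l , l′ = pinch x∈ y′∈ (v∈ , l , l′) o
      independent p02 q ne a _ = a
      independent p13 q ne a _ = a

      -- No integer lies strictly between two consecutive ones, so an edge of `p₀` never straddles a
      -- branch vertex.
      consecutive : ∀ {r s} t → s ≡ suc r → r ≤ t × s ≤ t ⊎ t ≤ r × t ≤ s
      consecutive {r} t refl with r ℕ.<? t
      ... | yes l = inj₁ (ℕ.<⇒≤ l , l)
      ... | no ¬l = let l = ℕ.≮⇒≥ ¬l in inj₂ (l , ℕ.m≤n⇒m≤1+n l)

      covers-p₀ : f ∈ₑ p₀ → Joins f u v → rk v ≡ suc (rk u) → (f∈ : f ∈ C) →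
                  ∃₂ λ k l → Σ[ p ∈ Pair k l ] inj₁ (f , f∈) W.∈ₑ path p
      covers-p₀ i j eq f∈ with consecutive (rk x) eq
      ... | inj₁ (a , b) = _ , _ , p03 , lift-edges O.outer _ (O.outer-edges⁺ i j (inj₁ (a , b))) f∈
      ... | inj₂ (a , b) with consecutive (rk x′) eq
      ... | inj₁ (c , d) = _ , _ , p01 , lift-edges M₁.walk _ (M₁.complete-edges i j a b c d) f∈
      ... | inj₂ (a , b) with consecutive (rk y) eq
      ... | inj₁ (c , d) = _ , _ , p12 , lift-edges M₂.walk _ (M₂.complete-edges i j a b c d) f∈
      ... | inj₂ (a , b) with consecutive (rk y′) eq
      ... | inj₁ (c , d) = _ , _ , p23 , lift-edges M₃.walk _ (M₃.complete-edges i j a b c d) f∈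
      ... | inj₂ (a , b) = _ , _ , p03 , lift-edges O.outer _ (O.outer-edges⁺ i j (inj₂ (a , b))) f∈

      covers : ∀ g → (C∪ i ∪ j) g → ∃₂ λ k l → Σ[ p ∈ Pair k l ] g W.∈ₑ path p
      covers (inj₂ _) (inj₁ refl) = _ , _ , p02 , here refl
      covers (inj₂ _) (inj₂ refl) = _ , _ , p13 , here refl
      covers (inj₁ (f , f∈)) _ with ∈C⁻ f∈
      ... | inj₁ refl = _ , _ , p03 , lift-edges O.outer _ O.e∈outer f∈
      ... | inj₂ i with Incident⇒Joins f (inj₁ refl)
      ...   | t , j with rk-edge i j
      ...     | inj₁ eq = covers-p₀ i j eq f∈
      ...     | inj₂ eq = covers-p₀ i (Joins-sym j) eq f∈

    interleaved⇒Cross : Cross i j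
    interleaved⇒Cross = record
      { branch = branch
      ; branch-inj = λ {k} {l} eq → inj k l eq
      ; path = λ k l k<l → path (pair k l k<l)
      ; path-isPathIn = λ k l k<l → isPathIn (pair k l k<l)
      ; independent = λ k l k<l k′ l′ k′<l′ ne v a b →
          independent (pair k l k<l) (pair k′ l′ k′<l′) ne (inRange (pair k l k<l) a) (inRange (pair k′ l′ k′<l′) b)
      ; covers = λ g Fg → let k , l , p , g∈ = covers g Fg in
          k , l , unpair p , subst (λ q → g W.∈ₑ path q) (pair-unique p (pair k l (unpair p))) g∈
      }
      where
      inj : ∀ k l → branch k ≡ branch l → k ≡ l
      inj k l eq with <-cmp k l
      ... | tri≈ _ k≡l _ = k≡l
      ... | tri< k<l _ _ = contradiction eq (≢branch (pair k l k<l))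
      ... | tri> _ _ l<k = contradiction (sym eq) (≢branch (pair l k l<k))

  -- Only two edges of C leave a range of ranks, one at either end.
  module NoCross (κ : Cross i j) where
    open K₄Cut κ
    open Graph.IsK₄Subdivision κ using (branch; branch-inj)

    module Range {p q : Fin n} (p∈ : On p) (q∈ : On q)
      (closed : ∀ {k u v} → k ≡ i ⊎ k ≡ j → JoinsChord k u v →
                On u × rk p ≤ rk u × rk u ≤ rk q → On v × rk p ≤ rk v × rk v ≤ rk q) where

      S : Fin n → Set
      S v = On v × rk p ≤ rk v × rk v ≤ rk q

      S? : Decidable S
      S? v = on? v ×-dec (rk p ℕ.≤? rk v) ×-dec (rk v ℕ.≤? rk q)

      private
        -- The possible exits from the range. The alternatives with `a` and `z` stand for `e`, which
        -- replaces the next edge of `p₀` when the range reaches an end of `p₀`.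
        Up Down : Fin n → Fin n → Set
        Up   u v = u ≡ q × On v × (rk v ≡ suc (rk u) ⊎ (u ≡ z × v ≡ a))
        Down u v = u ≡ p × On v × (rk u ≡ suc (rk v) ⊎ (u ≡ a × v ≡ z))

        up-functional : ∀ {u v u′ v′} → Up u v → Up u′ v′ → u ≡ u′ × v ≡ v′
        up-functional (refl , v∈ , inj₁ e) (refl , v′∈ , inj₁ e′) = refl , rk-injective v∈ v′∈ (trans e (sym e′))
        up-functional (refl , v∈ , inj₂ (_ , refl)) (refl , v′∈ , inj₂ (_ , refl)) = refl , refl
        up-functional (refl , v∈ , inj₁ e) (refl , _ , inj₂ (refl , _)) =
          contradiction (subst (_≤ rk z) e (rk≤rk-z v∈)) (ℕ.<⇒≱ (ℕ.n<1+n _))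
        up-functional (refl , _ , inj₂ (refl , _)) (refl , v∈ , inj₁ e) =
          contradiction (subst (_≤ rk z) e (rk≤rk-z v∈)) (ℕ.<⇒≱ (ℕ.n<1+n _))

        down-functional : ∀ {u v u′ v′} → Down u v → Down u′ v′ → u ≡ u′ × v ≡ v′
        down-functional (refl , v∈ , inj₁ e) (refl , v′∈ , inj₁ e′) =
          refl , rk-injective v∈ v′∈ (ℕ.suc-injective (trans (sym e) e′))
        down-functional (refl , v∈ , inj₂ (_ , refl)) (refl , v′∈ , inj₂ (_ , refl)) = refl , refl
        down-functional (refl , v∈ , inj₁ e) (refl , _ , inj₂ (refl , _)) = contradiction (trans (sym rk-a) e) λ ()
        down-functional (refl , _ , inj₂ (refl , _)) (refl , v∈ , inj₁ e) = contradiction (trans (sym rk-a) e) λ ()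

        classify : ∀ {u v} → Crosses S? u v → Up u v ⊎ Down u v
        classify (Su , ¬Sv , inj₂ k , Fk , c) = contradiction (closed Fk c Su) ¬Sv
        classify {u} {v} ((u∈ , l , r) , ¬Sv , inj₁ (f , f∈) , _ , c) with ∈C⁻ f∈
        classify {u} {v} ((u∈ , l , r) , ¬Sv , inj₁ (f , f∈) , _ , c) | inj₁ refl with Joins-unique c eⱼ
        ... | inj₁ (refl , refl) = inj₂ (rk-injective u∈ p∈ (ℕ.≤-antisym rk-a≤ l) , end∈ p₀ , inj₂ (refl , refl))
        ... | inj₂ (refl , refl) = inj₁ (rk-injective u∈ q∈ (ℕ.≤-antisym r (rk≤rk-z q∈)) , start∈ p₀ , inj₂ (refl , refl))
        classify {u} {v} ((u∈ , l , r) , ¬Sv , inj₁ (f , f∈) , _ , c) | inj₂ i with rk-edge i c | edge-On i (Joins-sym c)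
        ... | inj₁ eq | v∈ with rk v ℕ.≤? rk q
        ...   | yes v≤q = contradiction (v∈ , subst (rk p ≤_) (sym eq) (ℕ.m≤n⇒m≤1+n l) , v≤q) ¬Sv
        ...   | no v≰q = inj₁ (rk-injective u∈ q∈ (ℕ.≤-antisym r (ℕ.s≤s⁻¹ (subst (rk q <_) eq (ℕ.≰⇒> v≰q)))) , v∈ , inj₁ eq)
        classify {u} {v} ((u∈ , l , r) , ¬Sv , inj₁ (f , f∈) , _ , c) | inj₂ i | inj₂ eq | v∈ with rk p ℕ.≤? rk v
        ...   | yes p≤v = contradiction (v∈ , p≤v , ℕ.≤-trans (ℕ.n≤1+n _) (subst (_≤ rk q) eq r)) ¬Sv
        ...   | no p≰v = inj₂ (rk-injective u∈ p∈ (ℕ.≤-antisym (subst (_≤ rk p) (sym eq) (ℕ.≰⇒> p≰v)) l) , v∈ , inj₁ eq)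

      one-side : ∀ {s t} → S (branch s) → S (branch t)
      one-side {s} {t} Ss with S? (branch t)
      ... | yes St = St
      ... | no ¬St = ⊥-elim (not-separated S? classify up-functional down-functional Ss ¬St)

    module _ {x y x′ y′ : Fin n} (x∈ : On x) (y∈ : On y) (x′∈ : On x′) (y′∈ : On y′)
      (x′<y′ : rk x′ < rk y′) (x≤x′ : rk x ≤ rk x′) (y′≤y : rk y′ ≤ rk y)
      (chords : ∀ {k u v} → k ≡ i ⊎ k ≡ j → JoinsChord k u v →
        ((u ≡ x × v ≡ y) ⊎ (u ≡ y × v ≡ x)) ⊎ ((u ≡ x′ × v ≡ y′) ⊎ (u ≡ y′ × v ≡ x′))) where

      private
        On-branch : ∀ s → On (branch s)
        On-branch s with branch-incident s
        ... | inj₁ (f , f∈) , _ , inc = Touches⇒On (f , f∈ , inc)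
        ... | inj₂ k , Fk , inc with W.Incident⇒Joins (inj₂ k) inc
        ...   | _ , c with chords Fk c
        ...     | inj₁ (inj₁ (e , _)) = subst On (sym e) x∈
        ...     | inj₁ (inj₂ (e , _)) = subst On (sym e) y∈
        ...     | inj₂ (inj₁ (e , _)) = subst On (sym e) x′∈
        ...     | inj₂ (inj₂ (e , _)) = subst On (sym e) y′∈

        -- A branch vertex that is no chord end would by itself be a range that no chord leaves.
        -- Then `one-side` would put all four branch vertices into it.
        branch-end : ∀ s → branch s ∈ₗ x ∷ y ∷ x′ ∷ y′ ∷ []
        branch-end s with branch s ∈ₗ? (x ∷ y ∷ x′ ∷ y′ ∷ [])
        ... | yes i = i
        ... | no ∉ends = ⊥-elim (other≢ s (λ t → branch-inj (rk-injective (On-branch s) (On-branch t)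
                (let _ , l , r = Single.one-side {s} {t} (On-branch s , ℕ.≤-refl , ℕ.≤-refl) in ℕ.≤-antisym l r))))
          where
          other≢ : ∀ (s : Fin 4) → ¬ (∀ t → s ≡ t)
          other≢ 0F all with all 1F
          ... | ()
          other≢ (suc s) all with all 0F
          ... | ()
          ends-∈ : ∀ {u v} → ((u ≡ x × v ≡ y) ⊎ (u ≡ y × v ≡ x)) ⊎ ((u ≡ x′ × v ≡ y′) ⊎ (u ≡ y′ × v ≡ x′)) →
                   u ∈ₗ x ∷ y ∷ x′ ∷ y′ ∷ []
          ends-∈ (inj₁ (inj₁ (e , _))) = here e
          ends-∈ (inj₁ (inj₂ (e , _))) = there (here e)
          ends-∈ (inj₂ (inj₁ (e , _))) = there (there (here e))
          ends-∈ (inj₂ (inj₂ (e , _))) = there (there (there (here e)))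
          closed : ∀ {k u v} → k ≡ i ⊎ k ≡ j → JoinsChord k u v →
                   On u × rk (branch s) ≤ rk u × rk u ≤ rk (branch s) → On v × rk (branch s) ≤ rk v × rk v ≤ rk (branch s)
          closed Fk c (u∈ , l , r) = contradiction (ends-∈ (chords Fk c))
            (subst (_∉ₗ _) (rk-injective (On-branch s) u∈ (ℕ.≤-antisym l r)) ∉ends)
          module Single = Range (On-branch s) (On-branch s) closed

        -- If the chords shared this end, only three vertices would be left for four branch
        -- vertices.
        x<x′ : rk x < rk x′
        x<x′ = ℕ.≤∧≢⇒< x≤x′ λ eq → branches∉ (x ∷ y ∷ y′ ∷ []) ℕ.≤-refl λ s → merge (rk-injective x∈ x′∈ eq) (branch-end s)
          where
          merge : ∀ {v} → x ≡ x′ → v ∈ₗ x ∷ y ∷ x′ ∷ y′ ∷ [] → v ∈ₗ x ∷ y ∷ y′ ∷ []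
          merge _    (here e)                         = here e
          merge _    (there (here e))                 = there (here e)
          merge refl (there (there (here e)))         = here e
          merge _    (there (there (there (here e)))) = there (there (here e))

        y′<y : rk y′ < rk y
        y′<y = ℕ.≤∧≢⇒< y′≤y λ eq → branches∉ (x ∷ y ∷ x′ ∷ []) ℕ.≤-refl λ s → merge (rk-injective y′∈ y∈ eq) (branch-end s)
          where
          merge : ∀ {v} → y′ ≡ y → v ∈ₗ x ∷ y ∷ x′ ∷ y′ ∷ [] → v ∈ₗ x ∷ y ∷ x′ ∷ []
          merge _    (here e)                         = here e
          merge _    (there (here e))                 = there (here e)
          merge _    (there (there (here e)))         = there (there (here e))
          merge refl (there (there (there (here e)))) = there (here e)

        closed : ∀ {k u v} → k ≡ i ⊎ k ≡ j → JoinsChord k u v →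
                 On u × rk x′ ≤ rk u × rk u ≤ rk y′ → On v × rk x′ ≤ rk v × rk v ≤ rk y′
        closed Fk c Su with chords Fk c | Su
        ... | inj₁ (inj₁ (refl , _)) | _ , l , _ = contradiction l (ℕ.<⇒≱ x<x′)
        ... | inj₁ (inj₂ (refl , _)) | _ , _ , l = contradiction l (ℕ.<⇒≱ y′<y)
        ... | inj₂ (inj₁ (_ , refl)) | _ = y′∈ , ℕ.<⇒≤ x′<y′ , ℕ.≤-refl
        ... | inj₂ (inj₂ (_ , refl)) | _ = x′∈ , ℕ.≤-refl , ℕ.<⇒≤ x′<y′

        module Inner = Range x′∈ y′∈ closed

      -- The range from `x′` to `y′` contains both ends of one chord and no end of the other. All
      -- branch vertices are on one side of it, so four of them would share two vertices.
      nested⇒¬Cross : Empty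
      nested⇒¬Cross with Inner.S? (branch 0F)
      ... | yes S₀ = branches∉ (x′ ∷ y′ ∷ []) (ℕ.n≤1+n _) λ s → inner (Inner.one-side {0F} {s} S₀) (branch-end s)
        where
        inner : ∀ {v} → Inner.S v → v ∈ₗ x ∷ y ∷ x′ ∷ y′ ∷ [] → v ∈ₗ x′ ∷ y′ ∷ []
        inner (_ , l , _) (here refl)         = contradiction l (ℕ.<⇒≱ x<x′)
        inner (_ , _ , l) (there (here refl)) = contradiction l (ℕ.<⇒≱ y′<y)
        inner _           (there (there i))   = i
      ... | no ¬S₀ = branches∉ (x ∷ y ∷ []) (ℕ.n≤1+n _) λ s → outer′ (λ Ss → ¬S₀ (Inner.one-side {s} {0F} Ss)) (branch-end s)
        where
        outer′ : ∀ {v} → ¬ Inner.S v → v ∈ₗ x ∷ y ∷ x′ ∷ y′ ∷ [] → v ∈ₗ x ∷ y ∷ []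
        outer′ _  (here e)         = here e
        outer′ _  (there (here e)) = there (here e)
        outer′ ¬S (there (there (here refl)))         = contradiction (x′∈ , ℕ.≤-refl , ℕ.<⇒≤ x′<y′) ¬S
        outer′ ¬S (there (there (there (here refl)))) = contradiction (y′∈ , ℕ.<⇒≤ x′<y′ , ℕ.≤-refl) ¬S

-- Handles of `C*` in terms of innermost and outermost spans.

module Handles {n m : ℕ} {G : Graph (Fin n) (Fin m)} (loopless : Circles.Loopless G)
               {C : Subset m} {e : Fin m} (route : Route G C e)
               (chordEnds : FiniteGraph.Bridge G C → Fin n × Fin n)
               (exact : ∀ D → FiniteGraph.AttachedExactlyAt G C D (chordEnds D)) where
  open Circles G
  open CirclesLoopless loopless
  open Components G
  open Route route
  open CircleThrough loopless route
  open Crossing loopless route chordEnds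
  open FiniteGraph G using (Bridge)
  open FiniteGraph.WithChords G C chordEnds using (Cross; ChordEnd; SegmentBetween; IsHandle; TwoHandled)
  private variable
    u v w x y x′ y′ : Fin n
    f : Fin m
    D D′ : Bridge C
    H : Subset m

  JoinsChord-unique : JoinsChord D u w → JoinsChord D x y → (u ≡ x × w ≡ y) ⊎ (u ≡ y × w ≡ x)
  JoinsChord-unique {D} = W.Joins-unique {x = inj₂ D}

  chord⇒att : JoinsChord D u w → Att D u × Att D w
  chord⇒att {D} (inj₁ refl) = Equivalence.from (proj₂ (exact D) _) (inj₁ refl) , Equivalence.from (proj₂ (exact D) _) (inj₂ refl)
  chord⇒att {D} (inj₂ refl) = Equivalence.from (proj₂ (exact D) _) (inj₂ refl) , Equivalence.from (proj₂ (exact D) _) (inj₁ refl)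

  chord⇒span : JoinsChord D u w → Span D u w ⊎ Span D w u
  chord⇒span {D} c@(inj₁ refl) = let au , aw = chord⇒att c in
    attached⇒span au aw (proj₁ (exact D)) (Equivalence.to (proj₂ (exact D) _))
  chord⇒span {D} c@(inj₂ refl) = let au , aw = chord⇒att c in
    attached⇒span au aw (≢-sym (proj₁ (exact D))) (swap ∘ Equivalence.to (proj₂ (exact D) _))

  span : ∀ D → ∃₂ λ x y → Span D x y
  span D with chord⇒span {D} (inj₁ refl)
  ... | inj₁ S = _ , _ , S
  ... | inj₂ S = _ , _ , S

  span⇒chord : Span D x y → JoinsChord D x y
  span⇒chord {D} S with Equivalence.to (proj₂ (exact D) _) (Span.attˡ S) | Equivalence.to (proj₂ (exact D) _) (Span.attʳ S)
  ... | inj₁ refl | inj₂ refl = inj₁ refl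
  ... | inj₂ refl | inj₁ refl = inj₂ refl
  ... | inj₁ refl | inj₁ refl = contradiction refl (Span.x≢y S)
  ... | inj₂ refl | inj₂ refl = contradiction refl (Span.x≢y S)

  Attached : Fin n → Set
  Attached v = ∃[ D ] Att D v

  chordEnd⇒attached : ChordEnd v → Attached v
  chordEnd⇒attached (D , i) with W.Incident⇒Joins (inj₂ D) i
  ... | _ , c = D , proj₁ (chord⇒att c)

  attached⇒chordEnd : Attached v → ChordEnd v
  attached⇒chordEnd (D , av) with Equivalence.to (proj₂ (exact D) _) av
  ... | inj₁ refl = D , inj₁ refl
  ... | inj₂ refl = D , inj₂ refl

  attached⇒on : Attached v → On v
  attached⇒on (D , av) = Att⇒On D av

  -- The quantifier over bridges is replaced by one over edges: a vertex of `C` is an attachment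
  -- exactly if an edge outside `C` meets it.
  attached? : Decidable Attached
  attached? v with on? v | any? (λ f → ¬? (f ∈? C) ×-dec incident? f v)
  ... | no v∉ | _ = no (v∉ ∘ attached⇒on)
  ... | yes _ | no none = no λ { (D , _ , f , f∈ , i) → none (f , ∈ᴮ⇒∉C D f∈ , i) }
  ... | yes v∈ | yes (f , f∉ , i) = let D , _ , av = bridgeAt v∈ i f∉ in yes (D , av)

  attached⇒span′ : Attached v → ∃[ D ] ∃₂ λ x y → Span D x y × (v ≡ x ⊎ v ≡ y)
  attached⇒span′ (D , av) = let x , y , S = span D in D , x , y , S , Span.only S av

  Innermost Outermost : Fin n → Fin n → Set
  Innermost x y = ∀ {v} → Attached v → ¬ (rk x < rk v × rk v < rk y)
  Outermost x y = ∀ {v} → Attached v → rk x ≤ rk v × rk v ≤ rk y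

  module Arc (S : Span D x y) where
    open Span S public
    between-ends : Segment x y
    between-ends = segment onˡ onʳ (ℕ.<⇒≤ x<y)
    open Segment between-ends public
    open Outer onˡ onʳ x<y public

  innerHandle : (S : Span D x y) → Innermost x y → IsHandle (edgeSet (Arc.walk S))
  innerHandle {D} {x} {y} S inner = x , y ,
    (x≢y , attached⇒chordEnd (D , attˡ) , attached⇒chordEnd (D , attʳ) ,
      walk , (simple , All.tabulate (p₀⊆C ∘ edges⊆)) , refl , λ v i c → ends-only v i (chordEnd⇒attached c)) ,
    D , span⇒chord S
    where
    open Arc S
    ends-only : ∀ v → v ∈ᵥ walk → Attached v → v ≡ x ⊎ v ≡ y
    ends-only v i av with ℕ.<-cmp (rk x) (rk v) | ℕ.<-cmp (rk v) (rk y)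
    ... | tri< l _ _ | tri< r _ _ = contradiction (l , r) (inner av)
    ... | tri≈ _ q _ | _ = inj₁ (rk-injective (on i) onˡ (sym q))
    ... | _ | tri≈ _ q _ = inj₂ (rk-injective (on i) onʳ q)
    ... | tri> ¬l ¬q _ | _ = contradiction (ℕ.≤∧≢⇒< (above i) ¬q) ¬l
    ... | _ | tri> ¬l ¬q _ = contradiction (ℕ.≤∧≢⇒< (below i) ¬q) ¬l

  outerHandle : (S : Span D x y) → Outermost x y → IsHandle (edgeSet (Arc.outer S))
  outerHandle {D} {x} {y} S outermost = x , y ,
    (x≢y , attached⇒chordEnd (D , attˡ) , attached⇒chordEnd (D , attʳ) ,
      outer , (outer-simple , All.tabulate outer⊆C) , refl , λ v i c → ends-only v i (chordEnd⇒attached c)) ,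
    D , span⇒chord S
    where
    open Arc S
    ends-only : ∀ v → v ∈ᵥ outer → Attached v → v ≡ x ⊎ v ≡ y
    ends-only v i av with outer-vertices⁻ i | outermost av
    ... | v∈ , inj₁ l | r , _ = inj₁ (rk-injective v∈ onˡ (ℕ.≤-antisym l r))
    ... | v∈ , inj₂ l | _ , r = inj₂ (rk-injective v∈ onʳ (ℕ.≤-antisym r l))

  data HandleForm (H : Subset m) : Set where
    inner : (S : Span D x y) → Innermost x y → edgeSet (Arc.walk S) ≡ H → HandleForm H
    outer : (S : Span D x y) → Outermost x y → edgeSet (Arc.outer S) ≡ H → HandleForm H

  edgeSet-reverse : (p : Walk u w) → edgeSet (reverse p) ≡ edgeSet p
  edgeSet-reverse p = ⊆-antisym (∈-edgeSet⁺ p ∘ ∈ₑ-reverse⁻ p ∘ ∈-edgeSet⁻ (reverse p))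
                                (∈-edgeSet⁺ (reverse p) ∘ ∈ₑ-reverse⁺ p ∘ ∈-edgeSet⁻ p)

  -- Whether the arc uses `e` decides which of the two arcs between the ends of the span it is; the
  -- absence of further chord ends on it then says that the span is innermost or outermost.
  form : (S : Span D x y) (p : Walk x y) → Simple p → (∀ {f} → f ∈ₑ p → f ∈ C) →
         (∀ {v} → v ∈ᵥ p → Attached v → v ≡ x ⊎ v ≡ y) → HandleForm (edgeSet p)
  form {x = x} {y} S p sp p⊆ ends with e ∈ₗ? edges p
  ... | no e∉p = inner S
      (λ {v} av (l , r) → case ends (arc-vertices A.walk p A.simple sp (p₀⊆C ∘ A.edges⊆) p⊆
                                   (⊥-elim ∘ segment-e∉ A.between-ends) (⊥-elim ∘ e∉p) A.x≢y
                                   (A.complete (attached⇒on av) (ℕ.<⇒≤ l) (ℕ.<⇒≤ r))) av of λ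
        { (inj₁ refl) → ℕ.<-irrefl refl l ; (inj₂ refl) → ℕ.<-irrefl refl r })
      (arc-edgeSet A.walk p A.simple sp (p₀⊆C ∘ A.edges⊆) p⊆ (⊥-elim ∘ segment-e∉ A.between-ends) (⊥-elim ∘ e∉p))
    where module A = Arc S
  ... | yes e∈p = outer S bound
      (arc-edgeSet A.outer p A.outer-simple sp A.outer⊆C p⊆ (λ _ → e∈p) (λ _ → A.e∈outer))
    where
    module A = Arc S
    on-outer : ∀ {v} → Attached v → rk v ≤ rk x ⊎ rk y ≤ rk v → v ≡ x ⊎ v ≡ y
    on-outer av o = ends (arc-vertices A.outer p A.outer-simple sp A.outer⊆C p⊆ (λ _ → e∈p) (λ _ → A.e∈outer) A.x≢y
                           (A.outer-vertices⁺ (attached⇒on av) o)) av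
    bound : Outermost x y
    bound {v} av with ℕ.≤-total (rk v) (rk x) | ℕ.≤-total (rk y) (rk v)
    ... | inj₂ l | inj₁ r = case on-outer av (inj₂ r) of λ { (inj₁ refl) → l , ℕ.<⇒≤ A.x<y ; (inj₂ refl) → l , ℕ.≤-refl }
    ... | inj₁ l | _ = case on-outer av (inj₁ l) of λ { (inj₁ refl) → ℕ.≤-refl , ℕ.<⇒≤ A.x<y ; (inj₂ refl) → ℕ.<⇒≤ A.x<y , ℕ.≤-refl }
    ... | inj₂ l | inj₂ r = l , r

  handleForm : IsHandle H → HandleForm H
  handleForm (u , w , (u≢w , _ , _ , p , (sp , pC) , refl , ends) , D , c) with chord⇒span c
  ... | inj₁ S = form S p sp (All.lookup pC) λ i av → ends _ i (attached⇒chordEnd av)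
  ... | inj₂ S = subst HandleForm (edgeSet-reverse p) (form S (reverse p) (Simple-reverse p sp) (All.lookup pC ∘ ∈ₑ-reverse⁻ p)
                   λ i av → swap (ends _ (∈ᵥ-reverse⁻ p i) (attached⇒chordEnd av)))

  e∉inner : (S : Span D x y) → e ∉ edgeSet (Arc.walk S)
  e∉inner S i = segment-e∉ (Arc.between-ends S) (∈-edgeSet⁻ (Arc.walk S) i)

  e∈outer′ : (S : Span D x y) → e ∈ edgeSet (Arc.outer S)
  e∈outer′ S = ∈-edgeSet⁺ (Arc.outer S) (Arc.e∈outer S)

  -- An attachment strictly inside the span belongs to another bridge, whose span does not cross the
  -- given one and hence is a shorter interval inside it. Only crossings are excluded by the
  -- hypothesis, because the lemma also serves to derive nestedness.
  innermost : (∀ {D D′ x y x′ y′} → Span D x y → Span D′ x′ y′ → ¬ (rk x < rk x′ × rk x′ < rk y × rk y < rk y′)) →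
              Span D x y → ∃[ D′ ] ∃₂ λ x′ y′ → Span D′ x′ y′ × Innermost x′ y′ × rk x ≤ rk x′ × rk y′ ≤ rk y
  innermost {x = x} {y} untangled S = go (rk y) S (ℕ.m≤n+m _ _)
    where
    go : ∀ k {D x y} → Span D x y → rk y ≤ rk x + k →
         ∃[ D′ ] ∃₂ λ x′ y′ → Span D′ x′ y′ × Innermost x′ y′ × rk x ≤ rk x′ × rk y′ ≤ rk y
    go zero {x = x} {y} S l = contradiction (subst (rk y ≤_) (ℕ.+-identityʳ _) l) (ℕ.<⇒≱ (Span.x<y S))
    go (suc k) {D} {x} {y} S l with any? (λ v → attached? v ×-dec (rk x ℕ.<? rk v) ×-dec (rk v ℕ.<? rk y))
    ... | no none = D , x , y , S , (λ av (p , q) → none (_ , av , p , q)) , ℕ.≤-refl , ℕ.≤-refl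
    ... | yes (v , av , x<v , v<y) with attached⇒span′ av
    ...   | D′ , x′ , y′ , S′ , inj₁ refl =
      let y′≤y = ℕ.≮⇒≥ λ y<y′ → untangled S S′ (x<v , v<y , y<y′)
          D″ , x″ , y″ , S″ , i , p , q = go k S′ (ℕ.≤-trans y′≤y (ℕ.≤-trans
            (subst (rk y ≤_) (ℕ.+-suc _ k) l) (ℕ.+-monoˡ-≤ k x<v)))
      in D″ , x″ , y″ , S″ , i , ℕ.≤-trans (ℕ.<⇒≤ x<v) p , ℕ.≤-trans q y′≤y
    ...   | D′ , x′ , y′ , S′ , inj₂ refl =
      let x≤x′ = ℕ.≮⇒≥ λ x′<x → untangled S′ S (x′<x , x<v , v<y)
          D″ , x″ , y″ , S″ , i , p , q = go k S′ (ℕ.≤-trans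
            (ℕ.s≤s⁻¹ (ℕ.≤-trans v<y (subst (rk y ≤_) (ℕ.+-suc _ k) l))) (ℕ.+-monoˡ-≤ k x≤x′))
      in D″ , x″ , y″ , S″ , i , ℕ.≤-trans x≤x′ p , ℕ.≤-trans q (ℕ.<⇒≤ v<y)

  module _ (nested : ∀ {D D′ x y x′ y′} → Span D x y → Span D′ x′ y′ → Nested x y x′ y′) where

    nested⇒untangled : Span D x y → Span D′ x′ y′ → ¬ (rk x < rk x′ × rk x′ < rk y × rk y < rk y′)
    nested⇒untangled S S′ (x<x′ , _ , y<y′) with nested S S′
    ... | inj₁ (_ , l) = ℕ.<⇒≱ y<y′ l
    ... | inj₂ (l , _) = ℕ.<⇒≱ x<x′ l

    enlarging : Span D x y → Span D′ x′ y′ → Nested x y x′ y′ → v ≡ x′ ⊎ v ≡ y′ → ¬ (rk x ≤ rk v × rk v ≤ rk y) →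
                (rk x′ ≤ rk x × rk y ≤ rk y′) × (rk x′ < rk x ⊎ rk y < rk y′)
    enlarging S S′ (inj₁ (p , q)) (inj₁ refl) out = contradiction (p , ℕ.≤-trans (ℕ.<⇒≤ (Span.x<y S′)) q) out
    enlarging S S′ (inj₁ (p , q)) (inj₂ refl) out = contradiction (ℕ.≤-trans p (ℕ.<⇒≤ (Span.x<y S′)) , q) out
    enlarging {x = x} {x′ = x′} S S′ (inj₂ (p , q)) (inj₁ refl) out = (p , q) , inj₁ (ℕ.≰⇒> λ l →
      out (l , ℕ.≤-trans p (ℕ.<⇒≤ (Span.x<y S))))
    enlarging S S′ (inj₂ (p , q)) (inj₂ refl) out = (p , q) , inj₂ (ℕ.≰⇒> λ r →
      out (ℕ.≤-trans (ℕ.<⇒≤ (Span.x<y S)) q , r))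

    -- The measure is the number of ranks outside the span, `rk x + (rk z - rk y)`, written without
    -- subtraction; `rk x + rk z` is a crude initial bound for it.
    outermost : Span D x y → ∃[ D′ ] ∃₂ λ x′ y′ → Span D′ x′ y′ × Outermost x′ y′
    outermost {x = x} {y} S = go (rk x + rk z) S (ℕ.m≤n+m (rk x + rk z) (rk y))
      where
      go : ∀ k {D x y} → Span D x y → rk x + rk z ≤ rk y + k → ∃[ D′ ] ∃₂ λ x′ y′ → Span D′ x′ y′ × Outermost x′ y′
      go k {D} {x} {y} S l with any? (λ v → attached? v ×-dec ¬? ((rk x ℕ.≤? rk v) ×-dec (rk v ℕ.≤? rk y)))
      ... | no none = D , x , y , S , bound
        where
        bound : Outermost x y
        bound {v} av with (rk x ℕ.≤? rk v) ×-dec (rk v ℕ.≤? rk y)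
        ... | yes b = b
        ... | no ¬b = contradiction (v , av , ¬b) none
      ... | yes (v , av , out) with attached⇒span′ av
      ... | D′ , x′ , y′ , S′ , v≡ = enlarge k l
        where
        enlarged : (rk x′ ≤ rk x × rk y ≤ rk y′) × (rk x′ < rk x ⊎ rk y < rk y′)
        enlarged = enlarging S S′ (nested S S′) v≡ out
        larger = proj₁ enlarged
        strict = proj₂ enlarged
        sum-< : rk x′ + rk z < suc (rk x + rk z)
        sum-< = s≤s (ℕ.+-monoˡ-≤ (rk z) (proj₁ larger))
        grows : ∀ k → rk x + rk z ≤ rk y + k → suc (rk x′ + rk z) ≤ rk y′ + k
        grows k l with strict
        ... | inj₁ p = ℕ.≤-trans (ℕ.+-monoˡ-≤ (rk z) p) (ℕ.≤-trans l (ℕ.+-monoˡ-≤ k (proj₂ larger)))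
        ... | inj₂ q = ℕ.≤-trans sum-< (ℕ.≤-trans (s≤s l) (ℕ.+-monoˡ-≤ k q))
        enlarge : ∀ k → rk x + rk z ≤ rk y + k → ∃[ D′ ] ∃₂ λ x′ y′ → Span D′ x′ y′ × Outermost x′ y′
        -- No rank is left outside the span, so a larger span would have to end beyond `z`.
        enlarge zero l = contradiction
          (ℕ.≤-trans (subst (suc (rk x′ + rk z) ≤_) (ℕ.+-identityʳ _) (grows zero l)) (rk≤rk-z (Span.onʳ S′)))
          (ℕ.<⇒≱ (s≤s (ℕ.m≤n+m _ _)))
        enlarge (suc k) l = go k S′ (ℕ.s≤s⁻¹ (subst (suc (rk x′ + rk z) ≤_) (ℕ.+-suc _ k) (grows (suc k) l)))

    -- A span inside an innermost one has no end strictly inside it, hence has the same ends.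
    innermost-⊆ : (S : Span D x y) → Innermost x y → (S′ : Span D′ x′ y′) → rk x′ ≤ rk x × rk y ≤ rk y′
    innermost-⊆ {x = x} {y} {D′} {x′} {y′} S i S′ with nested S S′
    ... | inj₂ r = r
    ... | inj₁ (p , q) =
      ℕ.≮⇒≥ (λ l → i (D′ , Span.attˡ S′) (l , ℕ.<-≤-trans (Span.x<y S′) q)) ,
      ℕ.≮⇒≥ (λ l → i (D′ , Span.attʳ S′) (ℕ.≤-<-trans p (Span.x<y S′) , l))

    -- Every span contains the innermost one, so the bridge of the detour bypasses it. An edge of
    -- the inner handle before or after the bridge would have both ends at the rank of `x` or both
    -- at the rank of `y`.
    detour-avoids : (S : Span D x y) → Innermost x y → f ∈ₑ Arc.walk S → {q : Walk a z} → Detour q → Simple q → ¬ f ∈ₑ q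
    detour-avoids {x = x} {y} {f} S i f∈S {q} d s f∈q with ∈ₑ-·⁻ before (subst (f ∈ₑ_) split f∈q)
      where open Detour d
    ... | inj₁ k = edge-not-level (A.edges⊆ f∈S) λ inc → ℕ.≤-antisym
        (ℕ.≤-trans (Z.below (Incident⇒∈ᵥ Z.walk (onSegment k) inc)) (proj₁ (innermost-⊆ S i span′))) (A.above (Incident⇒∈ᵥ A.walk f∈S inc))
      where
      open Detour d renaming (span to span′)
      module A = Arc S
      module Z = Segment (segment (start∈ p₀) (Span.onˡ span′) rk-a≤)
      onSegment : f ∈ₑ before → f ∈ₑ Z.walk
      onSegment = arc-edges before Z.walk (Simple-·ˡ before (subst Simple split s)) Z.simple (p₀⊆C ∘ before⊆) (p₀⊆C ∘ Z.edges⊆)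
        (⊥-elim ∘ e∉p₀ ∘ before⊆) (⊥-elim ∘ e∉p₀ ∘ Z.edges⊆)
    ... | inj₂ k with ∈ₑ-·⁻ (Detour.path d) k
    ...   | inj₁ l = ∈ᴮ⇒∉C (Detour.bridge d) (Detour.path⊆ d l) (p₀⊆C (Arc.edges⊆ S f∈S))
    ...   | inj₂ l = edge-not-level (A.edges⊆ f∈S) λ inc → ℕ.≤-antisym (A.below (Incident⇒∈ᵥ A.walk f∈S inc))
        (ℕ.≤-trans (proj₂ (innermost-⊆ S i span′)) (Z.above (Incident⇒∈ᵥ Z.walk (onSegment l) inc)))
      where
      open Detour d renaming (span to span′)
      module A = Arc S
      module Z = Segment (segment (Span.onʳ span′) (end∈ p₀) (rk≤rk-z (Span.onʳ span′)))
      onSegment : f ∈ₑ after → f ∈ₑ Z.walk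
      onSegment = arc-edges after Z.walk (Simple-·ʳ path (Simple-·ʳ before (subst Simple split s))) Z.simple (p₀⊆C ∘ after⊆) (p₀⊆C ∘ Z.edges⊆)
        (⊥-elim ∘ e∉p₀ ∘ after⊆) (⊥-elim ∘ e∉p₀ ∘ Z.edges⊆)

    innermost-unique : (S : Span D x y) → Innermost x y → (S′ : Span D′ x′ y′) → Innermost x′ y′ → x ≡ x′ × y ≡ y′
    innermost-unique S i S′ i′ =
      let p , q = innermost-⊆ S i S′ ; p′ , q′ = innermost-⊆ S′ i′ S in
      rk-injective (Span.onˡ S) (Span.onˡ S′) (ℕ.≤-antisym p′ p) , rk-injective (Span.onʳ S) (Span.onʳ S′) (ℕ.≤-antisym q q′)

    twoHandled : Span D x y → TwoHandled
    twoHandled S = record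
      { noCrossing = λ i j _ κ → noCross κ (proj₂ (proj₂ (span i))) (proj₂ (proj₂ (span j)))
      ; twoHandles = two }
      where
      noCross : Cross D D′ → Span D x y → Span D′ x′ y′ → Empty
      noCross κ S S′ with nested S S′
      ... | inj₁ (p , q) = NoCross.nested⇒¬Cross κ (Span.onˡ S) (Span.onʳ S) (Span.onˡ S′) (Span.onʳ S′) (Span.x<y S′) p q λ
        { (inj₁ refl) c → inj₁ (JoinsChord-unique c (span⇒chord S)) ; (inj₂ refl) c → inj₂ (JoinsChord-unique c (span⇒chord S′)) }
      ... | inj₂ (p , q) = NoCross.nested⇒¬Cross κ (Span.onˡ S′) (Span.onʳ S′) (Span.onˡ S) (Span.onʳ S) (Span.x<y S) p q λ
        { (inj₁ refl) c → inj₂ (JoinsChord-unique c (span⇒chord S)) ; (inj₂ refl) c → inj₁ (JoinsChord-unique c (span⇒chord S′)) }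
      two : ∃₂ λ H₁ H₂ → H₁ ≢ H₂ × IsHandle H₁ × IsHandle H₂ × (∀ H → IsHandle H → H ≡ H₁ ⊎ H ≡ H₂)
      two with innermost nested⇒untangled S | outermost S
      ... | D₁ , x₁ , y₁ , S₁ , i₁ , _ | D₂ , x₂ , y₂ , S₂ , o₂ =
        edgeSet (Arc.walk S₁) , edgeSet (Arc.outer S₂) , (λ eq → e∉inner S₁ (subst (e ∈_) (sym eq) (e∈outer′ S₂))) ,
        innerHandle S₁ i₁ , outerHandle S₂ o₂ , λ H h → classify (handleForm h)
        where
        classify : HandleForm H → H ≡ edgeSet (Arc.walk S₁) ⊎ H ≡ edgeSet (Arc.outer S₂)
        classify (inner S i refl) with innermost-unique S i S₁ i₁
        ... | refl , refl = inj₁ (arc-edgeSet A.walk B.walk A.simple B.simple (p₀⊆C ∘ A.edges⊆) (p₀⊆C ∘ B.edges⊆)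
                              (⊥-elim ∘ segment-e∉ A.between-ends) (⊥-elim ∘ segment-e∉ B.between-ends))
          where
          module A = Arc S
          module B = Arc S₁
        classify (outer {D} {x} {y} S o refl) with rk-injective (Span.onˡ S) (Span.onˡ S₂) (ℕ.≤-antisym
                (proj₁ (o (D₂ , Span.attˡ S₂))) (proj₁ (o₂ (D , Span.attˡ S))))
            | rk-injective (Span.onʳ S) (Span.onʳ S₂) (ℕ.≤-antisym
                (proj₂ (o₂ (D , Span.attʳ S))) (proj₂ (o (D₂ , Span.attʳ S₂))))
        ... | refl | refl = inj₂ (arc-edgeSet A.outer B.outer A.outer-simple B.outer-simple A.outer⊆C B.outer⊆C
                              (λ _ → B.e∈outer) (λ _ → A.e∈outer))
          where
          module A = Arc S
          module B = Arc S₂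

  module _ (layered : TwoHandled) {H : Subset m} (handle : IsHandle H) (e∈H : e ∈ H) where
    open TwoHandled layered

    twoHandled⇒untangled : Span D x y → Span D′ x′ y′ → ¬ (rk x < rk x′ × rk x′ < rk y × rk y < rk y′)
    twoHandled⇒untangled {D} {x} {y} {D′} {x′} {y′} S S′ (x<x′ , x′<y , y<y′) =
      noCrossing D D′ (λ { refl → ℕ.<-irrefl (cong rk (proj₁ (Span-same S S′ λ v → mk⇔ id id))) x<x′ })
        (interleaved⇒Cross (Span.onˡ S) (Span.onˡ S′) (Span.onʳ S) (Span.onʳ S′) x<x′ x′<y y<y′ (span⇒chord S) (span⇒chord S′))

    -- One of the two handles is `H`, which contains `e`, so a single one is left for handles
    -- avoiding `e`.
    two-only : ∀ {H₁ H₂} → IsHandle H₁ → IsHandle H₂ → e ∉ H₁ → e ∉ H₂ → H₁ ≡ H₂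
    two-only h₁ h₂ e∉₁ e∉₂ with twoHandles
    ... | K₁ , K₂ , _ , _ , _ , all with all _ handle | all _ h₁ | all _ h₂
    ... | _ | inj₁ refl | inj₁ refl = refl
    ... | _ | inj₂ refl | inj₂ refl = refl
    ... | inj₁ refl | inj₁ refl | inj₂ _ = contradiction e∈H e∉₁
    ... | inj₁ refl | inj₂ _ | inj₁ refl = contradiction e∈H e∉₂
    ... | inj₂ refl | inj₁ _ | inj₂ refl = contradiction e∈H e∉₂
    ... | inj₂ refl | inj₂ refl | inj₁ _ = contradiction e∈H e∉₁

    twoHandled⇒nested : Span D x y → Span D′ x′ y′ → Nested x y x′ y′
    twoHandled⇒nested S S′ = unstaggered⇒nested (staggered S S′) (staggered S′ S)
      where
      staggered : Span D x y → Span D′ x′ y′ → ¬ (rk x < rk x′ × rk y < rk y′)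
      staggered {x = x} {y} {x′ = x′} {y′} S S′ (x<x′ , y<y′) with rk x′ ℕ.<? rk y
      ... | yes x′<y = twoHandled⇒untangled S S′ (x<x′ , x′<y , y<y′)
      -- Spans without overlap contain innermost spans of their own. Both inner handles avoid `e`
      -- and so coincide by `two-only`; an edge of theirs would have both ends at rank `rk y`.
      ... | no x′≮y with innermost twoHandled⇒untangled S | innermost twoHandled⇒untangled S′
      ... | D₁ , x₁ , y₁ , S₁ , i₁ , _ , y₁≤y | D₂ , x₂ , y₂ , S₂ , i₂ , x′≤x₂ , _ =
        let f , f∈ , _ = ∈ᵥ⇒Incident A.walk A.x≢y (start∈ A.walk)
            f∈′ = ∈-edgeSet⁻ B.walk (subst (f ∈_) (two-only (innerHandle S₁ i₁) (innerHandle S₂ i₂) (e∉inner S₁) (e∉inner S₂))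
                    (∈-edgeSet⁺ A.walk f∈))
            low : ∀ {v} → Incident f v → rk v ≤ rk y
            low i = ℕ.≤-trans (A.below (Incident⇒∈ᵥ A.walk f∈ i)) y₁≤y
            high : ∀ {v} → Incident f v → rk y ≤ rk v
            high i = ℕ.≤-trans (ℕ.≮⇒≥ x′≮y) (ℕ.≤-trans x′≤x₂ (B.above (Incident⇒∈ᵥ B.walk f∈′ i)))
        in edge-not-level (A.edges⊆ f∈) λ i → ℕ.≤-antisym (low i) (high i)
        where
        module A = Arc S₁
        module B = Arc S₂

-- Signs of paths under a signature with a single negative edge.

module Marking {n m : ℕ} (G : Graph (Fin n) (Fin m)) (τ : Fin m → Sign) {b : Fin m}
               (marks : ∀ x → τ x ≡ Sign.- ⇔ x ≡ b) where
  open Circles G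
  private variable
    u w : Fin n

  τ-b : τ b ≡ Sign.-
  τ-b = Equivalence.from (marks b) refl

  τ-other : ∀ {x} → x ≢ b → τ x ≡ Sign.+
  τ-other {x} x≢b with τ x in eq
  ... | Sign.+ = refl
  ... | Sign.- = contradiction (Equivalence.to (marks x) eq) x≢b

  walkSign-unmarked : (p : Walk u w) → ¬ b ∈ₑ p → walkSign τ p ≡ Sign.+
  walkSign-unmarked []           _  = refl
  walkSign-unmarked (step x j p) b∉ =
    cong₂ _*_ (τ-other λ { refl → b∉ (here refl) }) (walkSign-unmarked p (b∉ ∘ there))

  walkSign-marked : (p : Walk u w) → Unique (edges p) → b ∈ₑ p → walkSign τ p ≡ Sign.-
  walkSign-marked (step x j p) (a ∷ _) (here refl) =
    cong₂ _*_ τ-b (walkSign-unmarked p λ i → All.lookup a i refl)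
  walkSign-marked (step x j p) (a ∷ s) (there i) =
    cong₂ _*_ (τ-other (All.lookup a i)) (walkSign-marked p s i)

circle⇒route : ∀ {n m} {G : Graph (Fin n) (Fin m)} → Circles.Loopless G →
               ∀ {C e} → Circles.IsCircle G C → e ∈ C → Route G C e
circle⇒route {G = G} loopless circle e∈ =
  let z , j = Circles.Incident⇒Joins G _ (inj₁ refl)
      p , s , e∉ , eq = Circles.CirclesLoopless.circle⇒path G loopless circle j e∈
  in record { eⱼ = j ; p₀ = p ; simple₀ = s ; e∉p₀ = e∉ ; C≡ = eq }

-- The two directions of the characterisation.

module Batteries {n m : ℕ} (B : SignedGraph n m) (block : SignedGraph.IsBlock B) (m≢1 : m ≢ 1)
  (¬circle⊤ : ¬ SignedGraph.IsCircle B ⊤) {e : Fin m} {C : Subset m}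
  (circle : SignedGraph.IsCircle B C) (route : Route (SignedGraph.graph B) C e) where

  open SignedGraph B using (graph; signature; sign; switch; IsBalancingEdge; Battery; OnHandle;
    OtherHandleBalances; BridgePathsNegative; Layered; Bridge)
  open Circles graph
  open Components graph
  open FiniteGraph.IsBlock block

  private variable
    u v w x y : Fin n
    D : Bridge C

  private
    σ : Fin m → Sign
    σ = signature

    loopless : Loopless
    loopless = IsBlock⇒Loopless block m≢1

  open CirclesLoopless loopless

  open Route route
  open CircleThrough loopless route
  open Signs σ

  sign-circuit : (q : Walk a z) → Simple q → ¬ e ∈ₑ q → sign (circuit e q) ≡ σ e * walkSign σ q
  sign-circuit q = product-circuit σ q

  sign-C : sign C ≡ σ e * walkSign σ p₀
  sign-C = trans (cong sign (sym C≡)) (sign-circuit p₀ simple₀ e∉p₀)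

  mkBattery : ∀ {s} → sign C ≡ s →
              ((q : Walk a z) → Simple q → ¬ e ∈ₑ q → σ e * walkSign σ q ≡ s → circuit e q ≡ C) → Battery e C s
  mkBattery {s} eq unique = record
    { isCircle = circle ; hasSign = eq ; contains = e∈C
    ; unique = λ C′ c s′ i → let q , sq , e∉ , q≡ = circle⇒path c eⱼ i in
        trans (sym q≡) (unique q sq e∉ (trans (sym (sign-circuit q sq e∉)) (trans (cong sign q≡) s′))) }

  along⇒C : (q : Walk a z) → Simple q → (∀ {f} → f ∈ₑ q → f ∈ₑ p₀) → circuit e q ≡ C
  along⇒C q s q⊆ = circle-minimal circle (circuit-IsCircle eⱼ q s (e∉p₀ ∘ q⊆))
    λ i → case ∈-circuit⁻ q i of λ { (inj₁ refl) → e∈C ; (inj₂ k) → p₀⊆C (q⊆ k) }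

  sign-union : (P Q : Walk u w) → Simple P → Simple Q → (∀ {f} → f ∈ₑ P → f ∉ C) → (∀ {f} → f ∈ₑ Q → f ∈ C) →
               sign (edgeSet P ∪ edgeSet Q) ≡ walkSign σ P * walkSign σ Q
  sign-union P Q sP sQ P∉ Q∈ = trans (product-∪ σ (edgeSet P) (edgeSet Q) λ i k → P∉ (∈-edgeSet⁻ P i) (Q∈ (∈-edgeSet⁻ Q k)))
    (cong₂ _*_ (product-edgeSet σ P sP) (product-edgeSet σ Q sQ))

  -- As `C` is not the whole graph, an edge lies outside it. On a walk from `a` towards that edge,
  -- the first edge outside `C` starts on `C` and so belongs to a bridge.
  someBridge : Bridge C
  someBridge with any? (λ f → ¬? (f ∈? C))
  ... | no none = contradiction (subst (SignedGraph.IsCircle B) C≡⊤ circle) ¬circle⊤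
    where
    C≡⊤ : C ≡ ⊤
    C≡⊤ = ⊆-antisym (λ _ → ∈⊤) λ {f} _ → case f ∈? C of λ { (yes i) → i ; (no f∉) → contradiction (f , f∉) none }
  ... | yes (f , f∉) = find (connected a (proj₁ (ends f))) (start∈ p₀)
    where
    find : Walk u (proj₁ (ends f)) → On u → Bridge C
    find []           u∈ = proj₁ (bridgeAt u∈ (inj₁ refl) f∉)
    find (step g j p) u∈ with g ∈? C
    ... | no g∉ = proj₁ (bridgeAt u∈ (Joins⇒Incidentˡ j) g∉)
    ... | yes g∈ = find p (Touches⇒On (g , g∈ , Joins⇒Incidentʳ j))

  module FromLayered (L : Layered C) (onHandle : OnHandle C L e) where
    open FiniteGraph.Layered L using (twoAttachments; twoHandled)
    open Handles loopless route (λ D → proj₁ (twoAttachments D)) (λ D → proj₂ (twoAttachments D))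
      hiding (twoHandled)

    nested : ∀ {D D′ x y x′ y′} → Span D x y → Span D′ x′ y′ → Nested x y x′ y′
    nested = twoHandled⇒nested twoHandled (proj₁ (proj₂ onHandle)) (proj₂ (proj₂ onHandle))

    -- Switching preserves the signs of circles, so a circle through `e` is negative exactly if it
    -- contains `b`. A detour misses the inner handle and with it `b`; therefore `C` is the only
    -- negative circle through `e`.
    otherHandle⇒battery : OtherHandleBalances C L e → Battery e C Sign.-
    otherHandle⇒battery (H , handle , e∉H , b , b∈H , ζ , switched) with handleForm handle
    ... | outer S _ refl = contradiction (e∈outer′ S) e∉H
    ... | inner S i refl = mkBattery negative unique
      where
      σ′ = switch ζ
      open Marking graph σ′ switched
      b∈S = ∈-edgeSet⁻ (Arc.walk S) b∈H
      b∈p₀ = Arc.edges⊆ S b∈S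
      e≢b : e ≢ b
      e≢b refl = e∉p₀ b∈p₀
      switch-joins : ∀ {f u v} → Joins f u v → σ′ f ≡ (ζ u * σ f) * ζ v
      switch-joins (inj₁ eq) rewrite eq = refl
      switch-joins {f} {u} {v} (inj₂ eq) rewrite eq = trans (Sign.*-comm _ (ζ u))
        (trans (cong (ζ u *_) (Sign.*-comm (ζ v) (σ f))) (sym (Sign.*-assoc (ζ u) _ _)))
      walkSign-switch : (p : Walk u w) → walkSign σ′ p ≡ (ζ u * walkSign σ p) * ζ w
      walkSign-switch {u} [] = sym (trans (cong (_* ζ u) (Sign.*-identityʳ (ζ u))) (Sign.s*s≡+ (ζ u)))
      walkSign-switch {u} {w} (step {v = v} f j p) =
        trans (cong₂ _*_ (switch-joins j) (walkSign-switch p)) (cancel (ζ u) (σ f) (ζ v) (walkSign σ p) (ζ w))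
        where
        cancel : ∀ u f v p w → ((u * f) * v) * ((v * p) * w) ≡ (u * (f * p)) * w
        cancel = from-yes (∀⁵ λ u f v p w → ((u * f) * v) * ((v * p) * w) Sign.≟ (u * (f * p)) * w)
      switch-circuit : (q : Walk a z) → σ e * walkSign σ q ≡ walkSign σ′ q
      switch-circuit q = cancel (ζ a) (σ e) (ζ z) (walkSign σ q) _ (trans (sym (switch-joins eⱼ)) (τ-other e≢b)) (walkSign-switch q)
        where
        cancel : ∀ a e z q q′ → (a * e) * z ≡ Sign.+ → q′ ≡ (a * q) * z → e * q ≡ q′
        cancel = from-yes (∀⁵ λ a e z q q′ → ((a * e) * z Sign.≟ Sign.+) →-dec ((q′ Sign.≟ (a * q) * z) →-dec (e * q Sign.≟ q′)))
      negative : sign C ≡ Sign.-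
      negative = trans sign-C (trans (switch-circuit p₀) (walkSign-marked p₀ (Simple⇒Unique-edges p₀ simple₀) b∈p₀))
      unique : (q : Walk a z) → Simple q → ¬ e ∈ₑ q → σ e * walkSign σ q ≡ Sign.- → circuit e q ≡ C
      unique q s e∉ neg with shape span nested q s e∉
      ... | inj₁ q⊆ = along⇒C q s q⊆
      ... | inj₂ d = contradiction
        (trans (sym neg) (trans (switch-circuit q) (walkSign-unmarked q (detour-avoids nested S i b∈S d s)))) λ ()

    bridgePaths⇒battery : BridgePathsNegative C → Battery e C Sign.+
    bridgePaths⇒battery bpn = mkBattery positive unique
      where
      outer-sign : (S : Span D x y) (P : Walk x y) → Simple P → (∀ {f} → f ∈ₑ P → f ∈ᴮ D) →
                   walkSign σ P * walkSign σ (Arc.outer S) ≡ Sign.-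
      outer-sign {D} S P sP P⊆ = trans (sym (sign-union P A.outer sP A.outer-simple (∈ᴮ⇒∉C D ∘ P⊆) A.outer⊆C))
        (bpn D _ _ A.x≢y A.attˡ A.attʳ P (sP , All.tabulate P⊆) A.outer (A.outer-simple , All.tabulate A.outer⊆C))
        where module A = Arc S
      inner-sign : (S : Span D x y) (P : Walk x y) → Simple P → (∀ {f} → f ∈ₑ P → f ∈ᴮ D) →
                   walkSign σ P * walkSign σ (Arc.walk S) ≡ Sign.-
      inner-sign {D} S P sP P⊆ = trans (sym (sign-union P A.walk sP A.simple (∈ᴮ⇒∉C D ∘ P⊆) (p₀⊆C ∘ A.edges⊆)))
        (bpn D _ _ A.x≢y A.attˡ A.attʳ P (sP , All.tabulate P⊆) A.walk (A.simple , All.tabulate (p₀⊆C ∘ A.edges⊆)))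
        where module A = Arc S
      -- The two circles formed by one ear and the two arcs of `C` are negative. The ear occurs in
      -- both, so their signs multiply to that of `C`.
      positive : sign C ≡ Sign.+
      positive with span someBridge
      ... | x , y , S = trans sign-C (trans (cong (σ e *_) (sym ψ-z))
        (combine (ψ x) (ψ y) (ψ z) (σ e) (walkSign σ E.path)
          (trans (cong (walkSign σ E.path *_) (sym (walkSign-along A.walk A.edges⊆))) (inner-sign S E.path E.simple E.within))
          (trans (cong (walkSign σ E.path *_) (sym (trans (A.walkSign-outer σ) (cong (λ t → ψ x * (σ e * (t * ψ y))) (sym ψ-z)))))
            (outer-sign S E.path E.simple E.within))))
        where
        module A = Arc S
        module E = Ear (ear someBridge A.attˡ A.attʳ A.x≢y)
        combine : ∀ x y z e p → p * (x * y) ≡ Sign.- → p * (x * (e * (z * y))) ≡ Sign.- → e * z ≡ Sign.+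
        combine = from-yes (∀⁵ λ x y z e p → (p * (x * y) Sign.≟ Sign.-) →-dec ((p * (x * (e * (z * y))) Sign.≟ Sign.-) →-dec
          (e * z Sign.≟ Sign.+)))
      unique : (q : Walk a z) → Simple q → ¬ e ∈ₑ q → σ e * walkSign σ q ≡ Sign.+ → circuit e q ≡ C
      unique q s e∉ pos with shape span nested q s e∉
      ... | inj₁ q⊆ = along⇒C q s q⊆
      ... | inj₂ d = contradiction (trans (sym pos) (trans sign-q (outer-sign S path simple-path path⊆))) λ ()
        where
        open Detour d renaming (span to S)
        module A = Arc S
        simple-path : Simple path
        simple-path = Simple-·ˡ path (Simple-·ʳ before (subst Simple split s))
        rearrange : ∀ x y z e p → e * (x * (p * (y * z))) ≡ p * (x * (e * (z * y)))
        rearrange = from-yes (∀⁵ λ x y z e p → e * (x * (p * (y * z))) Sign.≟ p * (x * (e * (z * y))))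
        -- Together with `e`, the pieces of the detour on `p₀` have the sign of the outer arc. The
        -- circle thus has the sign of one of the circles in the hypothesis, which is negative.
        sign-q : σ e * walkSign σ q ≡ walkSign σ path * walkSign σ A.outer
        sign-q = trans (cong (σ e *_) (trans (cong (walkSign σ) split) (trans (walkSign-· σ before _) (cong₂ _*_
            (trans (walkSign-along before before⊆) (cong (_* ψ from) ψ-a))
            (trans (walkSign-· σ path _) (cong (walkSign σ path *_) (walkSign-along after after⊆)))))))
          (trans (rearrange (ψ from) (ψ to) (ψ z) (σ e) (walkSign σ path))
            (cong (walkSign σ path *_) (sym (trans (A.walkSign-outer σ)
              (cong (λ t → ψ from * (σ e * (t * ψ to))) (sym ψ-z))))))

  module FromBattery {s : Sign} (battery : Battery e C s) where
    open SignedGraph.Battery battery using (hasSign; unique)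

    -- With the sign of `p₀`, the path would close up to a second circle through `e` of sign `s`.
    negates : (q : Walk a z) → Simple q → ¬ e ∈ₑ q → (∃[ f ] f ∈ₑ q × f ∉ C) → walkSign σ q ≡ opposite (walkSign σ p₀)
    negates q sq e∉ (f , f∈ , f∉) with walkSign σ q Sign.≟ walkSign σ p₀
    ... | yes eq = contradiction (subst (f ∈_) (unique (circuit e q) (circuit-IsCircle eⱼ q sq e∉)
            (trans (sign-circuit q sq e∉) (trans (cong (σ e *_) eq) (trans (sym sign-C) hasSign))) (e∈circuit q))
            (∈-circuit⁺ q f∈)) f∉
    ... | no ne = other _ _ ne
      where
      other : ∀ s t → s ≢ t → s ≡ opposite t
      other = from-yes (∀² λ s t → ¬? (s Sign.≟ t) →-dec (s Sign.≟ opposite t))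

    open Unique-path connected noCutpoint σ negates

    module Layering (spans : ∀ D → ∃₂ λ x y → Span D x y)
                    (nested : ∀ {D D′ x y x′ y′} → Span D x y → Span D′ x′ y′ → Nested x y x′ y′) where

      private
        chordEnds : Bridge C → Fin n × Fin n
        chordEnds D = proj₁ (spans D) , proj₁ (proj₂ (spans D))

        exact : ∀ D → FiniteGraph.AttachedExactlyAt graph C D (chordEnds D)
        exact D = Span.x≢y S , λ v → mk⇔ (Span.only S) [ (λ { refl → Span.attˡ S }) , (λ { refl → Span.attʳ S }) ]′
          where S = proj₂ (proj₂ (spans D))

      open Handles loopless route chordEnds exact

      private
        S₀ = proj₂ (proj₂ (spans someBridge))

      layered : Layered C
      layered = record
        { twoAttachments = λ D → chordEnds D , exact D
        ; twoHandled = twoHandled nested S₀ }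

      onHandle : OnHandle C layered e
      onHandle = let D , x , y , S , o = outermost nested S₀ in
        edgeSet (Arc.outer S) , outerHandle S o , e∈outer′ S

      -- Negating `b` changes the sign of `C` and of no other circle through `e`. A potential for
      -- `σ′` is at the same time a switching function that turns `σ` into `τ`, whose only negative
      -- edge is `b`.
      balancing : s ≡ Sign.- → (S : Span D x y) → Innermost x y → ∀ {b} → b ∈ₑ Arc.walk S → IsBalancingEdge b
      balancing refl S i {b} b∈S = ζ , switched
        where
        τ : Fin m → Sign
        τ x = if does (x ≟ b) then Sign.- else Sign.+
        marks : ∀ x → τ x ≡ Sign.- ⇔ x ≡ b
        marks x with x ≟ b
        ... | yes eq = mk⇔ (λ _ → eq) (λ _ → refl)
        ... | no ne = mk⇔ (λ ()) (λ eq → contradiction eq ne)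
        open Marking graph τ marks
        σ′ : Fin m → Sign
        σ′ x = σ x * τ x
        walkSign-σ′ : (p : Walk u w) → walkSign σ′ p ≡ walkSign σ p * walkSign τ p
        walkSign-σ′ []           = refl
        walkSign-σ′ (step f j p) = trans (cong (σ′ f *_) (walkSign-σ′ p)) (rearrange (σ f) (τ f) _ _)
          where
          rearrange : ∀ a b c d → (a * b) * (c * d) ≡ (a * c) * (b * d)
          rearrange = from-yes (∀⁴ λ a b c d → (a * b) * (c * d) Sign.≟ (a * c) * (b * d))
        b∈p₀ = Arc.edges⊆ S b∈S
        positive : (q : Walk a z) → Simple q → ¬ e ∈ₑ q → σ′ e * walkSign σ′ q ≡ Sign.+
        positive q sq e∉ = combine (σ e) (τ e) (walkSign σ p₀) _ _ (trans (sym sign-C) hasSign)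
            (τ-other {e} λ e≡b → e∉p₀ (subst (_∈ₑ p₀) (sym e≡b) b∈p₀)) (by-shape (shape spans nested q sq e∉)) (walkSign-σ′ q)
          where
          by-shape : (∀ {f} → f ∈ₑ q → f ∈ₑ p₀) ⊎ Detour q → walkSign σ q * walkSign τ q ≡ opposite (walkSign σ p₀)
          by-shape (inj₁ q⊆) = trans (cong₂ _*_ (trans (walkSign-along q q⊆) (trans (cong (_* ψ z) ψ-a) ψ-z))
              (walkSign-marked q (Simple⇒Unique-edges q sq) (arc-edges p₀ q simple₀ sq p₀⊆C (p₀⊆C ∘ q⊆)
                (⊥-elim ∘ e∉p₀) (⊥-elim ∘ e∉) b∈p₀)))
            (negate (walkSign σ p₀))
            where
            negate : ∀ s → s * Sign.- ≡ opposite s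
            negate Sign.+ = refl
            negate Sign.- = refl
          by-shape (inj₂ d) = trans (cong₂ _*_
              (negates q sq e∉ (let f , f∈ , _ = ∈ᵥ⇒Incident path (Span.x≢y span′) (start∈ path) in
                f , subst (f ∈ₑ_) (sym split) (∈ₑ-·ʳ before (∈ₑ-·ˡ path f∈)) , ∈ᴮ⇒∉C bridge (path⊆ f∈)))
              (walkSign-unmarked q (detour-avoids nested S i b∈S d sq))) (Sign.*-identityʳ _)
            where open Detour d renaming (span to span′)
          combine : ∀ e t s q′ r → e * s ≡ Sign.- → t ≡ Sign.+ → r ≡ opposite s → q′ ≡ r → (e * t) * q′ ≡ Sign.+
          combine = from-yes (∀⁵ λ e t s q′ r → (e * s Sign.≟ Sign.-) →-dec ((t Sign.≟ Sign.+) →-dec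
            ((r Sign.≟ opposite s) →-dec ((q′ Sign.≟ r) →-dec ((e * t) * q′ Sign.≟ Sign.+)))))
        balance = Balance.balanced graph loopless connected noCutpoint σ′ eⱼ positive
        ζ = proj₁ balance
        switch≡τ : ∀ x → switch ζ x ≡ τ x
        switch≡τ x = cancel (ζ (proj₁ (ends x))) (σ x) (ζ (proj₂ (ends x))) (τ x) (proj₂ balance (inj₁ refl))
          where
          cancel : ∀ u s v t → s * t ≡ u * v → (u * s) * v ≡ t
          cancel = from-yes (∀⁴ λ u s v t → (s * t Sign.≟ u * v) →-dec ((u * s) * v Sign.≟ t))
        switched : ∀ x → switch ζ x ≡ Sign.- ⇔ x ≡ b
        switched x = subst (λ t → t ≡ Sign.- ⇔ x ≡ b) (sym (switch≡τ x)) (marks x)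

      otherHandle : s ≡ Sign.- → OtherHandleBalances C layered e
      otherHandle s≡- =
        let D , x , y , S , i , _ = innermost (nested⇒untangled nested) S₀
            b , b∈S , _ = ∈ᵥ⇒Incident (Arc.walk S) (Arc.x≢y S) (start∈ (Arc.walk S))
        in edgeSet (Arc.walk S) , innerHandle S i , e∉inner S , b , ∈-edgeSet⁺ (Arc.walk S) b∈S , balancing s≡- S i b∈S

      -- As `C` is positive, both arcs between `x` and `y` have the sign `ψ x * ψ y`, and by
      -- `ear-sign` the path through the bridge has the opposite one.
      bridgePath-negative : s ≡ Sign.+ → (S : Span D x y) (P : Walk x y) → Simple P → (∀ {f} → f ∈ₑ P → f ∈ᴮ D) →
        (Q : Walk x y) → Simple Q → (∀ {f} → f ∈ₑ Q → f ∈ C) → walkSign σ P * walkSign σ Q ≡ Sign.-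
      bridgePath-negative {D} {x} {y} refl S P sP P⊆ Q sQ Q⊆ =
        combine (ψ x) (ψ y) (walkSign σ P) _ (ear-sign E A.onˡ A.onʳ A.x<y) Q-sign
        where
        module A = Arc S
        -- A path through the bridge meets `C` only in attachments, and those are its two ends; so
        -- it is an ear.
        E : Ear D x y
        E = record { path = P ; simple = sP ; within = P⊆ ; onC = λ i v∈ → let f , f∈ , inc = ∈ᵥ⇒Incident P A.x≢y i in
                       A.only (∈ᴮ⇒Att D (P⊆ f∈) inc v∈) }
        same-sign : (R : Walk x y) → Simple R → edgeSet Q ≡ edgeSet R → walkSign σ Q ≡ walkSign σ R
        same-sign R sR eq = trans (sym (product-edgeSet σ Q sQ)) (trans (cong sign eq) (product-edgeSet σ R sR))
        C-positive : σ e * walkSign σ p₀ ≡ Sign.+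
        C-positive = trans (sym sign-C) hasSign
        reduce : ∀ x y e s → e * s ≡ Sign.+ → x * (e * (s * y)) ≡ x * y
        reduce = from-yes (∀⁴ λ x y e s → (e * s Sign.≟ Sign.+) →-dec (x * (e * (s * y)) Sign.≟ x * y))
        Q-sign : walkSign σ Q ≡ ψ x * ψ y
        Q-sign with e ∈ₗ? edges Q
        ... | no e∉Q = trans (same-sign A.walk A.simple (arc-edgeSet Q A.walk sQ A.simple Q⊆ (p₀⊆C ∘ A.edges⊆)
                           (⊥-elim ∘ e∉Q) (⊥-elim ∘ segment-e∉ A.between-ends))) (walkSign-along A.walk A.edges⊆)
        ... | yes e∈Q = trans (same-sign A.outer A.outer-simple (arc-edgeSet Q A.outer sQ A.outer-simple Q⊆ A.outer⊆C
                           (λ _ → A.e∈outer) (λ _ → e∈Q))) (trans (A.walkSign-outer σ) (reduce (ψ x) (ψ y) (σ e) _ C-positive))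
        combine : ∀ x y p q → p ≡ opposite (x * y) → q ≡ x * y → p * q ≡ Sign.-
        combine = from-yes (∀⁴ λ x y p q → (p Sign.≟ opposite (x * y)) →-dec ((q Sign.≟ x * y) →-dec (p * q Sign.≟ Sign.-)))

      bridgePaths : s ≡ Sign.+ → BridgePathsNegative C
      bridgePaths s≡+ D u w u≢w au aw P (sP , PD) Q (sQ , QC) = trans
        (sign-union P Q sP sQ (∈ᴮ⇒∉C D ∘ All.lookup PD) (All.lookup QC)) (oriented (spans D))
        where
        oriented : (∃₂ λ x y → Span D x y) → walkSign σ P * walkSign σ Q ≡ Sign.-
        oriented (x , y , S) with Span.only S au | Span.only S aw
        ... | inj₁ refl | inj₁ refl = contradiction refl u≢w
        ... | inj₂ refl | inj₂ refl = contradiction refl u≢w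
        ... | inj₁ refl | inj₂ refl = bridgePath-negative s≡+ S P sP (All.lookup PD) Q sQ (All.lookup QC)
        ... | inj₂ refl | inj₁ refl = trans (sym (cong₂ _*_ (walkSign-reverse σ P) (walkSign-reverse σ Q)))
                (bridgePath-negative s≡+ S (reverse P) (Simple-reverse P sP) (All.lookup PD ∘ ∈ₑ-reverse⁻ P)
                  (reverse Q) (Simple-reverse Q sQ) (All.lookup QC ∘ ∈ₑ-reverse⁻ Q))

    open Layering spans nested public

mainTheorem3 : ∀ {n m : ℕ} (B : SignedGraph n m) →
    let open SignedGraph B in
    IsBlock → m ≢ 1 → ¬ IsCircle ⊤ →
    (e : Fin m) (C : Subset m) → IsCircle C → e ∈ C →
    ((Battery e C Sign.- ⊎ Battery e C Sign.+) ⇔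
    (Σ[ L ∈ Layered C ] OnHandle C L e ×
    (OtherHandleBalances C L e ⊎ BridgePathsNegative C))) ×
    ((L : Layered C) → OnHandle C L e → OtherHandleBalances C L e → Battery e C Sign.-) ×
    ((L : Layered C) → OnHandle C L e → BridgePathsNegative C → Battery e C Sign.+)
mainTheorem3 B block m≢1 ¬circle⊤ e C circle e∈C =
  mk⇔ (λ { (inj₁ b) → let open FromBattery b in layered , onHandle , inj₁ (otherHandle refl)
         ; (inj₂ b) → let open FromBattery b in layered , onHandle , inj₂ (bridgePaths refl) })
      (λ { (L , on , inj₁ o) → inj₁ (FromLayered.otherHandle⇒battery L on o)
         ; (L , on , inj₂ p) → inj₂ (FromLayered.bridgePaths⇒battery L on p) }) ,
  FromLayered.otherHandle⇒battery ,
  FromLayered.bridgePaths⇒battery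
  where
  loopless = Components.IsBlock⇒Loopless (SignedGraph.graph B) block m≢1
  open Batteries B block m≢1 ¬circle⊤ circle (circle⇒route loopless circle e∈C)
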